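{- Let $\tilde L_n^{(\tilde r,\tilde s)}(\alpha,x,y,z,a)$ be the generalized $q$-polynomials defined in the context. (i) For $|xt|<1$ and $\tilde r,\tilde s\in\mathbb{Z}^\ast$, we have $$\sum_{n=0}^\infty\tilde L_n^{(\tilde r,\tilde s)}(\alpha,x,y,z,a)\frac{t^n}{(q;q)_n}=\frac{(yt;q)_\infty}{(xt;q)_\infty}\sum_{k=0}^\infty\frac{(-q^{ -\alpha},a;q)_k}{(q^2;q^2)_k}\,q^{k\alpha+\tilde r\binom k2-\tilde s\binom{k+1}2}(zt)^k.$$ (ii) For $\tilde r=\tilde s=0$ in the identity of (i) and $\max\{|zt|,|xt|\}<1$, we recover the Cauchy polynomials $p_n(x,y)$ as follows: $$\sum_{n=0}^\infty\frac{p_n(x,y)\,t^n}{(q;q)_n}\sum_{k=0}^n\begin{bmatrix} n \\ k \end{bmatrix}_q\begin{bmatrix} \alpha \\ k \end{bmatrix}_{ -q}\frac{(-1)^kq^{k(k-n)}(a;q)_k}{p_k(y,xq^{1-n})}z^k=\frac{(yt;q)_\infty}{(xt;q)_\infty}\;{}_2\Phi_1\left[\begin{array}{c} -q^{ -\alpha},a \\ -q \end{array};q;ztq^{\alpha}\right].$$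
   Context: Throughout, $q$ is a fixed nonzero real or complex number with $|q|<1$, and $\alpha\in\mathbb{C}$. $\mathbb{Z}^\ast$ denotes the nonzero integers. Notation: $(a;q)_0=1$, $(a;q)_n=\prod_{k=0}^{n-1}(1-aq^k)$, $(a;q)_\infty=\prod_{k=0}^\infty(1-aq^k)$, $(a_1,\ldots,a_r;q)_n=(a_1;q)_n\cdots(a_r;q)_n$; similarly with base $q^2$. $q$-binomial coefficients: for $\alpha\in\mathbb{C}$ and integers $k\ge 0$, $$\begin{bmatrix} \alpha \\ k \end{bmatrix}_q=\frac{(q^{ -\alpha};q)_k}{(q;q)_k}(-1)^kq^{\alpha k-\binom k2},\qquad \begin{bmatrix} \alpha \\ k \end{bmatrix}_{ -q}=\frac{(-q^{ -\alpha};q)_k}{(-q;q)_k}q^{\alpha k-\binom k2}.$$ Cauchy polynomials: $p_n(x,y)=(x-y)(x-qy)\cdots(x-q^{n-1}y)=(y/x;q)_n\,x^n$, $p_0=1$. Generalized $q$-polynomials: $$\tilde L_n^{(\tilde r,\tilde s)}(\alpha,x,y,z,a)=\sum_{k=0}^n\begin{bmatrix} n \\ k \end{bmatrix}_q\begin{bmatrix} \alpha \\ k \end{bmatrix}_{ -q}q^{\tilde r\binom k2-\tilde s\binom{k+1}2+\binom k2}(a;q)_k\,p_{n-k}(x,y)\,z^k.$$ Basic hypergeometric series: ${}_2\Phi_1\left[\begin{array}{c} a_1,a_2 \\ {b_1} \end{array};q;w\right]=\sum_{n=0}^\infty\frac{(a_1,a_2;q)_n}{(b_1;q)_n}\fr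ac{w^n}{(q;q)_n}$.
   Formalization: The right-hand series can diverge (e.g. (i) r<s; (ii) |ztq^α|>1), so both identities are stated whenever it converges; convergence is proved for s<r, or s=r with |ztq^(α-s)|<1, and in (ii) for |ztq^α|<1. In (ii) the denominators p_k(y,xq^(1-n)), k≤n, are assumed nonzero. -}

module Defs where

open import Level using (_⊔_) renaming (suc to lsuc)
open import Algebra.Apartness.Bundles using (HeytingField; HeytingCommutativeRing)
open import Algebra.Bundles using (CommutativeRing; CommutativeSemiring)
open import Algebra.Bundles.Raw using (RawRing)
import Algebra.Definitions.RawSemiring as RawSemiringDefs
import Algebra.Properties.Ring as RingProperties
import Algebra.Apartness.Properties.HeytingCommutativeRing as HeytingProperties
import Algebra.Solver.Ring.NaturalCoefficients.Default as SemiringSolver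
import Relation.Binary.Reasoning.Setoid as SetoidReasoning
open import Data.Empty using (⊥-elim)
open import Data.Fin.Base using (Fin; toℕ) renaming (zero to fzero; suc to fsuc)
open import Data.Integer.Base as ℤ using (ℤ; +_; -[1+_])
open import Data.Nat.Base as ℕ using (ℕ; zero; suc; _≥_; _∸_; _!)
open import Data.Nat.Combinatorics using (_C_)
open import Data.Nat.Properties using (_!≢0)
open import Data.Product.Base using (Σ-syntax; ∃-syntax; _×_; _,_; proj₁; proj₂)
open import Data.Sum.Base using (_⊎_; inj₁; inj₂)
open import Function.Base using (_∘_)
open import Relation.Binary.Core using (Rel)
open import Relation.Binary.Structures using (IsStrictPartialOrder)
open import Relation.Nullary.Negation using (¬_)

-- The real numbers, characterised up to isomorphism as a Cauchy-complete
-- Archimedean ordered field.  The axioms are constructive (strict order with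
-- apartness instead of decidable equality); classically they are equivalent
-- to the usual ones.
record CompleteOrderedField c ℓ₁ ℓ₂ : Set (lsuc (c ⊔ ℓ₁ ⊔ ℓ₂)) where
  field
    heytingField : HeytingField c ℓ₁ ℓ₂

  open HeytingField heytingField public
  open HeytingCommutativeRing heytingCommutativeRing public using (commutativeRing)
  open CommutativeRing commutativeRing public using (ring; commutativeSemiring)

  infix 4 _<_

  field
    _<_                  : Rel Carrier ℓ₂
    isStrictPartialOrder : IsStrictPartialOrder _≈_ _<_
    #⇒<⊎>                : ∀ {x y} → x # y → x < y ⊎ y < x
    <⇒#                  : ∀ {x y} → x < y → x # y
    +-monoˡ-<            : ∀ z {x y} → x < y → x + z < y + z
    *-pos                : ∀ {x y} → 0# < x → 0# < y → 0# < x * y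

  open RawSemiringDefs (CommutativeSemiring.rawSemiring commutativeSemiring)
    using () renaming (_×_ to _×ℝ_)

  -- The condition is symmetric in m and n, so it bounds the distance.
  Cauchy : (ℕ → Carrier) → Set (c ⊔ ℓ₂)
  Cauchy u = ∀ ε → 0# < ε → ∃[ N ] (∀ m n → m ≥ N → n ≥ N → u m - u n < ε)

  Converges : (ℕ → Carrier) → Carrier → Set (c ⊔ ℓ₂)
  Converges u l =
    ∀ ε → 0# < ε → ∃[ N ] (∀ n → n ≥ N → u n - l < ε × l - u n < ε)

  field
    archimedean : ∀ x → ∃[ n ] x < n ×ℝ 1#
    complete    : ∀ u → Cauchy u → ∃[ l ] Converges u l

module OrderedFieldProperties {c ℓ₁ ℓ₂} (R : CompleteOrderedField c ℓ₁ ℓ₂) where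
  open CompleteOrderedField R
  open IsStrictPartialOrder isStrictPartialOrder
    using (<-respˡ-≈; <-respʳ-≈) renaming (irrefl to <-irrefl; trans to <-trans)
  open RingProperties ring using (-‿distribˡ-*; -‿distribʳ-*; -‿involutive)
  open HeytingProperties heytingCommutativeRing
    using (x-0≈x; 1#0; invertibleˡ⇒#)
  open SemiringSolver commutativeSemiring using (solve; _:=_; _:+_; _:*_)
  open SetoidReasoning setoid

  <-resp : ∀ {x x′ y y′} → x ≈ x′ → y ≈ y′ → x < y → x′ < y′
  <-resp p q x<y = <-respˡ-≈ p (<-respʳ-≈ q x<y)

  <-cotrans : ∀ {x y} z → x < y → x < z ⊎ z < y
  <-cotrans z x<y with #-cotrans (<⇒# x<y) z
  ... | inj₁ x#z with #⇒<⊎> x#z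
  ...   | inj₁ x<z = inj₁ x<z
  ...   | inj₂ z<x = inj₂ (<-trans z<x x<y)
  <-cotrans z x<y | inj₂ z#y with #⇒<⊎> z#y
  ...   | inj₁ z<y = inj₂ z<y
  ...   | inj₂ y<z = inj₁ (<-trans x<y y<z)

  neg-sq : ∀ x → (- x) * (- x) ≈ x * x
  neg-sq x = begin
    (- x) * (- x)   ≈⟨ -‿distribˡ-* x (- x) ⟨
    - (x * (- x))   ≈⟨ -‿cong (-‿distribʳ-* x x) ⟨
    - (- (x * x))   ≈⟨ -‿involutive (x * x) ⟩
    x * x           ∎

  <⇒0<- : ∀ {x y} → x < y → 0# < y - x
  <⇒0<- {x} x<y = <-respˡ-≈ (-‿inverseʳ x) (+-monoˡ-< (- x) x<y)

  cancel : ∀ x y → (x - y) + y ≈ x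
  cancel x y = trans (+-assoc x (- y) y) (trans (+-congˡ (-‿inverseˡ y)) (+-identityʳ x))

  0<-⇒< : ∀ {x y} → 0# < y - x → x < y
  0<-⇒< {x} {y} h = <-resp (+-identityˡ x) (cancel y x) (+-monoˡ-< x h)

  #0⇒0<sq : ∀ {x} → x # 0# → 0# < x * x
  #0⇒0<sq {x} x#0 with #⇒<⊎> x#0
  ... | inj₂ 0<x = *-pos 0<x 0<x
  ... | inj₁ x<0 = <-respʳ-≈ (neg-sq x) (*-pos 0<-x 0<-x)
    where 0<-x = <-respʳ-≈ (+-identityˡ (- x)) (<⇒0<- x<0)

  *#0⇒#0 : ∀ {x y} → x * y # 0# → x # 0#
  *#0⇒#0 {x} {y} h with #⇒invertible h
  ... | w , w*xy≈1 , _ = invertibleˡ⇒# (w * y , (begin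
    w * y * (x - 0#)    ≈⟨ *-congˡ (x-0≈x x) ⟩
    w * y * x           ≈⟨ *-assoc w y x ⟩
    w * (y * x)         ≈⟨ *-congˡ (*-comm y x) ⟩
    w * (x * y)         ≈⟨ *-congˡ (x-0≈x (x * y)) ⟨
    w * (x * y - 0#)    ≈⟨ w*xy≈1 ⟩
    1#                  ∎))

  0≤sq : ∀ x → ¬ (x * x < 0#)
  0≤sq x h = <-irrefl refl (<-trans h (#0⇒0<sq (*#0⇒#0 (<⇒# h))))

  0<1 : 0# < 1#
  0<1 = <-respʳ-≈ (*-identityˡ 1#) (#0⇒0<sq 1#0)

  pos+nonneg : ∀ {x y} → 0# < x → ¬ (y < 0#) → 0# < x + y
  pos+nonneg {x} {y} 0<x 0≤y with <-cotrans (x + y) 0<x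
  ... | inj₁ 0<x+y = 0<x+y
  ... | inj₂ x+y<x = ⊥-elim (0≤y (<-resp lhs (-‿inverseʳ x) (+-monoˡ-< (- x) x+y<x)))
    where
    lhs : x + y - x ≈ y
    lhs = begin
      x + y - x     ≈⟨ +-congʳ (+-comm x y) ⟩
      y + x - x     ≈⟨ +-assoc y x (- x) ⟩
      y + (x - x)   ≈⟨ +-congˡ (-‿inverseʳ x) ⟩
      y + 0#        ≈⟨ +-identityʳ y ⟩
      y             ∎

  nonneg*pos : ∀ {x y} → ¬ (x < 0#) → 0# < y → ¬ (x * y < 0#)
  nonneg*pos 0≤x 0<y h with #⇒<⊎> (*#0⇒#0 (<⇒# h))
  ... | inj₁ x<0 = 0≤x x<0
  ... | inj₂ 0<x = <-irrefl refl (<-trans h (*-pos 0<x 0<y))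

  nonneg+nonneg : ∀ {x y} → ¬ (x < 0#) → ¬ (y < 0#) → ¬ (x + y < 0#)
  nonneg+nonneg {x} {y} 0≤x 0≤y h with <-cotrans y h
  ... | inj₂ y<0   = 0≤y y<0
  ... | inj₁ x+y<y = 0≤x (<-resp (trans (+-assoc x y (- y))
                              (trans (+-congˡ (-‿inverseʳ y)) (+-identityʳ x)))
                            (-‿inverseʳ y) (+-monoˡ-< (- y) x+y<y))

  -- 1 - x y = (1 - x) + x (1 - y)
  *<1 : ∀ {x y} → ¬ (x < 0#) → x < 1# → y < 1# → x * y < 1#
  *<1 {x} {y} 0≤x x<1 y<1 = 0<-⇒< (<-respʳ-≈ eq
    (pos+nonneg (<⇒0<- x<1) (nonneg*pos 0≤x (<⇒0<- y<1))))
    where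
    eq : (1# - x) + x * (1# - y) ≈ 1# - x * y
    eq = begin
      (1# - x) + x * (1# - y)           ≈⟨ +-congˡ (distribˡ x 1# (- y)) ⟩
      (1# - x) + (x * 1# + x * (- y))   ≈⟨ +-congˡ (+-cong (*-identityʳ x) (sym (-‿distribʳ-* x y))) ⟩
      (1# - x) + (x - x * y)            ≈⟨ +-assoc (1# - x) x (- (x * y)) ⟨
      ((1# - x) + x) - x * y            ≈⟨ +-congʳ (cancel 1# x) ⟩
      1# - x * y                        ∎

  sq<1⇒#1 : ∀ {x} → x * x < 1# → (1# - x) # 0#
  sq<1⇒#1 {x} h = *#0⇒#0 (#-sym (<⇒# (<-respʳ-≈ eq (<⇒0<- h))))
    where
    eq : 1# - x * x ≈ (1# - x) * (1# + x)
    eq = sym (begin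
      (1# - x) * (1# + x)               ≈⟨ distribˡ (1# - x) 1# x ⟩
      (1# - x) * 1# + (1# - x) * x      ≈⟨ +-cong (*-identityʳ (1# - x)) (distribʳ x 1# (- x)) ⟩
      (1# - x) + (1# * x + (- x) * x)   ≈⟨ +-congˡ (+-cong (*-identityˡ x) (sym (-‿distribˡ-* x x))) ⟩
      (1# - x) + (x - x * x)            ≈⟨ +-assoc (1# - x) x (- (x * x)) ⟨
      ((1# - x) + x) - x * x            ≈⟨ +-congʳ (cancel 1# x) ⟩
      1# - x * x                        ∎)

  two-squares : ∀ a b c d →
    (a * c - b * d) * (a * c - b * d) + (a * d + b * c) * (a * d + b * c)
      ≈ (a * a + b * b) * (c * c + d * d)
  two-squares a b c d = begin
    (a * c + m) * (a * c + m) + (a * d + b * c) * (a * d + b * c)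
      ≈⟨ solve 5 (λ a b c d m →
           (a :* c :+ m) :* (a :* c :+ m) :+ (a :* d :+ b :* c) :* (a :* d :+ b :* c)
           := (a :* c :* (a :* c) :+ m :* m :+ (a :* d :* (a :* d) :+ b :* c :* (b :* c)))
              :+ (a :* c :+ a :* c) :* (m :+ b :* d)) refl a b c d m ⟩
    (a * c * (a * c) + m * m + (a * d * (a * d) + b * c * (b * c)))
      + (a * c + a * c) * (m + b * d)
      ≈⟨ +-cong (+-congʳ (+-congˡ (neg-sq (b * d))))
                (trans (*-congˡ (-‿inverseˡ (b * d))) (zeroʳ _)) ⟩
    (a * c * (a * c) + b * d * (b * d) + (a * d * (a * d) + b * c * (b * c))) + 0#
      ≈⟨ +-identityʳ _ ⟩
    a * c * (a * c) + b * d * (b * d) + (a * d * (a * d) + b * c * (b * c))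
      ≈⟨ solve 4 (λ a b c d →
           a :* c :* (a :* c) :+ b :* d :* (b :* d) :+ (a :* d :* (a :* d) :+ b :* c :* (b :* c))
           := (a :* a :+ b :* b) :* (c :* c :+ d :* d)) refl a b c d ⟩
    (a * a + b * b) * (c * c + d * d) ∎
    where m = - (b * d)

module Complex {c ℓ₁ ℓ₂} (R : CompleteOrderedField c ℓ₁ ℓ₂) where
  private
    module ℝ where
      open CompleteOrderedField R public
      open IsStrictPartialOrder isStrictPartialOrder public
        using (<-respˡ-≈; <-respʳ-≈) renaming (trans to <-trans)
      open OrderedFieldProperties R public
    open ℝ using (_<_; 0#; 1#)

  record ℂ : Set c where
    no-eta-equality
    constructor _+i_
    field
      re im : ℝ.Carrier
  open ℂ public

  infix  4 _≈_
  infixl 6 _+_ _-_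
  infixl 7 _*_
  infix  8 -_

  record _≈_ (z w : ℂ) : Set ℓ₁ where
    constructor mk≈
    field
      re≈ : re z ℝ.≈ re w
      im≈ : im z ℝ.≈ im w
  open _≈_ public

  _+_ _*_ : ℂ → ℂ → ℂ
  z + w = (re z ℝ.+ re w) +i (im z ℝ.+ im w)
  z * w = (re z ℝ.* re w ℝ.- im z ℝ.* im w) +i (re z ℝ.* im w ℝ.+ im z ℝ.* re w)

  -_ : ℂ → ℂ
  - z = (ℝ.- re z) +i (ℝ.- im z)

  _-_ : ℂ → ℂ → ℂ
  z - w = z + (- w)

  0ℂ 1ℂ : ℂ
  0ℂ = 0# +i 0#
  1ℂ = 1# +i 0#

  rawRing : RawRing c ℓ₁
  rawRing = record
    { Carrier = ℂ ; _≈_ = _≈_ ; _+_ = _+_ ; _*_ = _*_ ; -_ = -_ ; 0# = 0ℂ ; 1# = 1ℂ }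

  open RawSemiringDefs (RawRing.rawSemiring rawRing) public
    using (_^_; sum; product) renaming (_×_ to _×ℂ_)

  fromℤ : ℤ → ℂ
  fromℤ (+ n)    = n ×ℂ 1ℂ
  fromℤ -[1+ n ] = - (suc n ×ℂ 1ℂ)

  ∣_∣² : ℂ → ℝ.Carrier
  ∣ z ∣² = re z ℝ.* re z ℝ.+ im z ℝ.* im z

  -- ∣ z ∣< ε expresses |z| < ε without square roots; it is meant for ε > 0.
  infix 4 ∣_∣<_
  record ∣_∣<_ (z : ℂ) (ε : ℝ.Carrier) : Set ℓ₂ where
    constructor mk∣∣<
    field
      ∣∣²<ε² : ∣ z ∣² < ε ℝ.* ε
  open ∣_∣<_ public

  1ℝ : ℝ.Carrier
  1ℝ = 1#

  -- Apartness from zero, |z| > 0; classically z ≠ 0.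
  record NonZero (z : ℂ) : Set ℓ₂ where
    constructor mkNonZero
    field
      0<∣∣² : 0# < ∣ z ∣²
  open NonZero public

  _⁻¹[_] : (z : ℂ) → NonZero z → ℂ
  z ⁻¹[ nz ] = (re z ℝ.* r) +i (ℝ.- im z ℝ.* r)
    where r = proj₁ (ℝ.#⇒invertible (ℝ.#-sym (ℝ.<⇒# (0<∣∣² nz))))

  infixl 7 _/_[_]
  _/_[_] : (z w : ℂ) → NonZero w → ℂ
  z / w [ nz ] = z * w ⁻¹[ nz ]

  infix 4 _⟶_ _sumsTo_
  _⟶_ : (ℕ → ℂ) → ℂ → Set (c ⊔ ℓ₂)
  u ⟶ l = ∀ ε → 0# < ε → ∃[ N ] (∀ n → n ≥ N → ∣ u n - l ∣< ε)

  _sumsTo_ : (ℕ → ℂ) → ℂ → Set (c ⊔ ℓ₂)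
  u sumsTo s = (λ n → sum {n} (u ∘ toℕ)) ⟶ s

  0≤∣∣² : ∀ z → ¬ (∣ z ∣² < 0#)
  0≤∣∣² z = ℝ.nonneg+nonneg (ℝ.0≤sq (re z)) (ℝ.0≤sq (im z))

  ∣∣²-* : ∀ z w → ∣ z * w ∣² ℝ.≈ ∣ z ∣² ℝ.* ∣ w ∣²
  ∣∣²-* z w = ℝ.two-squares (re z) (im z) (re w) (im w)

  NonZero-* : ∀ {z w} → NonZero z → NonZero w → NonZero (z * w)
  NonZero-* {z} {w} (mkNonZero p) (mkNonZero r) =
    mkNonZero (ℝ.<-respʳ-≈ (ℝ.sym (∣∣²-* z w)) (ℝ.*-pos p r))

  0<re⇒NonZero : ∀ z → 0# < re z → NonZero z
  0<re⇒NonZero z 0<a = mkNonZero (ℝ.pos+nonneg (ℝ.*-pos 0<a 0<a) (ℝ.0≤sq (im z)))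

  NonZero-product : ∀ {n} (f : Fin n → ℂ) → (∀ i → NonZero (f i)) → NonZero (product f)
  NonZero-product {zero}  f nz = 0<re⇒NonZero 1ℂ ℝ.0<1
  NonZero-product {suc n} f nz =
    NonZero-* (nz fzero) (NonZero-product (f ∘ fsuc) (nz ∘ fsuc))

  ∣-∣<1 : ∀ {z} → ∣ z ∣< 1ℝ → ∣ - z ∣< 1ℝ
  ∣-∣<1 {z} (mk∣∣< h) = mk∣∣<
    (ℝ.<-respˡ-≈ (ℝ.sym (ℝ.+-cong (ℝ.neg-sq (re z)) (ℝ.neg-sq (im z)))) h)

  ∣*∣<1 : ∀ {z w} → ∣ z ∣< 1ℝ → ∣ w ∣< 1ℝ → ∣ z * w ∣< 1ℝ
  ∣*∣<1 {z} {w} (mk∣∣< p) (mk∣∣< r) = mk∣∣<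
    (ℝ.<-resp (ℝ.sym (∣∣²-* z w)) (ℝ.sym 1*1)
      (ℝ.*<1 (0≤∣∣² z) (ℝ.<-respʳ-≈ 1*1 p) (ℝ.<-respʳ-≈ 1*1 r)))
    where 1*1 = ℝ.*-identityˡ 1#

  ∣*^∣<1 : ∀ {z w} → ∣ z ∣< 1ℝ → ∣ w ∣< 1ℝ → ∀ n → ∣ z * w ^ n ∣< 1ℝ
  ∣*^∣<1 {z} (mk∣∣< p) _ zero = mk∣∣< (ℝ.<-respˡ-≈ (ℝ.sym ∣z*1∣²) p)
    where
    ∣1∣² = ℝ.trans (ℝ.+-cong (ℝ.*-identityˡ 1#) (ℝ.zeroˡ 0#)) (ℝ.+-identityʳ 1#)
    ∣z*1∣² = ℝ.trans (∣∣²-* z 1ℂ) (ℝ.trans (ℝ.*-congˡ ∣1∣²) (ℝ.*-identityʳ ∣ z ∣²))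
  ∣*^∣<1 p r (suc n) = ∣*∣<1 p (∣*^∣<1 r r n)

  NonZero-1- : ∀ {z} → ∣ z ∣< 1ℝ → NonZero (1ℂ - z)
  NonZero-1- {z} (mk∣∣< h) =
    mkNonZero (ℝ.pos+nonneg (ℝ.#0⇒0<sq (ℝ.sq<1⇒#1 a²<1)) (ℝ.0≤sq _))
    where
    open SetoidReasoning ℝ.setoid
    open RingProperties ℝ.ring using (-‿+-comm)
    a² = re z ℝ.* re z
    b² = im z ℝ.* im z
    eq : (1# ℝ.- (a² ℝ.+ b²)) ℝ.+ b² ℝ.≈ 1# ℝ.- a²
    eq = begin
      (1# ℝ.- (a² ℝ.+ b²)) ℝ.+ b²     ≈⟨ ℝ.+-congʳ (ℝ.+-congˡ (-‿+-comm a² b²)) ⟨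
      (1# ℝ.+ (ℝ.- a² ℝ.- b²)) ℝ.+ b² ≈⟨ ℝ.+-congʳ (ℝ.+-assoc 1# (ℝ.- a²) (ℝ.- b²)) ⟨
      (1# ℝ.- a² ℝ.- b²) ℝ.+ b²       ≈⟨ ℝ.cancel (1# ℝ.- a²) b² ⟩
      1# ℝ.- a²                       ∎
    a²<1 : a² < 1#
    a²<1 = ℝ.0<-⇒< (ℝ.<-respʳ-≈ eq (ℝ.pos+nonneg
      (ℝ.<⇒0<- (ℝ.<-respʳ-≈ (ℝ.*-identityˡ 1#) h)) (ℝ.0≤sq (im z))))

  NonZero-ℕ : ∀ n → .{{ℕ.NonZero n}} → NonZero (n ×ℂ 1ℂ)
  NonZero-ℕ (suc n) = 0<re⇒NonZero (suc n ×ℂ 1ℂ) (ℝ.pos+nonneg ℝ.0<1 (0≤re n))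
    where
    0≤re : ∀ n → ¬ (re (n ×ℂ 1ℂ) < 0#)
    0≤re zero    h = ℝ.#-irrefl ℝ.refl (ℝ.<⇒# h)
    0≤re (suc n) h = 0≤re n (ℝ.<-resp (ℝ.+-identityˡ _) ℝ.refl
      (ℝ.<-trans (ℝ.+-monoˡ-< (re (n ×ℂ 1ℂ)) ℝ.0<1) h))

  expTerm : ℂ → ℕ → ℂ
  expTerm w k = w ^ k / (k !) ×ℂ 1ℂ [ NonZero-ℕ (k !) {{k !≢0}} ]

  -- q^ is a branch α ↦ exp (α log q) of the complex power; log q may be any
  -- logarithm of q.
  record IsPower (q : ℂ) (q^ : ℂ → ℂ) : Set (c ⊔ ℓ₂) where
    field
      log     : ℂ
      exp-log : expTerm log sumsTo q
      power   : ∀ α → expTerm (α * log) sumsTo q^ α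

  -- (a ; b)ₙ
  infix 9 ⟨_⨾_⟩_
  ⟨_⨾_⟩_ : ℂ → ℂ → ℕ → ℂ
  ⟨ a ⨾ b ⟩ n = product {n} λ k → 1ℂ - a * b ^ toℕ k

  NonZero-⟨⨾⟩ : ∀ {a b} → ∣ a ∣< 1ℝ → ∣ b ∣< 1ℝ → ∀ n → NonZero (⟨ a ⨾ b ⟩ n)
  NonZero-⟨⨾⟩ {a} {b} p r n =
    NonZero-product {n} _ λ k → NonZero-1- (∣*^∣<1 p r (toℕ k))

  -- P is (a ; b)_∞
  ⟨_⨾_⟩∞≡_ : ℂ → ℂ → ℂ → Set (c ⊔ ℓ₂)
  ⟨ a ⨾ b ⟩∞≡ P = (λ n → ⟨ a ⨾ b ⟩ n) ⟶ P

  module QSeries (q : ℂ) (∣q∣<1 : ∣ q ∣< 1ℝ) (q^ : ℂ → ℂ) where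

    [q⨾q]≢0 : ∀ n → NonZero (⟨ q ⨾ q ⟩ n)
    [q⨾q]≢0 = NonZero-⟨⨾⟩ ∣q∣<1 ∣q∣<1

    [-q⨾q]≢0 : ∀ n → NonZero (⟨ - q ⨾ q ⟩ n)
    [-q⨾q]≢0 = NonZero-⟨⨾⟩ (∣-∣<1 ∣q∣<1) ∣q∣<1

    [q²⨾q²]≢0 : ∀ n → NonZero (⟨ q * q ⨾ q * q ⟩ n)
    [q²⨾q²]≢0 = NonZero-⟨⨾⟩ ∣q²∣<1 ∣q²∣<1
      where ∣q²∣<1 = ∣*∣<1 ∣q∣<1 ∣q∣<1

    q^ℤ : ℤ → ℂ
    q^ℤ m = q^ (fromℤ m)

    binom₂ : ℕ → ℤ
    binom₂ k = + (k C 2)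

    [_,_]q : ℂ → ℕ → ℂ
    [ α , k ]q =
      ⟨ q^ (- α) ⨾ q ⟩ k / ⟨ q ⨾ q ⟩ k [ [q⨾q]≢0 k ]
        * (- 1ℂ) ^ k * q^ (α * fromℤ (+ k) - fromℤ (binom₂ k))

    [_,_]-q : ℂ → ℕ → ℂ
    [ α , k ]-q =
      ⟨ - q^ (- α) ⨾ q ⟩ k / ⟨ - q ⨾ q ⟩ k [ [-q⨾q]≢0 k ]
        * q^ (α * fromℤ (+ k) - fromℤ (binom₂ k))

    cauchy : ℕ → ℂ → ℂ → ℂ
    cauchy n x y = product {n} λ k → x - q ^ toℕ k * y

    exponent : ℤ → ℤ → ℕ → ℤ
    exponent r s k = r ℤ.* binom₂ k ℤ.- s ℤ.* binom₂ (suc k)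

    L̃ : ℤ → ℤ → ℕ → (α x y z a : ℂ) → ℂ
    L̃ r s n α x y z a = sum {suc n} λ i → let k = toℕ i in
      [ fromℤ (+ n) , k ]q * [ α , k ]-q
        * q^ℤ (exponent r s k ℤ.+ binom₂ k)
        * ⟨ a ⨾ q ⟩ k * cauchy (n ∸ k) x y * z ^ k

    ₂Φ₁-term : (a₁ a₂ b : ℂ) → (∀ n → NonZero (⟨ b ⨾ q ⟩ n)) → ℂ → ℕ → ℂ
    ₂Φ₁-term a₁ a₂ b nz w n =
      (⟨ a₁ ⨾ q ⟩ n * ⟨ a₂ ⨾ q ⟩ n) / ⟨ b ⨾ q ⟩ n [ nz n ]
        * (w ^ n / ⟨ q ⨾ q ⟩ n [ [q⨾q]≢0 n ])

{-# OPTIONS --safe #-}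
module Submission where

-- With cₙ = pₙ(x,y) tⁿ/(q;q)ₙ and bₖ the k-th term of the series on the right,
-- the identity L̃ₙ tⁿ/(q;q)ₙ = Σₖ bₖ cₙ₋ₖ is finite algebra, as is its
-- counterpart in (ii).  The cₙ are dominated by a geometric series, so Mertens'
-- theorem multiplies Σ cₙ with any convergent Σ bₖ.  The sum F(t) = Σ cₙ
-- satisfies (1 - xt) F(t) = (1 - yt) F(qt), and iterating this functional
-- equation gives (xt;q)_∞ F(t) = (yt;q)_∞; the case y = 0 shows that (xt;q)_∞
-- is invertible.  The laws of q^ α come from Mertens' theorem for exp.

open import Defs
open import Level using (_⊔_) renaming (suc to lsuc)
open import Algebra.Bundles using (CommutativeRing; RawRing)
import Algebra.Definitions.RawSemiring as RawSemiringDefs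
import Algebra.Properties.AbelianGroup as AbelianGroupProperties
import Algebra.Properties.CommutativeSemiring.Binomial as Binomial
import Algebra.Properties.CommutativeSemiring.Exp as CommutativeSemiringExp
import Algebra.Properties.Monoid.Mult.TCOptimised as Mult′
import Algebra.Properties.Ring as RingProperties
import Algebra.Properties.Semiring.Exp as SemiringExp
import Algebra.Properties.Semiring.Mult as SemiringMult
import Algebra.Properties.Semiring.Sum as SemiringSum
import Algebra.Solver.Ring as RingSolver
open import Algebra.Solver.Ring.AlmostCommutativeRing
  using (fromCommutativeRing; _-Raw-AlmostCommutative⟶_)
open import Data.Empty using (⊥-elim)
open import Data.Fin.Base using (Fin; toℕ)
import Data.Fin.Properties as Fin
open import Data.Integer.Base as ℤ using (ℤ; +_; -[1+_]; 0ℤ; 1ℤ)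
import Data.Integer.Properties as ℤ
open import Data.Maybe.Base using (just; nothing)
open import Data.Nat.Base as ℕ using (ℕ; zero; suc; _≥_; _∸_; _!)
open import Data.Nat.Combinatorics
  using (_C_; nC1≡n; nCk+nC[k+1]≡[n+1]C[k+1]; nCk≡n!/k![n-k]!; k![n∸k]!∣n!)
open import Data.Nat.DivMod using (m/n*n≡m)
import Data.Nat.Properties as ℕ
open import Data.Nat.Properties using (_!*_!≢0; _!≢0)
open import Data.Product.Base using (Σ-syntax; ∃-syntax; _×_; _,_; proj₁; proj₂)
open import Data.Sum.Base using (_⊎_; inj₁; inj₂; [_,_]′)
open import Function.Base using (_∘_)
open import Relation.Binary.Definitions using (WeaklyDecidable)
open import Relation.Binary.PropositionalEquality as ≡ using (_≡_; _≢_)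
import Relation.Binary.Reasoning.Setoid as SetoidReasoning
open import Relation.Binary.Structures using (IsStrictPartialOrder)
open import Relation.Nullary.Decidable using (yes; no)
open import Relation.Nullary.Negation using (¬_)

module IntegerMultiples {k ℓ} (K : CommutativeRing k ℓ) where
  open CommutativeRing K
  open RawSemiringDefs (RawRing.rawSemiring rawRing) using () renaming (_×_ to _·_; _×′_ to _·′_)
  open RingProperties ring using (-‿distribˡ-*; -‿distribʳ-*; -‿involutive)
  open AbelianGroupProperties +-abelianGroup using (⁻¹-∙-comm; ε⁻¹≈ε)
  open SemiringMult semiring using (×-homo-+; ×1-homo-*)
  open Mult′ +-monoid using (×ᵤ≈×)
  open SetoidReasoning setoid

  fromℤ : ℤ → Carrier
  fromℤ (+ n)    = n · 1#
  fromℤ -[1+ n ] = - (suc n · 1#)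

  fromℤ-1 : fromℤ 1ℤ ≈ 1#
  fromℤ-1 = +-identityʳ 1#

  fromℤ-neg : ∀ m → fromℤ (ℤ.- m) ≈ - fromℤ m
  fromℤ-neg (+ zero)  = sym ε⁻¹≈ε
  fromℤ-neg (+ suc n) = refl
  fromℤ-neg -[1+ n ]  = sym (-‿involutive _)

  fromℤ-⊖ : ∀ m n → fromℤ (m ℤ.⊖ n) ≈ m · 1# - n · 1#
  fromℤ-⊖ m zero = begin
    m · 1#          ≈⟨ +-identityʳ _ ⟨
    m · 1# + 0#     ≈⟨ +-congˡ ε⁻¹≈ε ⟨
    m · 1# - 0#     ∎
  fromℤ-⊖ zero (suc n) = sym (+-identityˡ _)
  fromℤ-⊖ (suc m) (suc n) = begin
    fromℤ (suc m ℤ.⊖ suc n)               ≡⟨ ≡.cong fromℤ (ℤ.[1+m]⊖[1+n]≡m⊖n m n) ⟩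
    fromℤ (m ℤ.⊖ n)                       ≈⟨ fromℤ-⊖ m n ⟩
    m · 1# - n · 1#                       ≈⟨ +-identityˡ _ ⟨
    0# + (m · 1# - n · 1#)                ≈⟨ +-congʳ (-‿inverseʳ 1#) ⟨
    (1# - 1#) + (m · 1# - n · 1#)         ≈⟨ +-assoc 1# (- 1#) _ ⟩
    1# + (- 1# + (m · 1# - n · 1#))       ≈⟨ +-congˡ (+-assoc (- 1#) _ _) ⟨
    1# + ((- 1# + m · 1#) - n · 1#)       ≈⟨ +-congˡ (+-congʳ (+-comm (- 1#) _)) ⟩
    1# + ((m · 1# - 1#) - n · 1#)         ≈⟨ +-congˡ (+-assoc _ (- 1#) _) ⟩
    1# + (m · 1# + (- 1# - n · 1#))       ≈⟨ +-assoc 1# _ _ ⟨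
    (1# + m · 1#) + (- 1# - n · 1#)       ≈⟨ +-congˡ (⁻¹-∙-comm 1# _) ⟩
    suc m · 1# - suc n · 1#               ∎

  fromℤ-+ : ∀ m n → fromℤ (m ℤ.+ n) ≈ fromℤ m + fromℤ n
  fromℤ-+ (+ m)    (+ n)    = ×-homo-+ 1# m n
  fromℤ-+ (+ m)    -[1+ n ] = fromℤ-⊖ m (suc n)
  fromℤ-+ -[1+ m ] (+ n)    = trans (fromℤ-⊖ n (suc m)) (+-comm _ _)
  fromℤ-+ -[1+ m ] -[1+ n ] = begin
    - (suc (suc (m ℕ.+ n)) · 1#)       ≡⟨ ≡.cong (λ j → - (suc j · 1#)) (ℕ.+-suc m n) ⟨
    - ((suc m ℕ.+ suc n) · 1#)         ≈⟨ -‿cong (×-homo-+ 1# (suc m) (suc n)) ⟩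
    - (suc m · 1# + suc n · 1#)        ≈⟨ ⁻¹-∙-comm _ _ ⟨
    - (suc m · 1#) - suc n · 1#        ∎

  fromℤ-* : ∀ m n → fromℤ (m ℤ.* n) ≈ fromℤ m * fromℤ n
  fromℤ-*-pos : ∀ m n → fromℤ (+ m ℤ.* n) ≈ fromℤ (+ m) * fromℤ n
  fromℤ-*-pos m (+ n) = begin
    fromℤ (+ m ℤ.* + n)    ≡⟨ ≡.cong fromℤ (ℤ.pos-* m n) ⟨
    (m ℕ.* n) · 1#         ≈⟨ ×1-homo-* m n ⟩
    m · 1# * (n · 1#)      ∎
  fromℤ-*-pos m -[1+ n ] = begin
    fromℤ (+ m ℤ.* ℤ.- + suc n)     ≡⟨ ≡.cong fromℤ (ℤ.neg-distribʳ-* (+ m) (+ suc n)) ⟨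
    fromℤ (ℤ.- (+ m ℤ.* + suc n))   ≈⟨ fromℤ-neg (+ m ℤ.* + suc n) ⟩
    - fromℤ (+ m ℤ.* + suc n)       ≈⟨ -‿cong (fromℤ-*-pos m (+ suc n)) ⟩
    - (m · 1# * (suc n · 1#))       ≈⟨ -‿distribʳ-* _ _ ⟩
    m · 1# * - (suc n · 1#)         ∎
  fromℤ-* (+ m)    n = fromℤ-*-pos m n
  fromℤ-* -[1+ m ] n = begin
    fromℤ (ℤ.- + suc m ℤ.* n)       ≡⟨ ≡.cong fromℤ (ℤ.neg-distribˡ-* (+ suc m) n) ⟨
    fromℤ (ℤ.- (+ suc m ℤ.* n))     ≈⟨ fromℤ-neg (+ suc m ℤ.* n) ⟩
    - fromℤ (+ suc m ℤ.* n)         ≈⟨ -‿cong (fromℤ-*-pos (suc m) n) ⟩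
    - (suc m · 1# * fromℤ n)        ≈⟨ -‿distribˡ-* _ _ ⟩
    - (suc m · 1#) * fromℤ n        ∎

  fromℤ-sub : ∀ m n → fromℤ (m ℤ.- n) ≈ fromℤ m - fromℤ n
  fromℤ-sub m n = trans (fromℤ-+ m (ℤ.- n)) (+-congˡ (fromℤ-neg n))

  -- With _·′_ the coefficients 0 and 1 evaluate to 0# and 1# on the nose.
  private
    ⟦_⟧ : ℤ → Carrier
    ⟦ + n ⟧      = n ·′ 1#
    ⟦ -[1+ n ] ⟧ = - (suc n ·′ 1#)

    ⟦⟧≈fromℤ : ∀ m → fromℤ m ≈ ⟦ m ⟧
    ⟦⟧≈fromℤ (+ n)    = ×ᵤ≈× n 1#
    ⟦⟧≈fromℤ -[1+ n ] = -‿cong (×ᵤ≈× (suc n) 1#)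

    morphism : ℤ.+-*-rawRing -Raw-AlmostCommutative⟶ fromCommutativeRing K
    morphism = record
      { ⟦_⟧    = ⟦_⟧
      ; +-homo = λ m n → trans (sym (⟦⟧≈fromℤ (m ℤ.+ n)))
          (trans (fromℤ-+ m n) (+-cong (⟦⟧≈fromℤ m) (⟦⟧≈fromℤ n)))
      ; *-homo = λ m n → trans (sym (⟦⟧≈fromℤ (m ℤ.* n)))
          (trans (fromℤ-* m n) (*-cong (⟦⟧≈fromℤ m) (⟦⟧≈fromℤ n)))
      ; -‿homo = λ m → trans (sym (⟦⟧≈fromℤ (ℤ.- m)))
          (trans (fromℤ-neg m) (-‿cong (⟦⟧≈fromℤ m)))
      ; 0-homo = refl
      ; 1-homo = refl
      }

    _≟_ : WeaklyDecidable (λ m n → ⟦ m ⟧ ≈ ⟦ n ⟧)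
    m ≟ n with m ℤ.≟ n
    ... | yes ≡.refl = just refl
    ... | no _       = nothing

  open RingSolver ℤ.+-*-rawRing (fromCommutativeRing K) morphism _≟_ public
    using (solve; con; _:=_; _:+_; _:*_; _:-_; :-_)

module OrderedFieldArithmetic {c ℓ₁ ℓ₂} (R : CompleteOrderedField c ℓ₁ ℓ₂) where
  open CompleteOrderedField R
  open IsStrictPartialOrder isStrictPartialOrder
    using () renaming (irrefl to <-irrefl; trans to <-trans)
  open OrderedFieldProperties R
  open IntegerMultiples commutativeRing
  open RawSemiringDefs (RawRing.rawSemiring (CommutativeRing.rawRing commutativeRing))
    using (_^_) renaming (_×_ to _·_)
  open SemiringMult (CommutativeRing.semiring commutativeRing) using (×-homo-+)
  open SetoidReasoning setoid

  nonneg⇒≤ : ∀ {x y} → ¬ (y - x < 0#) → ¬ (y < x)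
  nonneg⇒≤ {x} {y} 0≤y-x y<x = 0≤y-x (<-resp refl (-‿inverseʳ x) (+-monoˡ-< (- x) y<x))

  ≤-<-trans : ∀ {x y z} → ¬ (y < x) → y < z → x < z
  ≤-<-trans {x} x≤y y<z with <-cotrans x y<z
  ... | inj₁ y<x = ⊥-elim (x≤y y<x)
  ... | inj₂ x<z = x<z

  <-≤-trans : ∀ {x y z} → x < y → ¬ (z < y) → x < z
  <-≤-trans {z = z} x<y y≤z with <-cotrans z x<y
  ... | inj₁ x<z = x<z
  ... | inj₂ z<y = ⊥-elim (y≤z z<y)

  <⇒≤ : ∀ {x y} → x < y → ¬ (y < x)
  <⇒≤ x<y y<x = <-irrefl refl (<-trans x<y y<x)

  ≤-refl : ∀ {x} → ¬ (x < x)
  ≤-refl = <-irrefl refl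

  +-monoʳ-< : ∀ z {x y} → x < y → z + x < z + y
  +-monoʳ-< z x<y = <-resp (+-comm _ z) (+-comm _ z) (+-monoˡ-< z x<y)

  +-mono-< : ∀ {x y u v} → x < y → u < v → x + u < y + v
  +-mono-< {y = y} {u} x<y u<v = <-trans (+-monoˡ-< u x<y) (+-monoʳ-< y u<v)

  +-pos : ∀ {x y} → 0# < x → 0# < y → 0# < x + y
  +-pos 0<x 0<y = <-resp (+-identityʳ 0#) refl (+-mono-< 0<x 0<y)

  *-monoʳ-< : ∀ {x y z} → 0# < z → x < y → z * x < z * y
  *-monoʳ-< {x} {y} {z} 0<z x<y = 0<-⇒< (<-resp refl
    (solve 3 (λ x y z → z :* (y :- x) := z :* y :- z :* x) refl x y z)
    (*-pos 0<z (<⇒0<- x<y)))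

  *-monoˡ-< : ∀ {x y z} → 0# < z → x < y → x * z < y * z
  *-monoˡ-< 0<z x<y = <-resp (*-comm _ _) (*-comm _ _) (*-monoʳ-< 0<z x<y)

  *-pos⇒#0 : ∀ {x y} → 0# < x * y → x < 0# ⊎ 0# < x
  *-pos⇒#0 0<xy = #⇒<⊎> (*#0⇒#0 (#-sym (<⇒# 0<xy)))

  -‿neg⇒< : ∀ {x y} → y - x < 0# → y < x
  -‿neg⇒< {x} {y} y-x<0 = <-resp (cancel y x) (+-identityˡ x) (+-monoˡ-< x y-x<0)

  *-cancelˡ-< : ∀ {x y z} → 0# < z → z * x < z * y → x < y
  *-cancelˡ-< {x} {y} {z} 0<z zx<zy =
    [ (λ y-x<0 → ⊥-elim (<-irrefl refl (<-trans zx<zy (*-monoʳ-< 0<z (-‿neg⇒< y-x<0)))))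
    , 0<-⇒<
    ]′ (*-pos⇒#0 (<-resp refl eq (<⇒0<- zx<zy)))
    where
    eq : z * y - z * x ≈ (y - x) * z
    eq = solve 3 (λ x y z → z :* y :- z :* x := (y :- x) :* z) refl x y z

  sq-mono-< : ∀ {x y} → 0# < x → x < y → x * x < y * y
  sq-mono-< 0<x x<y = <-trans (*-monoʳ-< 0<x x<y) (*-monoˡ-< (<-trans 0<x x<y) x<y)

  sq-cancel-< : ∀ {x y} → 0# < y → x * x < y * y → x < y
  sq-cancel-< {x} {y} 0<y xx<yy =
    [ (λ y-x<0 → ⊥-elim (<-irrefl refl (<-trans xx<yy (sq-mono-< 0<y (-‿neg⇒< y-x<0)))))
    , 0<-⇒<
    ]′ (*-pos⇒#0 (<-resp refl eq (<⇒0<- xx<yy)))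
    where
    eq : y * y - x * x ≈ (y - x) * (y + x)
    eq = solve 2 (λ x y → y :* y :- x :* x := (y :- x) :* (y :+ x)) refl x y

  opaque
    recip : ∀ {x} → 0# < x → ∃[ y ] 0# < y × x * y ≈ 1#
    recip {x} 0<x =
      let y , y*[x-0]≈1 , _ = #⇒invertible (#-sym (<⇒# 0<x))
          xy≈1 = trans (swap x y) y*[x-0]≈1
      in y , *-cancelˡ-< 0<x (<-resp (sym (zeroʳ x)) (sym xy≈1) 0<1) , xy≈1
      where
      swap : ∀ x y → x * y ≈ y * (x - 0#)
      swap = solve 2 (λ x y → x :* y := y :* (x :- con 0ℤ)) refl

  opaque
    divide : ∀ {x} y → 0# < x → 0# < y → ∃[ z ] 0# < z × x * z ≈ y
    divide {x} y 0<x 0<y = let r , 0<r , xr≈1 = recip 0<x in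
      r * y , *-pos 0<r 0<y
      , trans (sym (*-assoc x r y)) (trans (*-congʳ xr≈1) (*-identityˡ y))

  opaque
    halve : ∀ {x} → 0# < x → ∃[ y ] 0# < y × y + y ≈ x
    halve {x} 0<x = let y , 0<y , 2y≈x = divide x (+-pos 0<1 0<1) 0<x in
      y , 0<y , trans (double y) 2y≈x
      where
      double : ∀ y → y + y ≈ (1# + 1#) * y
      double = solve 1 (λ y → y :+ y := (con 1ℤ :+ con 1ℤ) :* y) refl

  x<x+y : ∀ {x y} → 0# < y → x < x + y
  x<x+y {x} 0<y = <-resp (+-identityʳ x) refl (+-monoʳ-< x 0<y)

  ^-pos : ∀ {x} → 0# < x → ∀ n → 0# < x ^ n
  ^-pos 0<x zero    = 0<1
  ^-pos 0<x (suc n) = *-pos 0<x (^-pos 0<x n)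

  ·1-nonneg : ∀ n → ¬ (n · 1# < 0#)
  ·1-nonneg zero    = ≤-refl
  ·1-nonneg (suc n) = nonneg+nonneg (<⇒≤ 0<1) (·1-nonneg n)

  opaque
    archimedean-≥ : ∀ x → ∃[ N ] (∀ n → n ≥ N → x < n · 1#)
    archimedean-≥ x = let N , x<N = archimedean x in
      N , λ n n≥N → <-≤-trans x<N (nonneg⇒≤ λ h → ·1-nonneg (n ℕ.∸ N) (<-resp (eq n N n≥N) refl h))
      where
      cancelʳ : ∀ x y → (x + y) - y ≈ x
      cancelʳ = solve 2 (λ x y → (x :+ y) :- y := x) refl

      eq : ∀ n N → n ≥ N → n · 1# - N · 1# ≈ (n ℕ.∸ N) · 1#
      eq n N n≥N = begin
        n · 1# - N · 1#                        ≡⟨ ≡.cong (λ m → m · 1# - N · 1#) (ℕ.m∸n+n≡m n≥N) ⟨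
        (n ℕ.∸ N ℕ.+ N) · 1# - N · 1#          ≈⟨ +-congʳ (×-homo-+ 1# (n ℕ.∸ N) N) ⟩
        ((n ℕ.∸ N) · 1# + N · 1#) - N · 1#     ≈⟨ cancelʳ _ _ ⟩
        (n ℕ.∸ N) · 1#                         ∎

  module _ {ρ} (0<ρ : 0# < ρ) (ρ<1 : ρ < 1#) where
    private
      h = 1# - ρ

      0<h : 0# < h
      0<h = <⇒0<- ρ<1

    1-^-nonneg : ∀ n → ¬ (1# - ρ ^ n < 0#)
    1-^-nonneg zero    x<0 = ≤-refl (<-resp (-‿inverseʳ 1#) refl x<0)
    1-^-nonneg (suc n) x<0 = nonneg+nonneg (nonneg*pos (1-^-nonneg n) 0<ρ) (<⇒≤ 0<h)
      (<-resp (eq ρ (ρ ^ n)) refl x<0)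
      where
      eq : ∀ ρ p → 1# - ρ * p ≈ (1# - p) * ρ + (1# - ρ)
      eq = solve 2 (λ ρ p → con 1ℤ :- ρ :* p := (con 1ℤ :- p) :* ρ :+ (con 1ℤ :- ρ)) refl

    bernoulli : ∀ n → ¬ (1# - ρ ^ n * (1# + n · 1# * h) < 0#)
    bernoulli zero    x<0 = ≤-refl (<-resp (eq h) refl x<0)
      where
      eq : ∀ h → 1# - 1# * (1# + 0# * h) ≈ 0#
      eq = solve 1 (λ h → con 1ℤ :- con 1ℤ :* (con 1ℤ :+ con 0ℤ :* h) := con 0ℤ) refl
    bernoulli (suc n) x<0 = nonneg+nonneg (nonneg*pos (bernoulli n) 0<ρ)
      (nonneg*pos (1-^-nonneg (suc n)) 0<h) (<-resp (eq ρ (ρ ^ n) (n · 1#)) refl x<0)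
      where
      eq : ∀ ρ p n → 1# - ρ * p * (1# + (1# + n) * (1# - ρ))
                     ≈ (1# - p * (1# + n * (1# - ρ))) * ρ + (1# - ρ * p) * (1# - ρ)
      eq = solve 3 (λ ρ p n →
        con 1ℤ :- ρ :* p :* (con 1ℤ :+ (con 1ℤ :+ n) :* (con 1ℤ :- ρ))
        := (con 1ℤ :- p :* (con 1ℤ :+ n :* (con 1ℤ :- ρ))) :* ρ
           :+ (con 1ℤ :- ρ :* p) :* (con 1ℤ :- ρ)) refl

    opaque
      ^-null : ∀ {ε} → 0# < ε → ∃[ N ] (∀ n → n ≥ N → ρ ^ n < ε)
      ^-null {ε} 0<ε =
        let 0<hε = *-pos 0<h 0<ε
            y , 0<y , hεy≈1 = recip 0<hε
            N , y< = archimedean-≥ y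
        in N , λ n n≥N →
          let 0<n = <-trans 0<y (y< n n≥N)
              0<1+nh = +-pos 0<1 (*-pos 0<n 0<h)
              1<nhε = <-resp hεy≈1 (eq₁ h ε (n · 1#)) (*-monoʳ-< 0<hε (y< n n≥N))
              1<[1+nh]ε = <-trans 1<nhε (<-resp refl (eq₂ (n · 1# * h) ε) (x<x+y 0<ε))
          in *-cancelˡ-< 0<1+nh (<-resp (*-comm _ _) refl
               (≤-<-trans (nonneg⇒≤ (bernoulli n)) 1<[1+nh]ε))
        where
        eq₁ : ∀ h ε n → h * ε * n ≈ n * h * ε
        eq₁ = solve 3 (λ h ε n → h :* ε :* n := n :* h :* ε) refl

        eq₂ : ∀ x ε → x * ε + ε ≈ (1# + x) * ε
        eq₂ = solve 2 (λ x ε → x :* ε :+ ε := (con 1ℤ :+ x) :* ε) refl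

-- The absolute value enters only through its open balls, so that no square
-- roots are needed.
record ValuedField {c ℓ₁ ℓ₂} (R : CompleteOrderedField c ℓ₁ ℓ₂) k ℓ
       : Set (lsuc (c ⊔ ℓ₁ ⊔ ℓ₂ ⊔ k ⊔ ℓ)) where
  private module ℝ = CompleteOrderedField R
  open RawSemiringDefs (RawRing.rawSemiring (CommutativeRing.rawRing ℝ.commutativeRing))
    using () renaming (_×_ to _·ℝ_)

  infix 4 ∣_∣<_

  field
    commutativeRing : CommutativeRing k ℓ

  open CommutativeRing commutativeRing public
  open RawSemiringDefs (RawRing.rawSemiring rawRing) public
    using (_^_; sum; product) renaming (_×_ to _·_)

  field
    ∣_∣<_     : Carrier → ℝ.Carrier → Set ℓ₂
    ∣∣-resp   : ∀ {z w ε δ} → z ≈ w → ε ℝ.≈ δ → ∣ z ∣< ε → ∣ w ∣< δ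
    ∣∣-<      : ∀ {z ε δ} → ℝ.0# ℝ.< ε → ε ℝ.< δ → ∣ z ∣< ε → ∣ z ∣< δ
    ∣0∣       : ∀ {ε} → ℝ.0# ℝ.< ε → ∣ 0# ∣< ε
    ∣-∣       : ∀ {z ε} → ∣ z ∣< ε → ∣ - z ∣< ε
    ∣+∣       : ∀ {z w ε δ} → ℝ.0# ℝ.< ε → ℝ.0# ℝ.< δ →
                ∣ z ∣< ε → ∣ w ∣< δ → ∣ z + w ∣< ε ℝ.+ δ
    ∣*∣       : ∀ {z w ε δ} → ℝ.0# ℝ.< ε → ℝ.0# ℝ.< δ →
                ∣ z ∣< ε → ∣ w ∣< δ → ∣ z * w ∣< ε ℝ.* δ
    bounded   : ∀ z → ∃[ M ] ℝ.0# ℝ.< M × ∣ z ∣< M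
    separated : ∀ {z} → (∀ ε → ℝ.0# ℝ.< ε → ∣ z ∣< ε) → z ≈ 0#
    shrink    : ∀ {z ε} → ℝ.0# ℝ.< ε → ∣ z ∣< ε →
                ∃[ δ ] ℝ.0# ℝ.< δ × δ ℝ.< ε × ∣ z ∣< δ
    ∣1/1-z∣   : ∀ {z w δ} → ℝ.0# ℝ.< δ → δ ℝ.+ δ ℝ.≈ ℝ.1# → ∣ z ∣< δ →
                w * (1# - z) ≈ 1# → ∣ w ∣< ℝ.1# ℝ.+ ℝ.1#
    ∣1/n∣     : ∀ {w ε} n → ℝ.0# ℝ.< ε → w * (n · 1#) ≈ 1# →
                ℝ.1# ℝ.< ε ℝ.* (n ·ℝ ℝ.1#) → ∣ w ∣< ε

  infix 4 _⟶_ _sumsTo_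

  Null : (ℕ → Carrier) → Set (c ⊔ ℓ₂)
  Null u = ∀ ε → ℝ.0# ℝ.< ε → ∃[ N ] (∀ n → n ≥ N → ∣ u n ∣< ε)

  _⟶_ : (ℕ → Carrier) → Carrier → Set (c ⊔ ℓ₂)
  u ⟶ l = Null λ n → u n - l

  Σ< : ℕ → (ℕ → Carrier) → Carrier
  Σ< n f = sum {n} (f ∘ toℕ)

  _sumsTo_ : (ℕ → Carrier) → Carrier → Set (c ⊔ ℓ₂)
  u sumsTo s = (λ n → Σ< n u) ⟶ s

  field
    complete  : ∀ u →
      (∀ ε → ℝ.0# ℝ.< ε → ∃[ N ] (∀ m n → m ≥ N → n ≥ N → ∣ u m - u n ∣< ε)) →
      ∃[ l ] u ⟶ l

module FiniteSums {k ℓ} (K : CommutativeRing k ℓ) where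
  open CommutativeRing K
  open RawSemiringDefs (RawRing.rawSemiring rawRing) using (sum; product)
  open SemiringSum semiring using (sum-cong-≋; ∑-distrib-+; *-distribˡ-sum)
  open SetoidReasoning setoid

  private
    Σ< : ℕ → (ℕ → Carrier) → Carrier
    Σ< n f = sum {n} (f ∘ toℕ)

  Σ-cong< : ∀ n {f g : ℕ → Carrier} → (∀ i → i ℕ.< n → f i ≈ g i) → Σ< n f ≈ Σ< n g
  Σ-cong< n eq = sum-cong-≋ {n} λ i → eq (toℕ i) (Fin.toℕ<n i)

  Σ-cong : ∀ n {f g : ℕ → Carrier} → (∀ i → f i ≈ g i) → Σ< n f ≈ Σ< n g
  Σ-cong n eq = Σ-cong< n λ i _ → eq i

  Σ-+ : ∀ n (f g : ℕ → Carrier) → Σ< n (λ i → f i + g i) ≈ Σ< n f + Σ< n g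
  Σ-+ n f g = ∑-distrib-+ {n} (f ∘ toℕ) (g ∘ toℕ)

  Σ-*ˡ : ∀ n a (f : ℕ → Carrier) → Σ< n (λ i → a * f i) ≈ a * Σ< n f
  Σ-*ˡ n a f = sym (*-distribˡ-sum {n} a (f ∘ toℕ))

  Σ-snoc : ∀ n (f : ℕ → Carrier) → Σ< (suc n) f ≈ Σ< n f + f n
  Σ-snoc zero    f = +-comm _ _
  Σ-snoc (suc n) f = trans (+-congˡ (Σ-snoc n (f ∘ suc))) (sym (+-assoc _ _ _))

  Σ-split : ∀ m n (f : ℕ → Carrier) → Σ< (m ℕ.+ n) f ≈ Σ< m f + Σ< n (λ i → f (m ℕ.+ i))
  Σ-split zero    n f = sym (+-identityˡ _)
  Σ-split (suc m) n f = trans (+-congˡ (Σ-split m n (f ∘ suc))) (sym (+-assoc _ _ _))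

  Σ-reverse : ∀ n (f : ℕ → ℕ → Carrier) →
    Σ< (suc n) (λ i → f i (n ∸ i)) ≈ Σ< (suc n) (λ i → f (n ∸ i) i)
  Σ-reverse zero    f = refl
  Σ-reverse (suc n) f = begin
    f 0 (suc n) + Σ< (suc n) (λ i → f (suc i) (n ∸ i))
      ≈⟨ +-congˡ (Σ-reverse n (f ∘ suc)) ⟩
    f 0 (suc n) + Σ< (suc n) (λ i → f (suc (n ∸ i)) i)
      ≈⟨ +-cong (reflexive (≡.cong (λ m → f m (suc n)) (≡.sym (ℕ.n∸n≡0 n))))
                (Σ-cong< (suc n) λ i i≤n → reflexive
                  (≡.cong (λ m → f m i) (≡.sym (ℕ.+-∸-assoc 1 (ℕ.s≤s⁻¹ i≤n))))) ⟩
    f (suc n ∸ suc n) (suc n) + Σ< (suc n) (λ i → f (suc n ∸ i) i)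
      ≈⟨ +-comm _ _ ⟩
    Σ< (suc n) (λ i → f (suc n ∸ i) i) + f (suc n ∸ suc n) (suc n)
      ≈⟨ Σ-snoc (suc n) (λ i → f (suc n ∸ i) i) ⟨
    Σ< (suc (suc n)) (λ i → f (suc n ∸ i) i) ∎

  Π-cong : ∀ n {f g : ℕ → Carrier} → (∀ i → f i ≈ g i) →
           product {n} (f ∘ toℕ) ≈ product {n} (g ∘ toℕ)
  Π-cong zero    eq = refl
  Π-cong (suc n) eq = *-cong (eq 0) (Π-cong n (eq ∘ suc))

  Π-snoc : ∀ n (f : ℕ → Carrier) →
           product {suc n} (f ∘ toℕ) ≈ product {n} (f ∘ toℕ) * f n
  Π-snoc zero    f = *-comm _ _
  Π-snoc (suc n) f = trans (*-congˡ (Π-snoc n (f ∘ suc))) (sym (*-assoc _ _ _))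

  convolve : (ℕ → Carrier) → (ℕ → Carrier) → ℕ → Carrier
  convolve b c n = Σ< (suc n) λ i → b i * c (n ∸ i)

  Σ-convolve : ∀ n b c → Σ< n (convolve b c) ≈ Σ< n (λ i → c i * Σ< (n ∸ i) b)
  Σ-convolve zero    b c = refl
  Σ-convolve (suc n) b c = sym (begin
    Σ< (suc n) (λ i → c i * Σ< (suc n ∸ i) b)
      ≈⟨ Σ-cong< (suc n) (λ i i≤n → step i (ℕ.s≤s⁻¹ i≤n)) ⟩
    Σ< (suc n) (λ i → c i * Σ< (n ∸ i) b + b (n ∸ i) * c i)
      ≈⟨ Σ-+ (suc n) (λ i → c i * Σ< (n ∸ i) b) (λ i → b (n ∸ i) * c i) ⟩
    Σ< (suc n) (λ i → c i * Σ< (n ∸ i) b) + Σ< (suc n) (λ i → b (n ∸ i) * c i)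
      ≈⟨ +-cong (Σ-snoc n λ i → c i * Σ< (n ∸ i) b) (sym (Σ-reverse n λ i j → b i * c j)) ⟩
    (Σ< n (λ i → c i * Σ< (n ∸ i) b) + c n * Σ< (n ∸ n) b) + convolve b c n
      ≈⟨ +-congʳ (+-congˡ (*-congˡ (reflexive (≡.cong (λ m → Σ< m b) (ℕ.n∸n≡0 n))))) ⟩
    (Σ< n (λ i → c i * Σ< (n ∸ i) b) + c n * 0#) + convolve b c n
      ≈⟨ +-congʳ (trans (+-congˡ (zeroʳ (c n))) (+-identityʳ _)) ⟩
    Σ< n (λ i → c i * Σ< (n ∸ i) b) + convolve b c n
      ≈⟨ +-congʳ (Σ-convolve n b c) ⟨
    Σ< n (convolve b c) + convolve b c n
      ≈⟨ Σ-snoc n (convolve b c) ⟨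
    Σ< (suc n) (convolve b c) ∎)
    where
    step : ∀ i → i ℕ.≤ n →
           c i * Σ< (suc n ∸ i) b ≈ c i * Σ< (n ∸ i) b + b (n ∸ i) * c i
    step i i≤n = begin
      c i * Σ< (suc n ∸ i) b
        ≡⟨ ≡.cong (λ m → c i * Σ< m b) (ℕ.+-∸-assoc 1 i≤n) ⟩
      c i * Σ< (suc (n ∸ i)) b
        ≈⟨ *-congˡ (Σ-snoc (n ∸ i) b) ⟩
      c i * (Σ< (n ∸ i) b + b (n ∸ i))
        ≈⟨ distribˡ _ _ _ ⟩
      c i * Σ< (n ∸ i) b + c i * b (n ∸ i)
        ≈⟨ +-congˡ (*-comm _ _) ⟩
      c i * Σ< (n ∸ i) b + b (n ∸ i) * c i ∎

module Limits {c ℓ₁ ℓ₂} {R : CompleteOrderedField c ℓ₁ ℓ₂} {k ℓ} (V : ValuedField R k ℓ) where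
  module ℝ where
    open CompleteOrderedField R public
    open IsStrictPartialOrder isStrictPartialOrder public
      using () renaming (irrefl to <-irrefl; trans to <-trans)
    open OrderedFieldProperties R public
    open OrderedFieldArithmetic R public
    open RawSemiringDefs (RawRing.rawSemiring (CommutativeRing.rawRing commutativeRing)) public
      using (_^_)
  open ℝ using (_<_; 0<1)
  open ValuedField V
  open FiniteSums commutativeRing
  open IntegerMultiples commutativeRing
  open SetoidReasoning setoid

  ∣∣-congˡ : ∀ {z w ε} → z ≈ w → ∣ z ∣< ε → ∣ w ∣< ε
  ∣∣-congˡ eq = ∣∣-resp eq ℝ.refl

  ∣∣-congʳ : ∀ {z ε δ} → ε ℝ.≈ δ → ∣ z ∣< ε → ∣ z ∣< δ
  ∣∣-congʳ eq = ∣∣-resp refl eq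

  Bounded : (ℕ → Carrier) → Set _
  Bounded u = ∃[ M ] ℝ.0# < M × (∀ n → ∣ u n ∣< M)

  Null-cong : ∀ {u v} → (∀ n → u n ≈ v n) → Null u → Null v
  Null-cong u≈v u→0 ε 0<ε = let N , u< = u→0 ε 0<ε in
    N , λ n n≥N → ∣∣-congˡ (u≈v n) (u< n n≥N)

  Null-0 : Null (λ _ → 0#)
  Null-0 ε 0<ε = 0 , λ _ _ → ∣0∣ 0<ε

  Null-neg : ∀ {u} → Null u → Null (λ n → - u n)
  Null-neg u→0 ε 0<ε = let N , u< = u→0 ε 0<ε in N , λ n n≥N → ∣-∣ (u< n n≥N)

  Null-+ : ∀ {u v} → Null u → Null v → Null (λ n → u n + v n)
  Null-+ u→0 v→0 ε 0<ε =
    let h , 0<h , h+h≈ε = ℝ.halve 0<ε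
        M , u< = u→0 h 0<h
        N , v< = v→0 h 0<h
    in M ℕ.+ N , λ n n≥ → ∣∣-congʳ h+h≈ε (∣+∣ 0<h 0<h
         (u< n (ℕ.≤-trans (ℕ.m≤m+n M N) n≥)) (v< n (ℕ.≤-trans (ℕ.m≤n+m N M) n≥)))

  Null-*-Bounded : ∀ {u v} → Null u → Bounded v → Null (λ n → u n * v n)
  Null-*-Bounded u→0 (M , 0<M , v<) ε 0<ε =
    let δ , 0<δ , Mδ≈ε = ℝ.divide ε 0<M 0<ε
        N , u< = u→0 δ 0<δ
    in N , λ n n≥N → ∣∣-congʳ (ℝ.trans (ℝ.*-comm δ M) Mδ≈ε) (∣*∣ 0<δ 0<M (u< n n≥N) (v< n))

  Null-shift : ∀ m {u} → Null u → Null (λ n → u (m ℕ.+ n))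
  Null-shift m u→0 ε 0<ε = let N , u< = u→0 ε 0<ε in
    N , λ n n≥N → u< (m ℕ.+ n) (ℕ.≤-trans n≥N (ℕ.m≤n+m n m))

  Null-unsuc : ∀ {u} → Null (u ∘ suc) → Null u
  Null-unsuc u→0 ε 0<ε = let N , u< = u→0 ε 0<ε in
    suc N , λ { (suc n) n≥N → u< n (ℕ.s≤s⁻¹ n≥N) }

  Bounded-const : ∀ z → Bounded (λ _ → z)
  Bounded-const z = let M , 0<M , z< = bounded z in M , 0<M , λ _ → z<

  Bounded-+ : ∀ {u v} → Bounded u → Bounded v → Bounded (λ n → u n + v n)
  Bounded-+ (M , 0<M , u<) (N , 0<N , v<) = M ℝ.+ N , ℝ.+-pos 0<M 0<N
    , λ n → ∣+∣ 0<M 0<N (u< n) (v< n)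

  Bounded-cong : ∀ {u v} → (∀ n → u n ≈ v n) → Bounded u → Bounded v
  Bounded-cong u≈v (M , 0<M , u<) = M , 0<M , λ n → ∣∣-congˡ (u≈v n) (u< n)

  Null⇒Bounded : ∀ {u} → Null u → Bounded u
  Null⇒Bounded {u} u→0 = let N , u< = u→0 ℝ.1# 0<1 in go u N u<
    where
    go : ∀ u N → (∀ n → n ≥ N → ∣ u n ∣< ℝ.1#) → Bounded u
    go u zero    u< = ℝ.1# , 0<1 , λ n → u< n ℕ.z≤n
    go u (suc N) u< =
      let K , 0<K , u₀< = bounded (u 0)
          M , 0<M , u₊< = go (u ∘ suc) N (λ n n≥N → u< (suc n) (ℕ.s≤s n≥N))
      in K ℝ.+ M , ℝ.+-pos 0<K 0<M
         , λ { zero    → ∣∣-< 0<K (ℝ.x<x+y 0<M) u₀<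
             ; (suc n) → ∣∣-< 0<M (ℝ.<-resp ℝ.refl (ℝ.+-comm M K) (ℝ.x<x+y 0<K)) (u₊< n) }

  ⟶⇒Bounded : ∀ {u l} → u ⟶ l → Bounded u
  ⟶⇒Bounded {u} {l} u→l = Bounded-cong (λ n → eq (u n) l)
    (Bounded-+ (Null⇒Bounded u→l) (Bounded-const l))
    where
    eq : ∀ x l → (x - l) + l ≈ x
    eq = solve 2 (λ x l → (x :- l) :+ l := x) refl

  ⟶-cong : ∀ {u v l} → (∀ n → u n ≈ v n) → u ⟶ l → v ⟶ l
  ⟶-cong u≈v = Null-cong λ n → +-congʳ (u≈v n)

  ⟶-congʳ : ∀ {u l m} → l ≈ m → u ⟶ l → u ⟶ m
  ⟶-congʳ l≈m = Null-cong λ n → +-congˡ (-‿cong l≈m)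

  ⟶-const : ∀ z → (λ _ → z) ⟶ z
  ⟶-const z = Null-cong (λ _ → sym (-‿inverseʳ z)) Null-0

  Null⇒⟶0 : ∀ {u} → Null u → u ⟶ 0#
  Null⇒⟶0 {u} = Null-cong λ n → eq (u n)
    where
    eq : ∀ x → x ≈ x - 0#
    eq = solve 1 (λ x → x := x :- con 0ℤ) refl

  ⟶-unique : ∀ {u l m} → u ⟶ l → u ⟶ m → l ≈ m
  ⟶-unique {u} {l} {m} u→l u→m = begin
    l              ≈⟨ eq₁ l m ⟩
    (l - m) + m    ≈⟨ +-congʳ (separated λ ε 0<ε →
                        let N , h = Null-cong (λ n → eq₂ (u n) l m) (Null-+ u→m (Null-neg u→l)) ε 0<ε
                        in h N ℕ.≤-refl) ⟩
    0# + m         ≈⟨ +-identityˡ m ⟩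
    m              ∎
    where
    eq₁ : ∀ l m → l ≈ (l - m) + m
    eq₁ = solve 2 (λ l m → l := (l :- m) :+ m) refl

    eq₂ : ∀ x l m → (x - m) - (x - l) ≈ l - m
    eq₂ = solve 3 (λ x l m → (x :- m) :- (x :- l) := l :- m) refl

  ⟶-+ : ∀ {u v l m} → u ⟶ l → v ⟶ m → (λ n → u n + v n) ⟶ l + m
  ⟶-+ {u} {v} {l} {m} u→l v→m = Null-cong (λ n → eq (u n) (v n) l m) (Null-+ u→l v→m)
    where
    eq : ∀ x y l m → (x - l) + (y - m) ≈ (x + y) - (l + m)
    eq = solve 4 (λ x y l m → (x :- l) :+ (y :- m) := (x :+ y) :- (l :+ m)) refl

  ⟶-* : ∀ {u v l m} → u ⟶ l → v ⟶ m → (λ n → u n * v n) ⟶ l * m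
  ⟶-* {u} {v} {l} {m} u→l v→m = Null-cong (λ n → eq (u n) (v n) l m)
    (Null-+ (Null-*-Bounded u→l (⟶⇒Bounded v→m)) (Null-*-Bounded v→m (Bounded-const l)))
    where
    eq : ∀ x y l m → (x - l) * y + (y - m) * l ≈ x * y - l * m
    eq = solve 4 (λ x y l m → (x :- l) :* y :+ (y :- m) :* l := x :* y :- l :* m) refl

  ⟶-*ˡ : ∀ z {u l} → u ⟶ l → (λ n → z * u n) ⟶ z * l
  ⟶-*ˡ z = ⟶-* (⟶-const z)

  ⟶-suc : ∀ {u l} → u ⟶ l → u ∘ suc ⟶ l
  ⟶-suc = Null-shift 1

  ⟶-unsuc : ∀ {u l} → u ∘ suc ⟶ l → u ⟶ l
  ⟶-unsuc {u} {l} = Null-unsuc {λ n → u n - l}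

  sumsTo-cong : ∀ {u v s} → (∀ n → u n ≈ v n) → u sumsTo s → v sumsTo s
  sumsTo-cong u≈v = ⟶-cong λ n → Σ-cong n u≈v

  sumsTo-suc : ∀ {u s} → u sumsTo s → (u ∘ suc) sumsTo (s - u 0)
  sumsTo-suc {u} {s} u→s = Null-cong (λ n → eq (u 0) (Σ< n (u ∘ suc)) s) (⟶-suc u→s)
    where
    eq : ∀ x y s → (x + y) - s ≈ y - (s - x)
    eq = solve 3 (λ x y s → (x :+ y) :- s := y :- (s :- x)) refl

  -- The limit of the inverses of 1 - uₙ, without assuming that they converge.
  1/1-Null : ∀ {u w} → Null u → (∀ n → w n * (1# - u n) ≈ 1#) → w ⟶ 1#
  1/1-Null {u} {w} u→0 inv ε 0<ε =
    let h , 0<h , h+h≈1 = ℝ.halve 0<1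
        δ , 0<δ , 2δ≈ε = ℝ.divide ε 0<2 0<ε
        M , u<h = u→0 h 0<h
        N , u<δ = u→0 δ 0<δ
    in M ℕ.+ N , λ n n≥ →
         let w<2 = ∣1/1-z∣ 0<h h+h≈1 (u<h n (ℕ.≤-trans (ℕ.m≤m+n M N) n≥)) (inv n)
         in ∣∣-resp (eq n) 2δ≈ε (∣*∣ 0<2 0<δ w<2 (u<δ n (ℕ.≤-trans (ℕ.m≤n+m N M) n≥)))
    where
    0<2 = ℝ.+-pos 0<1 0<1

    expand : ∀ w u → w * u ≈ w - w * (1# - u)
    expand = solve 2 (λ w u → w :* u := w :- w :* (con 1ℤ :- u)) refl

    eq : ∀ n → w n * u n ≈ w n - 1#
    eq n = trans (expand (w n) (u n)) (+-congˡ (-‿cong (inv n)))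

  Dominated : ℝ.Carrier → ℝ.Carrier → (ℕ → Carrier) → Set _
  Dominated K ρ u = ∀ n → ∣ u n ∣< K ℝ.* ρ ℝ.^ n

  Geometric : (ℕ → Carrier) → Set _
  Geometric u = ∃[ K ] ∃[ ρ ] ℝ.0# < K × ℝ.0# < ρ × ρ < ℝ.1# × Dominated K ρ u

  module _ {ρ} (0<ρ : ℝ.0# < ρ) where
    private
      Kρ^ : ∀ {K} → ℝ.0# < K → ∀ n → ℝ.0# < K ℝ.* ρ ℝ.^ n
      Kρ^ 0<K n = ℝ.*-pos 0<K (ℝ.^-pos 0<ρ n)

      enlarge : ∀ {K L} → ℝ.0# < K → ℝ.0# < L → ∀ {z} n →
                ∣ z ∣< K ℝ.* ρ ℝ.^ n → ∣ z ∣< (K ℝ.+ L) ℝ.* ρ ℝ.^ n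
      enlarge 0<K 0<L n = ∣∣-< (Kρ^ 0<K n) (ℝ.*-monoˡ-< (ℝ.^-pos 0<ρ n) (ℝ.x<x+y 0<L))

    dominated-up-to : ∀ (u : ℕ → Carrier) N → ∃[ K ] ℝ.0# < K × (∀ n → n ℕ.< N → ∣ u n ∣< K ℝ.* ρ ℝ.^ n)
    dominated-up-to u zero    = ℝ.1# , 0<1 , λ _ ()
    dominated-up-to u (suc N) =
      let K , 0<K , u< = dominated-up-to u N
          M , 0<M , uN< = bounded (u N)
          L , 0<L , eq = ℝ.divide M (ℝ.^-pos 0<ρ N) 0<M
      in K ℝ.+ L , ℝ.+-pos 0<K 0<L
         , λ n n<1+N →
             [ (λ n<N → enlarge 0<K 0<L n (u< n n<N))
             , (λ { ≡.refl → ∣∣-congʳ (ℝ.*-congʳ (ℝ.+-comm L K))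
                      (enlarge 0<L 0<K n (∣∣-congʳ (ℝ.trans (ℝ.sym eq) (ℝ.*-comm _ L)) uN<)) })
             ]′ (ℕ.m≤n⇒m<n∨m≡n (ℕ.s≤s⁻¹ n<1+N))

    ratio-test : ∀ {u β b} → (∀ n → u (suc n) ≈ β n * u n) → β ⟶ b → ∣ b ∣< ρ →
                 ∃[ K ] ℝ.0# < K × Dominated K ρ u
    ratio-test {u} {β} {b} rec β→b b<ρ =
      let δ , 0<δ , δ<ρ , b<δ = shrink 0<ρ b<ρ
          0<ρ-δ = ℝ.<⇒0<- δ<ρ
          N , β-b< = β→b (ρ ℝ.- δ) 0<ρ-δ
          K , 0<K , u< = dominated-up-to u (suc N)
      in K , 0<K , go 0<K N u< λ n n≥N →
           ∣∣-resp (cancel (β n) b) (ℝ.cancel ρ δ) (∣+∣ 0<ρ-δ 0<δ (β-b< n n≥N) b<δ)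
      where
      cancel : ∀ x b → (x - b) + b ≈ x
      cancel = solve 2 (λ x b → (x :- b) :+ b := x) refl

      go : ∀ {K} → ℝ.0# < K → ∀ N → (∀ n → n ℕ.< suc N → ∣ u n ∣< K ℝ.* ρ ℝ.^ n) →
           (∀ n → n ≥ N → ∣ β n ∣< ρ) → Dominated K ρ u
      go 0<K N u< β< zero    = u< 0 (ℕ.s≤s ℕ.z≤n)
      go {K} 0<K N u< β< (suc n) =
        [ u< (suc n)
        , (λ N<1+n → ∣∣-resp (sym (rec n)) (rearrange ρ K (ρ ℝ.^ n))
            (∣*∣ 0<ρ (Kρ^ 0<K n) (β< n (ℕ.s≤s⁻¹ N<1+n)) (go 0<K N u< β< n)))
        ]′ (ℕ.<-≤-connex (suc n) (suc N))
        where
        open IntegerMultiples ℝ.commutativeRing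
          using () renaming (solve to solveℝ; _:*_ to _⊗_; _:=_ to _⊜_)
        rearrange : ∀ ρ K p → ρ ℝ.* (K ℝ.* p) ℝ.≈ K ℝ.* (ρ ℝ.* p)
        rearrange = solveℝ 3 (λ ρ K p → (ρ ⊗ (K ⊗ p)) ⊜ (K ⊗ (ρ ⊗ p))) ℝ.refl

  ratio⇒geometric : ∀ {u β b} → (∀ n → u (suc n) ≈ β n * u n) → β ⟶ b → ∣ b ∣< ℝ.1# →
                    Geometric u
  ratio⇒geometric rec β→b b<1 =
    let ρ , 0<ρ , ρ<1 , b<ρ = shrink 0<1 b<1
        K , 0<K , u< = ratio-test 0<ρ rec β→b b<ρ
    in K , ρ , 0<K , 0<ρ , ρ<1 , u<

  Geometric⇒Null : ∀ {u} → Geometric u → Null u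
  Geometric⇒Null (K , ρ , 0<K , 0<ρ , ρ<1 , u<) ε 0<ε =
    let δ , 0<δ , Kδ≈ε = ℝ.divide ε 0<K 0<ε
        N , ρ^n< = ℝ.^-null 0<ρ ρ<1 0<δ
    in N , λ n n≥N → ∣∣-< (ℝ.*-pos 0<K (ℝ.^-pos 0<ρ n))
         (ℝ.<-resp ℝ.refl Kδ≈ε (ℝ.*-monoʳ-< 0<K (ρ^n< n n≥N))) (u< n)

  ^-geometric : ∀ {z} → ∣ z ∣< ℝ.1# → Geometric (z ^_)
  ^-geometric {z} = ratio⇒geometric {β = λ _ → z} (λ _ → refl) (⟶-const z)

  ^-Null : ∀ {z} → ∣ z ∣< ℝ.1# → Null (z ^_)
  ^-Null z<1 = Geometric⇒Null (^-geometric z<1)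

module Series {c ℓ₁ ℓ₂} {R : CompleteOrderedField c ℓ₁ ℓ₂} {k ℓ} (V : ValuedField R k ℓ) where
  open Limits V
  open ℝ using (_<_; 0<1)
  open ValuedField V
  open FiniteSums commutativeRing
  open IntegerMultiples commutativeRing
  open SetoidReasoning setoid

  private
    module ℝ^ = SemiringExp (CommutativeRing.semiring ℝ.commutativeRing)

  open IntegerMultiples ℝ.commutativeRing using () renaming
    (solve to solveℝ; con to conℝ; _:*_ to _⊗_; _:+_ to _⊕_; _:-_ to _⊖_; _:=_ to _⊜_)

  module GeometricSeries {ρ} (0<ρ : ℝ.0# < ρ) (ρ<1 : ρ < ℝ.1#) where
    private
      recip-1-ρ = ℝ.recip (ℝ.<⇒0<- ρ<1)

    opaque
      G : ℝ.Carrier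
      G = proj₁ recip-1-ρ

      0<G : ℝ.0# < G
      0<G = proj₁ (proj₂ recip-1-ρ)

      [1-ρ]G≈1 : (ℝ.1# ℝ.- ρ) ℝ.* G ℝ.≈ ℝ.1#
      [1-ρ]G≈1 = proj₂ (proj₂ recip-1-ρ)

    Σ-dominated : ∀ N {f : ℕ → Carrier} {K} → ℝ.0# < K →
                  (∀ n → n ℕ.< N → ∣ f n ∣< K ℝ.* ρ ℝ.^ n) → ∣ Σ< N f ∣< K ℝ.* G
    Σ-dominated zero    0<K f< = ∣0∣ (ℝ.*-pos 0<K 0<G)
    Σ-dominated (suc N) {f} {K} 0<K f< = ∣∣-congʳ K1+KρG≈KG
      (∣+∣ (ℝ.*-pos 0<K 0<1) (ℝ.*-pos 0<Kρ 0<G) (f< 0 (ℕ.s≤s ℕ.z≤n))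
        (Σ-dominated N 0<Kρ λ n n<N →
          ∣∣-congʳ (ℝ.sym (ℝ.*-assoc K ρ _)) (f< (suc n) (ℕ.s≤s n<N))))
      where
      0<Kρ : ℝ.0# < K ℝ.* ρ
      0<Kρ = ℝ.*-pos 0<K 0<ρ

      eq : ∀ K ρ G o → K ℝ.* o ℝ.+ K ℝ.* ρ ℝ.* G ℝ.≈ K ℝ.* (o ℝ.+ ρ ℝ.* G)
      eq = solveℝ 4 (λ K ρ G o → ((K ⊗ o) ⊕ ((K ⊗ ρ) ⊗ G)) ⊜ (K ⊗ (o ⊕ (ρ ⊗ G)))) ℝ.refl

      eq′ : ∀ ρ G → (ℝ.1# ℝ.- ρ) ℝ.* G ℝ.+ ρ ℝ.* G ℝ.≈ G
      eq′ = solveℝ 2 (λ ρ G → (((conℝ 1ℤ ⊖ ρ) ⊗ G) ⊕ (ρ ⊗ G)) ⊜ G) ℝ.refl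

      K1+KρG≈KG : K ℝ.* ℝ.1# ℝ.+ K ℝ.* ρ ℝ.* G ℝ.≈ K ℝ.* G
      K1+KρG≈KG = ℝ.trans (eq K ρ G ℝ.1#) (ℝ.*-congˡ
        (ℝ.trans (ℝ.+-congʳ (ℝ.sym [1-ρ]G≈1)) (eq′ ρ G)))

  module _ {K ρ} (0<K : ℝ.0# < K) (0<ρ : ℝ.0# < ρ) (ρ<1 : ρ < ℝ.1#) where
    open GeometricSeries 0<ρ ρ<1

    tails-vanish : ∀ {ε} → ℝ.0# < ε → ∃[ N ] (∀ n → n ≥ N → K ℝ.* ρ ℝ.^ n < ε)
    tails-vanish {ε} 0<ε =
      let δ , 0<δ , Kδ≈ε = ℝ.divide ε 0<K 0<ε
          N , ρ^n< = ℝ.^-null 0<ρ ρ<1 0<δ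
      in N , λ n n≥N → ℝ.<-resp ℝ.refl Kδ≈ε (ℝ.*-monoʳ-< 0<K (ρ^n< n n≥N))

    Σ-tail : ∀ {f} → Dominated K ρ f → ∀ N m → ∣ Σ< m (λ i → f (N ℕ.+ i)) ∣< K ℝ.* ρ ℝ.^ N ℝ.* G
    Σ-tail f< N m = Σ-dominated m (ℝ.*-pos 0<K (ℝ.^-pos 0<ρ N)) λ i _ →
      ∣∣-congʳ (ℝ.trans (ℝ.*-congˡ (ℝ^.^-homo-* ρ N i)) (ℝ.sym (ℝ.*-assoc K _ _))) (f< (N ℕ.+ i))

  opaque
    summable : ∀ {f} → Geometric f → ∃[ s ] f sumsTo s
    summable {f} (K , ρ , 0<K , 0<ρ , ρ<1 , f<) = complete (λ n → Σ< n f) λ ε 0<ε →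
      let h , 0<h , h+h≈ε = ℝ.halve 0<ε
          δ , 0<δ , Gδ≈h = ℝ.divide h 0<G 0<h
          N , small = tails-vanish 0<K 0<ρ ρ<1 0<δ
          near : ∀ n → n ≥ N → ∣ Σ< n f - Σ< N f ∣< h
          near n n≥N = ∣∣-congˡ (split n N n≥N)
            (∣∣-< (ℝ.*-pos (ℝ.*-pos 0<K (ℝ.^-pos 0<ρ N)) 0<G)
              (ℝ.<-resp ℝ.refl (ℝ.trans (ℝ.*-comm δ G) Gδ≈h) (ℝ.*-monoˡ-< 0<G (small N ℕ.≤-refl)))
              (Σ-tail 0<K 0<ρ ρ<1 f< N (n ∸ N)))
      in N , λ m n m≥N n≥N → ∣∣-resp (eq₂ (Σ< m f) (Σ< n f) (Σ< N f)) h+h≈ε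
           (∣+∣ 0<h 0<h (near m m≥N) (∣-∣ (near n n≥N)))
      where
      open GeometricSeries 0<ρ ρ<1

      eq₁ : ∀ x y → y ≈ (x + y) - x
      eq₁ = solve 2 (λ x y → y := (x :+ y) :- x) refl

      eq₂ : ∀ x y z → (x - z) - (y - z) ≈ x - y
      eq₂ = solve 3 (λ x y z → (x :- z) :- (y :- z) := x :- y) refl

      split : ∀ n N → n ≥ N → Σ< (n ∸ N) (λ i → f (N ℕ.+ i)) ≈ Σ< n f - Σ< N f
      split n N n≥N = begin
        Σ< (n ∸ N) (λ i → f (N ℕ.+ i))                            ≈⟨ eq₁ (Σ< N f) _ ⟩
        (Σ< N f + Σ< (n ∸ N) (λ i → f (N ℕ.+ i))) - Σ< N f        ≈⟨ +-congʳ (Σ-split N (n ∸ N) f) ⟨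
        Σ< (N ℕ.+ (n ∸ N)) f - Σ< N f
          ≡⟨ ≡.cong (λ m → Σ< m f - Σ< N f) (ℕ.m+[n∸m]≡n n≥N) ⟩
        Σ< n f - Σ< N f                                           ∎

  -- The sum splits into a part where d is small and a part where c is small.
  convolve-Null : ∀ {c d} → Geometric c → Null d → Null (λ n → Σ< n (λ i → c i * d (n ∸ i)))
  convolve-Null {c} {d} (K , ρ , 0<K , 0<ρ , ρ<1 , c<) d→0 ε 0<ε =
    let M , 0<M , d<M = Null⇒Bounded d→0
        h , 0<h , h+h≈ε = ℝ.halve 0<ε
        δ , 0<δ , KGδ≈h = ℝ.divide h (ℝ.*-pos 0<K 0<G) 0<h
        J , d<δ = d→0 δ 0<δ
        η , 0<η , Mη≈δ = ℝ.divide δ 0<M 0<δ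
        N , ρ^n<η = ℝ.^-null 0<ρ ρ<1 0<η
    in N ℕ.+ J , λ n n≥ →
      let j = n ∸ J
          j≥N = ≡.subst (ℕ._≤ j) (ℕ.m+n∸n≡m N J) (ℕ.∸-monoˡ-≤ J n≥)
          n≡j+J = ≡.sym (ℕ.m∸n+n≡m (ℕ.≤-trans (ℕ.m≤n+m J N) n≥))
          first = Σ-dominated j (ℝ.*-pos 0<K 0<δ) λ i i<j →
            ∣∣-congʳ (eq₁ K (ρ ℝ.^ i) δ) (∣*∣ (ℝ.*-pos 0<K (ℝ.^-pos 0<ρ i)) 0<δ (c< i)
              (d<δ (n ∸ i) (≡.subst (λ m → J ℕ.≤ m ∸ i) (≡.sym n≡j+J)
                (≡.subst (J ℕ.≤_) (≡.sym (ℕ.+-∸-comm J (ℕ.<⇒≤ i<j))) (ℕ.m≤n+m J (j ∸ i))))))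
          0<Kρ^j = ℝ.*-pos 0<K (ℝ.^-pos 0<ρ j)
          second = Σ-dominated J (ℝ.*-pos 0<Kρ^j 0<M) λ i _ →
            ∣∣-congʳ (eq₂ i j M)
              (∣*∣ (ℝ.*-pos 0<K (ℝ.^-pos 0<ρ (j ℕ.+ i))) 0<M (c< (j ℕ.+ i)) (d<M (n ∸ (j ℕ.+ i))))
          Kρ^jMG<h = ℝ.<-resp (eq₃ K (ρ ℝ.^ j) M G)
            (ℝ.trans (eq₄ K M G η) (ℝ.trans (ℝ.*-congˡ Mη≈δ) KGδ≈h))
            (ℝ.*-monoʳ-< (ℝ.*-pos (ℝ.*-pos 0<K 0<G) 0<M) (ρ^n<η j j≥N))
      in ∣∣-resp (sym (split n j n≡j+J)) (ℝ.trans (ℝ.+-congʳ (ℝ.trans (eq₅ K δ G) KGδ≈h)) h+h≈ε)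
           (∣+∣ (ℝ.*-pos (ℝ.*-pos 0<K 0<δ) 0<G) 0<h first
             (∣∣-< (ℝ.*-pos (ℝ.*-pos 0<Kρ^j 0<M) 0<G) Kρ^jMG<h second))
    where
    open GeometricSeries 0<ρ ρ<1

    eq₁ : ∀ K p δ → K ℝ.* p ℝ.* δ ℝ.≈ K ℝ.* δ ℝ.* p
    eq₁ = solveℝ 3 (λ K p δ → ((K ⊗ p) ⊗ δ) ⊜ ((K ⊗ δ) ⊗ p)) ℝ.refl

    eq₂ : ∀ i j M → K ℝ.* ρ ℝ.^ (j ℕ.+ i) ℝ.* M ℝ.≈ K ℝ.* ρ ℝ.^ j ℝ.* M ℝ.* ρ ℝ.^ i
    eq₂ i j M = ℝ.trans (ℝ.*-congʳ (ℝ.*-congˡ (ℝ^.^-homo-* ρ j i))) (eq K (ρ ℝ.^ j) (ρ ℝ.^ i) M)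
      where
      eq : ∀ K p r M → K ℝ.* (p ℝ.* r) ℝ.* M ℝ.≈ K ℝ.* p ℝ.* M ℝ.* r
      eq = solveℝ 4 (λ K p r M → ((K ⊗ (p ⊗ r)) ⊗ M) ⊜ (((K ⊗ p) ⊗ M) ⊗ r)) ℝ.refl

    eq₃ : ∀ K p M G → K ℝ.* G ℝ.* M ℝ.* p ℝ.≈ K ℝ.* p ℝ.* M ℝ.* G
    eq₃ = solveℝ 4 (λ K p M G → (((K ⊗ G) ⊗ M) ⊗ p) ⊜ (((K ⊗ p) ⊗ M) ⊗ G)) ℝ.refl

    eq₄ : ∀ K M G η → K ℝ.* G ℝ.* M ℝ.* η ℝ.≈ K ℝ.* G ℝ.* (M ℝ.* η)
    eq₄ = solveℝ 4 (λ K M G η → (((K ⊗ G) ⊗ M) ⊗ η) ⊜ ((K ⊗ G) ⊗ (M ⊗ η))) ℝ.refl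

    eq₅ : ∀ K δ G → K ℝ.* δ ℝ.* G ℝ.≈ K ℝ.* G ℝ.* δ
    eq₅ = solveℝ 3 (λ K δ G → ((K ⊗ δ) ⊗ G) ⊜ ((K ⊗ G) ⊗ δ)) ℝ.refl

    split : ∀ n j {J} → n ≡ j ℕ.+ J → Σ< n (λ i → c i * d (n ∸ i)) ≈
            Σ< j (λ i → c i * d (n ∸ i)) + Σ< J (λ i → c (j ℕ.+ i) * d (n ∸ (j ℕ.+ i)))
    split n j {J} n≡j+J = trans
      (reflexive (≡.cong (λ m → Σ< m (λ i → c i * d (n ∸ i))) n≡j+J))
      (Σ-split j J (λ i → c i * d (n ∸ i)))

  mertens : ∀ {b c s t} → b sumsTo s → Geometric c → c sumsTo t → convolve b c sumsTo (t * s)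
  mertens {b} {c} {s} {t} b→s c-geo c→t = Null-cong (λ n → eq n)
    (Null-+ (convolve-Null c-geo b→s) (Null-*-Bounded c→t (Bounded-const s)))
    where
    eq₁ : ∀ c x s → c * (x - s) + s * c ≈ c * x
    eq₁ = solve 3 (λ c x s → c :* (x :- s) :+ s :* c := c :* x) refl

    eq₂ : ∀ x y s t → x + (y - t) * s ≈ (x + s * y) - t * s
    eq₂ = solve 4 (λ x y s t → x :+ (y :- t) :* s := (x :+ s :* y) :- t :* s) refl

    eq : ∀ n → Σ< n (λ i → c i * (Σ< (n ∸ i) b - s)) + (Σ< n c - t) * s
               ≈ Σ< n (convolve b c) - t * s
    eq n = begin
      Σ< n (λ i → c i * (Σ< (n ∸ i) b - s)) + (Σ< n c - t) * s
        ≈⟨ eq₂ _ (Σ< n c) s t ⟩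
      (Σ< n (λ i → c i * (Σ< (n ∸ i) b - s)) + s * Σ< n c) - t * s
        ≈⟨ +-congʳ (+-congˡ (Σ-*ˡ n s c)) ⟨
      (Σ< n (λ i → c i * (Σ< (n ∸ i) b - s)) + Σ< n (λ i → s * c i)) - t * s
        ≈⟨ +-congʳ (Σ-+ n (λ i → c i * (Σ< (n ∸ i) b - s)) (λ i → s * c i)) ⟨
      Σ< n (λ i → c i * (Σ< (n ∸ i) b - s) + s * c i) - t * s
        ≈⟨ +-congʳ (Σ-cong n λ i → eq₁ (c i) (Σ< (n ∸ i) b) s) ⟩
      Σ< n (λ i → c i * Σ< (n ∸ i) b) - t * s
        ≈⟨ +-congʳ (Σ-convolve n b c) ⟨
      Σ< n (convolve b c) - t * s ∎

module Exponential {c ℓ₁ ℓ₂} {R : CompleteOrderedField c ℓ₁ ℓ₂} {k ℓ} (V : ValuedField R k ℓ) where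
  open ValuedField V
  open Limits V
  open Series V
  open FiniteSums commutativeRing
  open IntegerMultiples commutativeRing
  open SemiringExp semiring using (^-congˡ)
  open SemiringMult semiring using (×1-homo-*)
  open SetoidReasoning setoid

  module Terms (1/! : ℕ → Carrier) (1/!-inverse : ∀ n → 1/! n * ((n !) · 1#) ≈ 1#) where
    term : Carrier → ℕ → Carrier
    term w n = w ^ n * 1/! n

    private
      1/[1+_] : ℕ → Carrier
      1/[1+ n ] = 1/! (suc n) * ((n !) · 1#)

      1/[1+n]-inverse : ∀ n → 1/[1+ n ] * (suc n · 1#) ≈ 1#
      1/[1+n]-inverse n = begin
        1/[1+ n ] * (suc n · 1#)                       ≈⟨ eq _ _ _ ⟩
        1/! (suc n) * ((suc n · 1#) * ((n !) · 1#))    ≈⟨ *-congˡ (×1-homo-* (suc n) (n !)) ⟨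
        1/! (suc n) * ((suc n !) · 1#)                 ≈⟨ 1/!-inverse (suc n) ⟩
        1#                                             ∎
        where
        eq : ∀ x y z → x * y * z ≈ x * (z * y)
        eq = solve 3 (λ x y z → x :* y :* z := x :* (z :* y)) refl

      1/[1+n]-Null : Null 1/[1+_]
      1/[1+n]-Null ε 0<ε =
        let y , 0<y , εy≈1 = ℝ.recip 0<ε
            N , y< = ℝ.archimedean-≥ y
        in N , λ n n≥N → ∣1/n∣ (suc n) 0<ε (1/[1+n]-inverse n)
             (ℝ.<-resp εy≈1 ℝ.refl (ℝ.*-monoʳ-< 0<ε (y< (suc n) (ℕ.m≤n⇒m≤1+n n≥N))))

      term-suc : ∀ w n → term w (suc n) ≈ w * 1/[1+ n ] * term w n
      term-suc w n = begin
        w * w ^ n * 1/! (suc n)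
          ≈⟨ *-identityʳ _ ⟨
        w * w ^ n * 1/! (suc n) * 1#
          ≈⟨ *-congˡ (1/!-inverse n) ⟨
        w * w ^ n * 1/! (suc n) * (1/! n * ((n !) · 1#))
          ≈⟨ eq w (w ^ n) (1/! (suc n)) (1/! n) ((n !) · 1#) ⟩
        w * 1/[1+ n ] * term w n ∎
        where
        eq : ∀ w p x y z → w * p * x * (y * z) ≈ w * (x * z) * (p * y)
        eq = solve 5 (λ w p x y z → w :* p :* x :* (y :* z) := w :* (x :* z) :* (p :* y)) refl

    term-geometric : ∀ w → Geometric (term w)
    term-geometric w = ratio⇒geometric (term-suc w)
      (⟶-*ˡ w (Null⇒⟶0 1/[1+n]-Null)) (∣∣-congˡ (sym (zeroʳ w)) (∣0∣ ℝ.0<1))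

    private
      C-1/! : ∀ n i → i ℕ.≤ n → ((n C i) · 1#) * 1/! n ≈ 1/! i * 1/! (n ∸ i)
      C-1/! n i i≤n = begin
        nCi * 1/! n
          ≈⟨ *-identityʳ _ ⟨
        nCi * 1/! n * 1#
          ≈⟨ *-congˡ (trans (*-cong (1/!-inverse i) (1/!-inverse (n ∸ i))) (*-identityˡ 1#)) ⟨
        nCi * 1/! n * (1/! i * i! * (1/! (n ∸ i) * [n∸i]!))
          ≈⟨ eq nCi (1/! n) (1/! i) i! (1/! (n ∸ i)) [n∸i]! ⟩
        1/! n * (nCi * (i! * [n∸i]!)) * (1/! i * 1/! (n ∸ i))
          ≈⟨ *-congʳ (*-congˡ (*-congˡ (×1-homo-* (i !) ((n ∸ i) !)))) ⟨
        1/! n * (nCi * ((i ! ℕ.* (n ∸ i) !) · 1#)) * (1/! i * 1/! (n ∸ i))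
          ≈⟨ *-congʳ (*-congˡ (×1-homo-* (n C i) (i ! ℕ.* (n ∸ i) !))) ⟨
        1/! n * (((n C i) ℕ.* (i ! ℕ.* (n ∸ i) !)) · 1#) * (1/! i * 1/! (n ∸ i))
          ≡⟨ ≡.cong (λ m → 1/! n * (m · 1#) * (1/! i * 1/! (n ∸ i))) C*!*! ⟩
        1/! n * ((n !) · 1#) * (1/! i * 1/! (n ∸ i))
          ≈⟨ *-congʳ (1/!-inverse n) ⟩
        1# * (1/! i * 1/! (n ∸ i))
          ≈⟨ *-identityˡ _ ⟩
        1/! i * 1/! (n ∸ i) ∎
        where
        nCi = (n C i) · 1#
        i! = (i !) · 1#
        [n∸i]! = ((n ∸ i) !) · 1#

        instance _ = i !* (n ∸ i) !≢0

        C*!*! : (n C i) ℕ.* (i ! ℕ.* (n ∸ i) !) ≡ n !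
        C*!*! = ≡.trans (≡.cong (ℕ._* (i ! ℕ.* (n ∸ i) !)) (nCk≡n!/k![n-k]! i≤n))
          (m/n*n≡m (k![n∸k]!∣n! i≤n))

        eq : ∀ C x y z u v → C * x * (y * z * (u * v)) ≈ x * (C * (z * v)) * (y * u)
        eq = solve 6 (λ C x y z u v →
          C :* x :* (y :* z :* (u :* v)) := x :* (C :* (z :* v)) :* (y :* u)) refl

    term-+ : ∀ w z n → term (w + z) n ≈ convolve (term w) (term z) n
    term-+ w z n = begin
      (w + z) ^ n * 1/! n
        ≈⟨ *-congʳ (Binomial.theorem commutativeSemiring n w z) ⟩
      Σ< (suc n) (λ i → (n C i) · (w ^ i * z ^ (n ∸ i))) * 1/! n
        ≈⟨ *-comm _ _ ⟩
      1/! n * Σ< (suc n) (λ i → (n C i) · (w ^ i * z ^ (n ∸ i)))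
        ≈⟨ Σ-*ˡ (suc n) (1/! n) (λ i → (n C i) · (w ^ i * z ^ (n ∸ i))) ⟨
      Σ< (suc n) (λ i → 1/! n * ((n C i) · (w ^ i * z ^ (n ∸ i))))
        ≈⟨ Σ-cong< (suc n) (λ i i≤n → summand i (ℕ.s≤s⁻¹ i≤n)) ⟩
      convolve (term w) (term z) n ∎
      where
      open SemiringMult semiring using (×-congʳ; ×-assoc-*)

      eq₁ : ∀ x C y → x * (C * y) ≈ C * x * y
      eq₁ = solve 3 (λ x C y → x :* (C :* y) := C :* x :* y) refl

      eq₂ : ∀ x y u v → x * y * (u * v) ≈ u * x * (v * y)
      eq₂ = solve 4 (λ x y u v → x :* y :* (u :* v) := u :* x :* (v :* y)) refl

      summand : ∀ i → i ℕ.≤ n →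
        1/! n * ((n C i) · (w ^ i * z ^ (n ∸ i))) ≈ term w i * term z (n ∸ i)
      summand i i≤n = begin
        1/! n * ((n C i) · (w ^ i * z ^ (n ∸ i)))
          ≈⟨ *-congˡ (trans (×-congʳ (n C i) (sym (*-identityˡ _))) (sym (×-assoc-* (n C i) _ _))) ⟩
        1/! n * (((n C i) · 1#) * (w ^ i * z ^ (n ∸ i)))
          ≈⟨ eq₁ _ _ _ ⟩
        ((n C i) · 1#) * 1/! n * (w ^ i * z ^ (n ∸ i))
          ≈⟨ *-congʳ (C-1/! n i i≤n) ⟩
        1/! i * 1/! (n ∸ i) * (w ^ i * z ^ (n ∸ i))
          ≈⟨ eq₂ _ _ _ _ ⟩
        term w i * term z (n ∸ i) ∎

    module Powers {q q⁻¹ log} (qq⁻¹≈1 : q * q⁻¹ ≈ 1#) (exp-log : term log sumsTo q)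
      (q^ : Carrier → Carrier) (power : ∀ α → term (α * log) sumsTo q^ α) where

      private
        term-cong : ∀ {w z} → w ≈ z → ∀ n → term w n ≈ term z n
        term-cong w≈z n = *-congʳ (^-congˡ n w≈z)

      q^-cong : ∀ {α β} → α ≈ β → q^ α ≈ q^ β
      q^-cong {α} {β} α≈β = ⟶-unique (power α)
        (sumsTo-cong (term-cong (*-congʳ (sym α≈β))) (power β))

      q^-+ : ∀ α β → q^ (α + β) ≈ q^ α * q^ β
      q^-+ α β = ⟶-unique (power (α + β))
        (⟶-congʳ (*-comm (q^ β) (q^ α)) (sumsTo-cong
          (λ n → sym (trans (term-cong (distribʳ log α β) n) (term-+ (α * log) (β * log) n)))
          (mertens {b = term (α * log)} (power α) (term-geometric (β * log)) (power β))))

      q^-1 : q^ 1# ≈ q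
      q^-1 = ⟶-unique (power 1#) (sumsTo-cong (term-cong (sym (*-identityˡ log))) exp-log)

      q^-0 : q^ 0# ≈ 1#
      q^-0 = begin
        q^ 0#                 ≈⟨ *-identityʳ _ ⟨
        q^ 0# * 1#            ≈⟨ *-congˡ qq⁻¹≈1 ⟨
        q^ 0# * (q * q⁻¹)     ≈⟨ *-assoc _ _ _ ⟨
        q^ 0# * q * q⁻¹       ≈⟨ *-congʳ (*-congˡ q^-1) ⟨
        q^ 0# * q^ 1# * q⁻¹   ≈⟨ *-congʳ (q^-+ 0# 1#) ⟨
        q^ (0# + 1#) * q⁻¹    ≈⟨ *-congʳ (trans (q^-cong (+-identityˡ 1#)) q^-1) ⟩
        q * q⁻¹               ≈⟨ qq⁻¹≈1 ⟩
        1#                    ∎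

      q^-· : ∀ n → q^ (n · 1#) ≈ q ^ n
      q^-· zero    = q^-0
      q^-· (suc n) = trans (q^-+ 1# (n · 1#)) (*-cong q^-1 (q^-· n))

module ComplexField {c ℓ₁ ℓ₂} (R : CompleteOrderedField c ℓ₁ ℓ₂) where
  private
    module ℝ where
      open CompleteOrderedField R public
      open IsStrictPartialOrder isStrictPartialOrder public
        using () renaming (irrefl to <-irrefl; trans to <-trans)
      open OrderedFieldProperties R public
      open OrderedFieldArithmetic R public
      open RawSemiringDefs (RawRing.rawSemiring (CommutativeRing.rawRing commutativeRing)) public
        using () renaming (_×_ to _·_)
  open ℝ using (_<_; 0<1)
  open Complex R
  open IntegerMultiples ℝ.commutativeRing
  open SetoidReasoning ℝ.setoid

  private
    *-assoc-re : ∀ a b c d e f →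
      (a ℝ.* c ℝ.- b ℝ.* d) ℝ.* e ℝ.- (a ℝ.* d ℝ.+ b ℝ.* c) ℝ.* f
      ℝ.≈ a ℝ.* (c ℝ.* e ℝ.- d ℝ.* f) ℝ.- b ℝ.* (c ℝ.* f ℝ.+ d ℝ.* e)
    *-assoc-re = solve 6 (λ a b c d e f →
      (a :* c :- b :* d) :* e :- (a :* d :+ b :* c) :* f
      := a :* (c :* e :- d :* f) :- b :* (c :* f :+ d :* e)) ℝ.refl

    *-assoc-im : ∀ a b c d e f →
      (a ℝ.* c ℝ.- b ℝ.* d) ℝ.* f ℝ.+ (a ℝ.* d ℝ.+ b ℝ.* c) ℝ.* e
      ℝ.≈ a ℝ.* (c ℝ.* f ℝ.+ d ℝ.* e) ℝ.+ b ℝ.* (c ℝ.* e ℝ.- d ℝ.* f)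
    *-assoc-im = solve 6 (λ a b c d e f →
      (a :* c :- b :* d) :* f :+ (a :* d :+ b :* c) :* e
      := a :* (c :* f :+ d :* e) :+ b :* (c :* e :- d :* f)) ℝ.refl

    *-comm-re : ∀ a b c d → a ℝ.* c ℝ.- b ℝ.* d ℝ.≈ c ℝ.* a ℝ.- d ℝ.* b
    *-comm-re = solve 4 (λ a b c d → a :* c :- b :* d := c :* a :- d :* b) ℝ.refl

    *-comm-im : ∀ a b c d → a ℝ.* d ℝ.+ b ℝ.* c ℝ.≈ c ℝ.* b ℝ.+ d ℝ.* a
    *-comm-im = solve 4 (λ a b c d → a :* d :+ b :* c := c :* b :+ d :* a) ℝ.refl

    *-identityˡ-re : ∀ a b → ℝ.1# ℝ.* a ℝ.- ℝ.0# ℝ.* b ℝ.≈ a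
    *-identityˡ-re = solve 2 (λ a b → con 1ℤ :* a :- con 0ℤ :* b := a) ℝ.refl

    *-identityˡ-im : ∀ a b → ℝ.1# ℝ.* b ℝ.+ ℝ.0# ℝ.* a ℝ.≈ b
    *-identityˡ-im = solve 2 (λ a b → con 1ℤ :* b :+ con 0ℤ :* a := b) ℝ.refl

    distribˡ-re : ∀ a b c d e f →
      a ℝ.* (c ℝ.+ e) ℝ.- b ℝ.* (d ℝ.+ f) ℝ.≈ (a ℝ.* c ℝ.- b ℝ.* d) ℝ.+ (a ℝ.* e ℝ.- b ℝ.* f)
    distribˡ-re = solve 6 (λ a b c d e f →
      a :* (c :+ e) :- b :* (d :+ f) := (a :* c :- b :* d) :+ (a :* e :- b :* f)) ℝ.refl

    distribˡ-im : ∀ a b c d e f →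
      a ℝ.* (d ℝ.+ f) ℝ.+ b ℝ.* (c ℝ.+ e) ℝ.≈ (a ℝ.* d ℝ.+ b ℝ.* c) ℝ.+ (a ℝ.* f ℝ.+ b ℝ.* e)
    distribˡ-im = solve 6 (λ a b c d e f →
      a :* (d :+ f) :+ b :* (c :+ e) := (a :* d :+ b :* c) :+ (a :* f :+ b :* e)) ℝ.refl

    *-assocℂ : ∀ x y z → (x * y) * z ≈ x * (y * z)
    *-assocℂ x y z = mk≈ (*-assoc-re (re x) (im x) (re y) (im y) (re z) (im z))
                         (*-assoc-im (re x) (im x) (re y) (im y) (re z) (im z))

    *-commℂ : ∀ x y → x * y ≈ y * x
    *-commℂ x y = mk≈ (*-comm-re (re x) (im x) (re y) (im y)) (*-comm-im (re x) (im x) (re y) (im y))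

    ≈-trans : ∀ {x y z} → x ≈ y → y ≈ z → x ≈ z
    ≈-trans (mk≈ p q) (mk≈ r s) = mk≈ (ℝ.trans p r) (ℝ.trans q s)

    *-identityˡℂ : ∀ x → 1ℂ * x ≈ x
    *-identityˡℂ x = mk≈ (*-identityˡ-re (re x) (im x)) (*-identityˡ-im (re x) (im x))

    +-congℂ : ∀ {x y u v} → x ≈ y → u ≈ v → x + u ≈ y + v
    +-congℂ (mk≈ p q) (mk≈ r s) = mk≈ (ℝ.+-cong p r) (ℝ.+-cong q s)

    distribˡℂ : ∀ x y z → x * (y + z) ≈ x * y + x * z
    distribˡℂ x y z = mk≈ (distribˡ-re (re x) (im x) (re y) (im y) (re z) (im z))
                          (distribˡ-im (re x) (im x) (re y) (im y) (re z) (im z))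

  commutativeRing : CommutativeRing c ℓ₁
  commutativeRing = record
    { Carrier = ℂ ; _≈_ = _≈_ ; _+_ = _+_ ; _*_ = _*_ ; -_ = -_ ; 0# = 0ℂ ; 1# = 1ℂ
    ; isCommutativeRing = record
      { isRing = record
        { +-isAbelianGroup = record
          { isGroup = record
            { isMonoid = record
              { isSemigroup = record
                { isMagma = record
                  { isEquivalence = record
                    { refl  = mk≈ ℝ.refl ℝ.refl
                    ; sym   = λ (mk≈ p q) → mk≈ (ℝ.sym p) (ℝ.sym q)
                    ; trans = ≈-trans
                    }
                  ; ∙-cong = +-congℂ
                  }
                ; assoc = λ x y z → mk≈ (ℝ.+-assoc _ _ _) (ℝ.+-assoc _ _ _)
                }
              ; identity = (λ x → mk≈ (ℝ.+-identityˡ _) (ℝ.+-identityˡ _))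
                         , (λ x → mk≈ (ℝ.+-identityʳ _) (ℝ.+-identityʳ _))
              }
            ; inverse = (λ x → mk≈ (ℝ.-‿inverseˡ _) (ℝ.-‿inverseˡ _))
                      , (λ x → mk≈ (ℝ.-‿inverseʳ _) (ℝ.-‿inverseʳ _))
            ; ⁻¹-cong = λ (mk≈ p q) → mk≈ (ℝ.-‿cong p) (ℝ.-‿cong q)
            }
          ; comm = λ x y → mk≈ (ℝ.+-comm _ _) (ℝ.+-comm _ _)
          }
        ; *-cong = λ (mk≈ p q) (mk≈ r s) →
            mk≈ (ℝ.+-cong (ℝ.*-cong p r) (ℝ.-‿cong (ℝ.*-cong q s)))
                (ℝ.+-cong (ℝ.*-cong p s) (ℝ.*-cong q r))
        ; *-assoc = *-assocℂ
        ; *-identity = *-identityˡℂ , λ x → ≈-trans (*-commℂ x 1ℂ) (*-identityˡℂ x)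
        ; distrib = distribˡℂ
                  , λ x y z → ≈-trans (*-commℂ (y + z) x) (≈-trans (distribˡℂ x y z)
                      (+-congℂ (*-commℂ x y) (*-commℂ x z)))
        }
      ; *-comm = *-commℂ
      }
    }

  private
    ∣∣²-cong : ∀ {z w} → z ≈ w → ∣ z ∣² ℝ.≈ ∣ w ∣²
    ∣∣²-cong (mk≈ p q) = ℝ.+-cong (ℝ.*-cong p p) (ℝ.*-cong q q)

    sq-* : ∀ x y → (x ℝ.* x) ℝ.* (y ℝ.* y) ℝ.≈ (x ℝ.* y) ℝ.* (x ℝ.* y)
    sq-* = solve 2 (λ x y → (x :* x) :* (y :* y) := (x :* y) :* (x :* y)) ℝ.refl

    *-mono-<-nonneg : ∀ {a b A B} → ¬ (a < ℝ.0#) → ¬ (b < ℝ.0#) → a < A → b < B → a ℝ.* b < A ℝ.* B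
    *-mono-<-nonneg {a} {b} {A} {B} 0≤a 0≤b a<A b<B = ℝ.0<-⇒< (ℝ.<-resp ℝ.refl (eq a b A B)
      (ℝ.pos+nonneg (ℝ.*-pos (ℝ.<⇒0<- a<A) (ℝ.≤-<-trans 0≤b b<B))
                    (ℝ.nonneg*pos 0≤a (ℝ.<⇒0<- b<B))))
      where
      eq : ∀ a b A B → (A ℝ.- a) ℝ.* B ℝ.+ a ℝ.* (B ℝ.- b) ℝ.≈ A ℝ.* B ℝ.- a ℝ.* b
      eq = solve 4 (λ a b A B → (A :- a) :* B :+ a :* (B :- b) := A :* B :- a :* b) ℝ.refl

    x≤x+y : ∀ x {y} → ¬ (y < ℝ.0#) → ¬ (x ℝ.+ y < x)
    x≤x+y x {y} 0≤y = ℝ.nonneg⇒≤ λ h → 0≤y (ℝ.<-resp (eq x y) ℝ.refl h)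
      where
      eq : ∀ x y → x ℝ.+ y ℝ.- x ℝ.≈ y
      eq = solve 2 (λ x y → x :+ y :- x := y) ℝ.refl

    re²≤∣∣² : ∀ z → ¬ (∣ z ∣² < re z ℝ.* re z)
    re²≤∣∣² z = x≤x+y _ (ℝ.0≤sq (im z))

    im²≤∣∣² : ∀ z → ¬ (∣ z ∣² < im z ℝ.* im z)
    im²≤∣∣² z h = x≤x+y _ (ℝ.0≤sq (re z)) (ℝ.<-resp (ℝ.+-comm _ _) ℝ.refl h)

    re< : ∀ {z ε} → ℝ.0# < ε → ∣ z ∣< ε → re z < ε
    re< {z} 0<ε (mk∣∣< h) = ℝ.sq-cancel-< 0<ε (ℝ.≤-<-trans (re²≤∣∣² z) h)

    im< : ∀ {z ε} → ℝ.0# < ε → ∣ z ∣< ε → im z < ε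
    im< {z} 0<ε (mk∣∣< h) = ℝ.sq-cancel-< 0<ε (ℝ.≤-<-trans (im²≤∣∣² z) h)

    -- Cauchy–Schwarz in the form (re z w̄)² + (im z w̄)² = |z|² |w|².
    ∣+∣ : ∀ {z w ε δ} → ℝ.0# < ε → ℝ.0# < δ → ∣ z ∣< ε → ∣ w ∣< δ → ∣ z + w ∣< ε ℝ.+ δ
    ∣+∣ {z} {w} {ε} {δ} 0<ε 0<δ (mk∣∣< z<ε) (mk∣∣< w<δ) = mk∣∣<
      (ℝ.<-resp (ℝ.sym (eq₂ (re z) (im z) (re w) (im w))) (eq₃ ε δ)
        (ℝ.+-mono-< (ℝ.+-mono-< z<ε w<δ) (ℝ.+-mono-< p<εδ p<εδ)))
      where
      p = re z ℝ.* re w ℝ.+ im z ℝ.* im w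
      s = im z ℝ.* re w ℝ.- re z ℝ.* im w

      eq₁ : ∀ a b c d → (a ℝ.* a ℝ.+ b ℝ.* b) ℝ.* (c ℝ.* c ℝ.+ d ℝ.* d) ℝ.≈
        (a ℝ.* c ℝ.+ b ℝ.* d) ℝ.* (a ℝ.* c ℝ.+ b ℝ.* d)
        ℝ.+ (b ℝ.* c ℝ.- a ℝ.* d) ℝ.* (b ℝ.* c ℝ.- a ℝ.* d)
      eq₁ = solve 4 (λ a b c d → (a :* a :+ b :* b) :* (c :* c :+ d :* d) :=
        (a :* c :+ b :* d) :* (a :* c :+ b :* d)
        :+ (b :* c :- a :* d) :* (b :* c :- a :* d)) ℝ.refl

      eq₂ : ∀ a b c d → (a ℝ.+ c) ℝ.* (a ℝ.+ c) ℝ.+ (b ℝ.+ d) ℝ.* (b ℝ.+ d) ℝ.≈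
        ((a ℝ.* a ℝ.+ b ℝ.* b) ℝ.+ (c ℝ.* c ℝ.+ d ℝ.* d))
        ℝ.+ ((a ℝ.* c ℝ.+ b ℝ.* d) ℝ.+ (a ℝ.* c ℝ.+ b ℝ.* d))
      eq₂ = solve 4 (λ a b c d → (a :+ c) :* (a :+ c) :+ (b :+ d) :* (b :+ d) :=
        ((a :* a :+ b :* b) :+ (c :* c :+ d :* d))
        :+ ((a :* c :+ b :* d) :+ (a :* c :+ b :* d))) ℝ.refl

      eq₃ : ∀ ε δ → (ε ℝ.* ε ℝ.+ δ ℝ.* δ) ℝ.+ (ε ℝ.* δ ℝ.+ ε ℝ.* δ) ℝ.≈ (ε ℝ.+ δ) ℝ.* (ε ℝ.+ δ)
      eq₃ = solve 2 (λ ε δ → (ε :* ε :+ δ :* δ) :+ (ε :* δ :+ ε :* δ) := (ε :+ δ) :* (ε :+ δ)) ℝ.refl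

      p<εδ : p < ε ℝ.* δ
      p<εδ = ℝ.sq-cancel-< (ℝ.*-pos 0<ε 0<δ) (ℝ.≤-<-trans (x≤x+y (p ℝ.* p) (ℝ.0≤sq s))
        (ℝ.<-resp (eq₁ (re z) (im z) (re w) (im w)) (sq-* ε δ)
          (*-mono-<-nonneg (0≤∣∣² z) (0≤∣∣² w) z<ε w<δ)))

    ∣*∣ : ∀ {z w ε δ} → ∣ z ∣< ε → ∣ w ∣< δ → ∣ z * w ∣< ε ℝ.* δ
    ∣*∣ {z} {w} {ε} {δ} (mk∣∣< z<ε) (mk∣∣< w<δ) = mk∣∣<
      (ℝ.<-resp (ℝ.sym (∣∣²-* z w)) (sq-* ε δ) (*-mono-<-nonneg (0≤∣∣² z) (0≤∣∣² w) z<ε w<δ))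

    bounded : ∀ z → ∃[ M ] ℝ.0# < M × ∣ z ∣< M
    bounded z = ℝ.1# ℝ.+ s , ℝ.pos+nonneg 0<1 (0≤∣∣² z)
      , mk∣∣< (ℝ.0<-⇒< (ℝ.<-resp ℝ.refl (eq s)
          (ℝ.pos+nonneg (ℝ.pos+nonneg 0<1 (0≤∣∣² z)) (ℝ.0≤sq s))))
      where
      s = ∣ z ∣²
      eq : ∀ s → (ℝ.1# ℝ.+ s) ℝ.+ s ℝ.* s ℝ.≈ (ℝ.1# ℝ.+ s) ℝ.* (ℝ.1# ℝ.+ s) ℝ.- s
      eq = solve 1 (λ s → (con 1ℤ :+ s) :+ s :* s := (con 1ℤ :+ s) :* (con 1ℤ :+ s) :- s) ℝ.refl

    separated-ℝ : ∀ {x} → (∀ ε → ℝ.0# < ε → x ℝ.* x < ε ℝ.* ε) → x ℝ.≈ ℝ.0#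
    separated-ℝ {x} small = proj₁ (ℝ.tight x ℝ.0#) λ x#0 →
      [ (λ x<0 → ℝ.≤-refl (ℝ.<-resp ℝ.refl (ℝ.neg-sq x)
          (small (ℝ.- x) (ℝ.<-resp ℝ.refl (ℝ.+-identityˡ (ℝ.- x)) (ℝ.<⇒0<- x<0)))))
      , (λ 0<x → ℝ.≤-refl (small x 0<x)) ]′ (ℝ.#⇒<⊎> x#0)

    separated : ∀ {z} → (∀ ε → ℝ.0# < ε → ∣ z ∣< ε) → z ≈ 0ℂ
    separated {z} small = mk≈
      (separated-ℝ λ ε 0<ε → ℝ.≤-<-trans (re²≤∣∣² z) (∣∣²<ε² (small ε 0<ε)))
      (separated-ℝ λ ε 0<ε → ℝ.≤-<-trans (im²≤∣∣² z) (∣∣²<ε² (small ε 0<ε)))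

    -- For s = |z|² < ε² the number δ = (ε² + s) / 2ε lies strictly between
    -- |z| and ε, by the inequality of arithmetic and geometric means.
    shrink : ∀ {z ε} → ℝ.0# < ε → ∣ z ∣< ε → ∃[ δ ] ℝ.0# < δ × δ < ε × ∣ z ∣< δ
    shrink {z} {ε} 0<ε (mk∣∣< z<ε) =
      let 0<2ε = ℝ.+-pos 0<ε 0<ε
          δ , 0<δ , 2εδ≈ = ℝ.divide (ε ℝ.* ε ℝ.+ s) 0<2ε
            (ℝ.pos+nonneg (ℝ.*-pos 0<ε 0<ε) (0≤∣∣² z))
      in δ , 0<δ
         , ℝ.*-cancelˡ-< 0<2ε (ℝ.<-resp (ℝ.sym 2εδ≈) (eq₁ ε) (ℝ.+-monoʳ-< (ε ℝ.* ε) z<ε))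
         , mk∣∣< (ℝ.*-cancelˡ-< (ℝ.*-pos 0<2ε 0<2ε) (ℝ.0<-⇒< (ℝ.<-resp ℝ.refl
             (ℝ.trans (eq₂ ε s) (ℝ.+-congʳ
               (ℝ.trans (ℝ.*-cong (ℝ.sym 2εδ≈) (ℝ.sym 2εδ≈)) (ℝ.sym (sq-* (ε ℝ.+ ε) δ)))))
             (ℝ.*-pos (ℝ.<⇒0<- z<ε) (ℝ.<⇒0<- z<ε)))))
      where
      s = ∣ z ∣²
      eq₁ : ∀ ε → ε ℝ.* ε ℝ.+ ε ℝ.* ε ℝ.≈ (ε ℝ.+ ε) ℝ.* ε
      eq₁ = solve 1 (λ ε → ε :* ε :+ ε :* ε := (ε :+ ε) :* ε) ℝ.refl

      eq₂ : ∀ ε s → (ε ℝ.* ε ℝ.- s) ℝ.* (ε ℝ.* ε ℝ.- s) ℝ.≈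
        (ε ℝ.* ε ℝ.+ s) ℝ.* (ε ℝ.* ε ℝ.+ s) ℝ.- (ε ℝ.+ ε) ℝ.* (ε ℝ.+ ε) ℝ.* s
      eq₂ = solve 2 (λ ε s → (ε :* ε :- s) :* (ε :* ε :- s) :=
        (ε :* ε :+ s) :* (ε :* ε :+ s) :- (ε :+ ε) :* (ε :+ ε) :* s) ℝ.refl

    between-sq : ∀ {x h} → x < h → ℝ.- x < h → x ℝ.* x < h ℝ.* h
    between-sq {x} {h} x<h -x<h = ℝ.0<-⇒< (ℝ.<-resp ℝ.refl (eq x h)
      (ℝ.*-pos (ℝ.<⇒0<- x<h) (ℝ.<⇒0<- -x<h)))
      where
      eq : ∀ x h → (h ℝ.- x) ℝ.* (h ℝ.- ℝ.- x) ℝ.≈ h ℝ.* h ℝ.- x ℝ.* x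
      eq = solve 2 (λ x h → (h :- x) :* (h :- :- x) := h :* h :- x :* x) ℝ.refl

    complete : ∀ u →
      (∀ ε → ℝ.0# < ε → ∃[ N ] (∀ m n → m ≥ N → n ≥ N → ∣ u m - u n ∣< ε)) → ∃[ l ] u ⟶ l
    complete u cauchy =
      let a , re→a = ℝ.complete (re ∘ u) λ ε 0<ε → let N , u< = cauchy ε 0<ε in
            N , λ m n m≥N n≥N → re< 0<ε (u< m n m≥N n≥N)
          b , im→b = ℝ.complete (im ∘ u) λ ε 0<ε → let N , u< = cauchy ε 0<ε in
            N , λ m n m≥N n≥N → im< 0<ε (u< m n m≥N n≥N)
      in a +i b , λ ε 0<ε →
           let h , 0<h , h+h≈ε = ℝ.halve 0<ε
               M , re< = re→a h 0<h
               N , im< = im→b h 0<h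
           in M ℕ.+ N , λ n n≥ →
                let r<h , -r<h = re< n (ℕ.≤-trans (ℕ.m≤m+n M N) n≥)
                    i<h , -i<h = im< n (ℕ.≤-trans (ℕ.m≤n+m N M) n≥)
                    hh+hh = ℝ.+-mono-< (between-sq r<h (ℝ.<-resp (swap (re (u n)) a) ℝ.refl -r<h))
                                       (between-sq i<h (ℝ.<-resp (swap (im (u n)) b) ℝ.refl -i<h))
                    0<hh = ℝ.*-pos 0<h 0<h
                in mk∣∣< (ℝ.<-resp ℝ.refl (ℝ.trans (eq h) (ℝ.*-cong h+h≈ε h+h≈ε))
                     (ℝ.<-trans hh+hh (ℝ.x<x+y (ℝ.+-pos 0<hh 0<hh))))
      where
      swap : ∀ x a → a ℝ.- x ℝ.≈ ℝ.- (x ℝ.- a)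
      swap = solve 2 (λ x a → a :- x := :- (x :- a)) ℝ.refl

      eq : ∀ h → (h ℝ.* h ℝ.+ h ℝ.* h) ℝ.+ (h ℝ.* h ℝ.+ h ℝ.* h) ℝ.≈ (h ℝ.+ h) ℝ.* (h ℝ.+ h)
      eq = solve 1 (λ h → (h :* h :+ h :* h) :+ (h :* h :+ h :* h) := (h :+ h) :* (h :+ h)) ℝ.refl

    ∣1ℂ∣² : ∣ 1ℂ ∣² ℝ.≈ ℝ.1#
    ∣1ℂ∣² = ℝ.trans (ℝ.+-cong (ℝ.*-identityˡ ℝ.1#) (ℝ.zeroˡ ℝ.0#)) (ℝ.+-identityʳ ℝ.1#)

    ∣∣²-inverse : ∀ z w → z * w ≈ 1ℂ → ∣ z ∣² ℝ.* ∣ w ∣² ℝ.≈ ℝ.1#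
    ∣∣²-inverse z w zw≈1 = ℝ.trans (ℝ.sym (∣∣²-* z w)) (ℝ.trans (∣∣²-cong zw≈1) ∣1ℂ∣²)

    ∣1/1-z∣ : ∀ {z w δ} → ℝ.0# < δ → δ ℝ.+ δ ℝ.≈ ℝ.1# → ∣ z ∣< δ → w * (1ℂ - z) ≈ 1ℂ →
              ∣ w ∣< ℝ.1# ℝ.+ ℝ.1#
    ∣1/1-z∣ {z} {w} {δ} 0<δ 2δ≈1 z<δ w[1-z]≈1 = mk∣∣< (ℝ.*-cancelˡ-< (ℝ.<-trans 0<δδ δδ<∣1-z∣²)
      (ℝ.<-resp 4δδ≈ ℝ.refl (ℝ.*-monoˡ-< (ℝ.*-pos 0<2 0<2) δδ<∣1-z∣²)))
      where
      0<2 = ℝ.+-pos 0<1 0<1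
      0<δδ = ℝ.*-pos 0<δ 0<δ

      1-re : ∀ δ x → δ ℝ.+ δ ℝ.- x ℝ.- δ ℝ.≈ δ ℝ.- x
      1-re = solve 2 (λ δ x → δ :+ δ :- x :- δ := δ :- x) ℝ.refl

      δ<re : δ < re (1ℂ - z)
      δ<re = ℝ.0<-⇒< (ℝ.<-resp ℝ.refl
        (ℝ.trans (ℝ.sym (1-re δ (re z))) (ℝ.+-congʳ (ℝ.+-congʳ 2δ≈1)))
        (ℝ.<⇒0<- (re< 0<δ z<δ)))

      δδ<∣1-z∣² : δ ℝ.* δ < ∣ 1ℂ - z ∣²
      δδ<∣1-z∣² = ℝ.<-≤-trans (ℝ.sq-mono-< 0<δ δ<re) (re²≤∣∣² (1ℂ - z))

      eq : ∀ δ → δ ℝ.* δ ℝ.* ((ℝ.1# ℝ.+ ℝ.1#) ℝ.* (ℝ.1# ℝ.+ ℝ.1#)) ℝ.≈ (δ ℝ.+ δ) ℝ.* (δ ℝ.+ δ)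
      eq = solve 1 (λ δ → δ :* δ :* ((con 1ℤ :+ con 1ℤ) :* (con 1ℤ :+ con 1ℤ)) := (δ :+ δ) :* (δ :+ δ)) ℝ.refl

      4δδ≈ : δ ℝ.* δ ℝ.* ((ℝ.1# ℝ.+ ℝ.1#) ℝ.* (ℝ.1# ℝ.+ ℝ.1#)) ℝ.≈ ∣ 1ℂ - z ∣² ℝ.* ∣ w ∣²
      4δδ≈ = ℝ.trans (eq δ) (ℝ.trans (ℝ.*-cong 2δ≈1 2δ≈1) (ℝ.trans (ℝ.*-identityˡ ℝ.1#)
        (ℝ.sym (ℝ.trans (ℝ.*-comm _ _) (∣∣²-inverse w (1ℂ - z) w[1-z]≈1)))))

    re-·1 : ∀ n → re (n ×ℂ 1ℂ) ℝ.≈ n ℝ.· ℝ.1#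
    re-·1 zero    = ℝ.refl
    re-·1 (suc n) = ℝ.+-congˡ (re-·1 n)

    im-·1 : ∀ n → im (n ×ℂ 1ℂ) ℝ.≈ ℝ.0#
    im-·1 zero    = ℝ.refl
    im-·1 (suc n) = ℝ.trans (ℝ.+-identityˡ _) (im-·1 n)

    ∣1/n∣ : ∀ {w ε} n → ℝ.0# < ε → w * (n ×ℂ 1ℂ) ≈ 1ℂ → ℝ.1# < ε ℝ.* (n ℝ.· ℝ.1#) → ∣ w ∣< ε
    ∣1/n∣ {w} {ε} n 0<ε wn≈1 1<εn = mk∣∣< (ℝ.*-cancelˡ-< (ℝ.*-pos 0<n 0<n)
      (ℝ.<-resp 1≈ (ℝ.trans (ℝ.sym (sq-* ε _)) (ℝ.*-comm _ _)) (ℝ.sq-mono-< 0<1 1<εn)))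
      where
      0<n : ℝ.0# < n ℝ.· ℝ.1#
      0<n = ℝ.*-cancelˡ-< 0<ε (ℝ.<-resp (ℝ.sym (ℝ.zeroʳ ε)) ℝ.refl (ℝ.<-trans 0<1 1<εn))

      ∣n∣² : ∣ n ×ℂ 1ℂ ∣² ℝ.≈ (n ℝ.· ℝ.1#) ℝ.* (n ℝ.· ℝ.1#)
      ∣n∣² = ℝ.trans (ℝ.+-cong (ℝ.*-cong (re-·1 n) (re-·1 n))
        (ℝ.trans (ℝ.*-cong (im-·1 n) (im-·1 n)) (ℝ.zeroˡ ℝ.0#))) (ℝ.+-identityʳ _)

      1≈ : ℝ.1# ℝ.* ℝ.1# ℝ.≈ (n ℝ.· ℝ.1#) ℝ.* (n ℝ.· ℝ.1#) ℝ.* ∣ w ∣²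
      1≈ = ℝ.trans (ℝ.*-identityˡ ℝ.1#) (ℝ.trans (ℝ.sym (∣∣²-inverse w (n ×ℂ 1ℂ) wn≈1))
        (ℝ.trans (ℝ.*-comm _ _) (ℝ.*-congʳ ∣n∣²)))

  valuedField : ValuedField R c ℓ₁
  valuedField = record
    { commutativeRing = commutativeRing
    ; ∣_∣<_     = ∣_∣<_
    ; ∣∣-resp   = λ z≈w ε≈δ (mk∣∣< h) → mk∣∣< (ℝ.<-resp (∣∣²-cong z≈w) (ℝ.*-cong ε≈δ ε≈δ) h)
    ; ∣∣-<      = λ 0<ε ε<δ (mk∣∣< h) → mk∣∣< (ℝ.<-trans h (ℝ.sq-mono-< 0<ε ε<δ))
    ; ∣0∣       = λ 0<ε → mk∣∣< (ℝ.<-resp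
        (ℝ.sym (ℝ.trans (ℝ.+-cong (ℝ.zeroˡ ℝ.0#) (ℝ.zeroˡ ℝ.0#)) (ℝ.+-identityʳ ℝ.0#)))
        ℝ.refl (ℝ.*-pos 0<ε 0<ε))
    ; ∣-∣       = λ (mk∣∣< h) → mk∣∣<
        (ℝ.<-resp (ℝ.sym (ℝ.+-cong (ℝ.neg-sq _) (ℝ.neg-sq _))) ℝ.refl h)
    ; ∣+∣       = ∣+∣
    ; ∣*∣       = λ _ _ → ∣*∣
    ; bounded   = bounded
    ; separated = separated
    ; shrink    = shrink
    ; ∣1/1-z∣   = ∣1/1-z∣
    ; ∣1/n∣     = ∣1/n∣
    ; complete  = complete
    }

  inverse⇒NonZero : ∀ {z w} → z * w ≈ 1ℂ → NonZero z
  inverse⇒NonZero {z} {w} zw≈1 = mkNonZero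
    ([ (λ ∣z∣²<0 → ⊥-elim (0≤∣∣² z ∣z∣²<0)) , (λ 0<∣z∣² → 0<∣z∣²) ]′
      (ℝ.*-pos⇒#0 (ℝ.<-resp ℝ.refl (ℝ.sym (∣∣²-inverse z w zw≈1)) 0<1)))

  *-inverse : ∀ z (nz : NonZero z) → z * z ⁻¹[ nz ] ≈ 1ℂ
  *-inverse z nz = mk≈ (ℝ.trans (eq₁ (re z) (im z) r) r*∣z∣²≈1) (eq₂ (re z) (im z) r)
    where
    inverse = ℝ.#⇒invertible (ℝ.#-sym (ℝ.<⇒# (0<∣∣² nz)))
    r = proj₁ inverse
    r*∣z∣²≈1 = proj₁ (proj₂ inverse)

    eq₁ : ∀ a b r → a ℝ.* (a ℝ.* r) ℝ.- b ℝ.* (ℝ.- b ℝ.* r)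
                    ℝ.≈ r ℝ.* ((a ℝ.* a ℝ.+ b ℝ.* b) ℝ.- ℝ.0#)
    eq₁ = solve 3 (λ a b r → a :* (a :* r) :- b :* (:- b :* r)
                             := r :* ((a :* a :+ b :* b) :- con 0ℤ)) ℝ.refl

    eq₂ : ∀ a b r → a ℝ.* (ℝ.- b ℝ.* r) ℝ.+ b ℝ.* (a ℝ.* r) ℝ.≈ ℝ.0#
    eq₂ = solve 3 (λ a b r → a :* (:- b :* r) :+ b :* (a :* r) := con 0ℤ) ℝ.refl

module QPochhammer {c ℓ₁ ℓ₂} {R : CompleteOrderedField c ℓ₁ ℓ₂} {k ℓ} (V : ValuedField R k ℓ) where
  open Limits V
  open ℝ using (_<_; 0<1)
  open ValuedField V
  open FiniteSums commutativeRing
  open IntegerMultiples commutativeRing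
  open Series V
  open SemiringExp semiring using (^-homo-*)
  open SetoidReasoning setoid

  pochhammer : Carrier → Carrier → ℕ → Carrier
  pochhammer a b n = product {n} λ i → 1# - a * b ^ toℕ i

  pochhammer-suc : ∀ a b n → pochhammer a b (suc n) ≈ pochhammer a b n * (1# - a * b ^ n)
  pochhammer-suc a b n = Π-snoc n λ i → 1# - a * b ^ i

  *^-Null : ∀ a {b} → ∣ b ∣< ℝ.1# → Null (λ n → a * b ^ n)
  *^-Null a b<1 = Null-cong (λ n → *-comm _ a) (Null-*-Bounded (^-Null b<1) (Bounded-const a))

  1-*^⟶1 : ∀ a {b} → ∣ b ∣< ℝ.1# → (λ n → 1# - a * b ^ n) ⟶ 1#
  1-*^⟶1 a {b} b<1 = Null-cong (λ n → eq (a * b ^ n)) (Null-neg (*^-Null a b<1))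
    where
    eq : ∀ x → - x ≈ (1# - x) - 1#
    eq = solve 1 (λ x → :- x := (con 1ℤ :- x) :- con 1ℤ) refl

  opaque
    -- The increments of the partial products have ratio tending to b.
    pochhammer-converges : ∀ a {b} → ∣ b ∣< ℝ.1# → ∃[ P ] pochhammer a b ⟶ P
    pochhammer-converges a {b} b<1 =
      let s , increments→s = summable (ratio⇒geometric {increment}
            {λ n → b * (1# - a * b ^ n)} ratio
            (⟶-congʳ (*-identityʳ b) (⟶-*ˡ b (1-*^⟶1 a b<1))) b<1)
      in 1# + s , ⟶-cong telescope (⟶-+ (⟶-const 1#) increments→s)
      where
      increment : ℕ → Carrier
      increment n = - (a * b ^ n * pochhammer a b n)

      eq₁ : ∀ a b p u → - (a * (b * p) * (u * (1# - a * p))) ≈ b * (1# - a * p) * - (a * p * u)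
      eq₁ = solve 4 (λ a b p u → :- (a :* (b :* p) :* (u :* (con 1ℤ :- a :* p)))
        := b :* (con 1ℤ :- a :* p) :* (:- (a :* p :* u))) refl

      ratio : ∀ n → increment (suc n) ≈ b * (1# - a * b ^ n) * increment n
      ratio n = trans (-‿cong (*-congˡ (pochhammer-suc a b n))) (eq₁ a b (b ^ n) _)

      eq₂ : ∀ x u → u + - (x * u) ≈ u * (1# - x)
      eq₂ = solve 2 (λ x u → u :+ :- (x :* u) := u :* (con 1ℤ :- x)) refl

      telescope : ∀ n → 1# + Σ< n increment ≈ pochhammer a b n
      telescope zero    = +-identityʳ 1#
      telescope (suc n) = begin
        1# + Σ< (suc n) increment              ≈⟨ +-congˡ (Σ-snoc n increment) ⟩
        1# + (Σ< n increment + increment n)    ≈⟨ +-assoc _ _ _ ⟨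
        (1# + Σ< n increment) + increment n    ≈⟨ +-congʳ (telescope n) ⟩
        pochhammer a b n + increment n         ≈⟨ eq₂ (a * b ^ n) _ ⟩
        pochhammer a b n * (1# - a * b ^ n)    ≈⟨ pochhammer-suc a b n ⟨
        pochhammer a b (suc n)                 ∎

  pochhammer-0 : ∀ {a b} → a ≈ 0# → ∀ n → pochhammer a b n ≈ 1#
  pochhammer-0         a≈0 zero    = refl
  pochhammer-0 {a} {b} a≈0 (suc n) = begin
    pochhammer a b (suc n)                ≈⟨ pochhammer-suc a b n ⟩
    pochhammer a b n * (1# - a * b ^ n)   ≈⟨ *-cong (pochhammer-0 a≈0 n)
                                               (+-congˡ (-‿cong (*-congʳ a≈0))) ⟩
    1# * (1# - 0# * b ^ n)                ≈⟨ eq (b ^ n) ⟩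
    1#                                    ∎
    where
    eq : ∀ p → 1# * (1# - 0# * p) ≈ 1#
    eq = solve 1 (λ p → con 1ℤ :* (con 1ℤ :- con 0ℤ :* p) := con 1ℤ) refl

  ∣*^∣ : ∀ {z w ε} → ℝ.0# < ε → ∣ z ∣< ε → ∣ w ∣< ℝ.1# → ∀ n → ∣ z * w ^ n ∣< ε
  ∣*^∣ 0<ε z<ε w<1 zero    = ∣∣-congˡ (sym (*-identityʳ _)) z<ε
  ∣*^∣ {z} {w} {ε} 0<ε z<ε w<1 (suc n) = ∣∣-resp (eq w z (w ^ n)) (ℝ.*-identityˡ ε)
    (∣*∣ 0<1 0<ε w<1 (∣*^∣ 0<ε z<ε w<1 n))
    where
    eq : ∀ w z p → w * (z * p) ≈ z * (w * p)
    eq = solve 3 (λ w z p → w :* (z :* p) := z :* (w :* p)) refl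

  module Reciprocal (a : Carrier) {b} (b<1 : ∣ b ∣< ℝ.1#) (1/[a⨾b] : ℕ → Carrier)
    (inverse : ∀ n → pochhammer a b n * 1/[a⨾b] n ≈ 1#) where

    factor : ℕ → Carrier
    factor n = 1/[a⨾b] (suc n) * pochhammer a b n

    factor-inverse : ∀ n → factor n * (1# - a * b ^ n) ≈ 1#
    factor-inverse n = begin
      1/[a⨾b] (suc n) * pochhammer a b n * (1# - a * b ^ n)    ≈⟨ *-assoc _ _ _ ⟩
      1/[a⨾b] (suc n) * (pochhammer a b n * (1# - a * b ^ n))  ≈⟨ *-congˡ (pochhammer-suc a b n) ⟨
      1/[a⨾b] (suc n) * pochhammer a b (suc n)                 ≈⟨ *-comm _ _ ⟩
      pochhammer a b (suc n) * 1/[a⨾b] (suc n)                 ≈⟨ inverse (suc n) ⟩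
      1#                                                       ∎

    factor⟶1 : factor ⟶ 1#
    factor⟶1 = 1/1-Null (*^-Null a b<1) factor-inverse

    reciprocal-suc : ∀ n → 1/[a⨾b] (suc n) ≈ factor n * 1/[a⨾b] n
    reciprocal-suc n = begin
      1/[a⨾b] (suc n)                                    ≈⟨ *-identityʳ _ ⟨
      1/[a⨾b] (suc n) * 1#                               ≈⟨ *-congˡ (inverse n) ⟨
      1/[a⨾b] (suc n) * (pochhammer a b n * 1/[a⨾b] n)   ≈⟨ *-assoc _ _ _ ⟨
      factor n * 1/[a⨾b] n                               ∎

  sumsTo-+ : ∀ {u v s r} → u sumsTo s → v sumsTo r → (λ n → u n + v n) sumsTo (s + r)
  sumsTo-+ {u} {v} u→s v→r = ⟶-cong (λ n → sym (Σ-+ n u v)) (⟶-+ u→s v→r)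

  sumsTo-*ˡ : ∀ a {u s} → u sumsTo s → (λ n → a * u n) sumsTo (a * s)
  sumsTo-*ˡ a {u} u→s = ⟶-cong (λ n → sym (Σ-*ˡ n a u)) (⟶-*ˡ a u→s)

  ∣limit∣ : ∀ {u l M} → ℝ.0# < M → (∀ n → ∣ u n ∣< M) → u ⟶ l → ∣ l ∣< M ℝ.+ ℝ.1#
  ∣limit∣ {u} {l} 0<M u< u→l = let N , u-l< = u→l ℝ.1# 0<1 in
    ∣∣-congˡ (eq (u N) l) (∣+∣ 0<M 0<1 (u< N) (∣-∣ (u-l< N ℕ.≤-refl)))
    where
    eq : ∀ x l → x - (x - l) ≈ l
    eq = solve 2 (λ x l → x :- (x :- l) := l) refl

  module QBinomial {q} (q<1 : ∣ q ∣< ℝ.1#) (1/[q⨾q] : ℕ → Carrier)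
    (inverse : ∀ n → pochhammer q q n * 1/[q⨾q] n ≈ 1#) (x y t : Carrier) where

    open Reciprocal q q<1 1/[q⨾q] inverse

    cauchy : ℕ → Carrier
    cauchy n = product {n} λ i → x - q ^ toℕ i * y

    coefficient : ℕ → Carrier
    coefficient n = cauchy n * (t ^ n * 1/[q⨾q] n)

    coefficient-suc : ∀ n →
      coefficient (suc n) ≈ t * (x - q ^ n * y) * factor n * coefficient n
    coefficient-suc n = begin
      cauchy (suc n) * (t * t ^ n * 1/[q⨾q] (suc n))
        ≈⟨ *-cong (Π-snoc n λ i → x - q ^ i * y) (*-congˡ (reciprocal-suc n)) ⟩
      cauchy n * (x - q ^ n * y) * (t * t ^ n * (factor n * 1/[q⨾q] n))
        ≈⟨ eq (cauchy n) (x - q ^ n * y) t (t ^ n) (factor n) (1/[q⨾q] n) ⟩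
      t * (x - q ^ n * y) * factor n * coefficient n ∎
      where
      eq : ∀ p v t s f r → p * v * (t * s * (f * r)) ≈ t * v * f * (p * (s * r))
      eq = solve 6 (λ p v t s f r →
        p :* v :* (t :* s :* (f :* r)) := t :* v :* f :* (p :* (s :* r))) refl

    coefficient-0 : coefficient 0 ≈ 1#
    coefficient-0 = begin
      1# * (1# * 1/[q⨾q] 0)   ≈⟨ *-identityˡ _ ⟩
      1# * 1/[q⨾q] 0          ≈⟨ inverse 0 ⟩
      1#                      ∎

    module _ (xt<1 : ∣ x * t ∣< ℝ.1#) where

      coefficient-geometric : Geometric coefficient
      coefficient-geometric = ratio⇒geometric coefficient-suc
        (⟶-congʳ (eq₁ x t) (⟶-* (⟶-*ˡ t x-q^ny⟶x) factor⟶1)) xt<1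
        where
        eq₁ : ∀ x t → t * x * 1# ≈ x * t
        eq₁ = solve 2 (λ x t → t :* x :* con 1ℤ := x :* t) refl

        eq₂ : ∀ x y p → - (y * p) ≈ (x - p * y) - x
        eq₂ = solve 3 (λ x y p → :- (y :* p) := (x :- p :* y) :- x) refl

        x-q^ny⟶x : (λ n → x - q ^ n * y) ⟶ x
        x-q^ny⟶x = Null-cong (λ n → eq₂ x y (q ^ n)) (Null-neg (*^-Null y q<1))

      private
        g : ℕ → ℕ → Carrier
        g n m = coefficient m * q ^ (n ℕ.* m)

        tail-term : ℕ → ℕ → Carrier
        tail-term n m = coefficient (suc m) * q ^ (n ℕ.* m)

        K = proj₁ coefficient-geometric
        ρ = proj₁ (proj₂ coefficient-geometric)
        0<K = proj₁ (proj₂ (proj₂ coefficient-geometric))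
        0<ρ = proj₁ (proj₂ (proj₂ (proj₂ coefficient-geometric)))
        ρ<1 = proj₁ (proj₂ (proj₂ (proj₂ (proj₂ coefficient-geometric))))
        coefficient< = proj₂ (proj₂ (proj₂ (proj₂ (proj₂ coefficient-geometric))))

        0<Kρ : ℝ.0# < K ℝ.* ρ
        0<Kρ = ℝ.*-pos 0<K 0<ρ

        tail-dominated : ∀ n → Dominated (K ℝ.* ρ) ρ (tail-term n)
        tail-dominated n m = ∣*^∣ (ℝ.*-pos 0<Kρ (ℝ.^-pos 0<ρ m))
          (∣∣-congʳ (ℝ.sym (ℝ.*-assoc K ρ _)) (coefficient< (suc m))) q<1 (n ℕ.* m)

        T-sum : ∀ n → ∃[ T ] tail-term n sumsTo T
        T-sum n = summable (K ℝ.* ρ , ρ , 0<Kρ , 0<ρ , ρ<1 , tail-dominated n)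

        T : ℕ → Carrier
        T n = proj₁ (T-sum n)

        T-bounded : Bounded T
        T-bounded = K ℝ.* ρ ℝ.* G ℝ.+ ℝ.1# , ℝ.+-pos 0<KρG 0<1
          , λ n → ∣limit∣ 0<KρG (λ N → Σ-dominated N 0<Kρ λ m _ → tail-dominated n m) (proj₂ (T-sum n))
          where
          open GeometricSeries 0<ρ ρ<1
          0<KρG = ℝ.*-pos 0<Kρ 0<G

        -- F n is F(qⁿt), and q ^ n * T n the part of the series after its first term.
        F : ℕ → Carrier
        F n = 1# + q ^ n * T n

        q^[n*suc-m] : ∀ n m → q ^ (n ℕ.* suc m) ≈ q ^ n * q ^ (n ℕ.* m)
        q^[n*suc-m] n m = trans (reflexive (≡.cong (q ^_) (ℕ.*-suc n m))) (^-homo-* q n (n ℕ.* m))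

        g-sums : ∀ n → g n sumsTo F n
        g-sums n = ⟶-unsuc (⟶-+ (⟶-congʳ g-0 (⟶-const (g n 0)))
          (sumsTo-cong g-suc (sumsTo-*ˡ (q ^ n) {tail-term n} (proj₂ (T-sum n)))))
          where
          g-0 : g n 0 ≈ 1#
          g-0 = trans (*-cong coefficient-0 (reflexive (≡.cong (q ^_) (ℕ.*-zeroʳ n))))
                      (*-identityˡ 1#)

          eq : ∀ p c r → p * (c * r) ≈ c * (p * r)
          eq = solve 3 (λ p c r → p :* (c :* r) := c :* (p :* r)) refl

          g-suc : ∀ m → q ^ n * tail-term n m ≈ g n (suc m)
          g-suc m = trans (eq (q ^ n) _ _) (*-congˡ (sym (q^[n*suc-m] n m)))

        F⟶1 : F ⟶ 1#
        F⟶1 = ⟶-congʳ (+-identityʳ 1#)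
          (⟶-+ (⟶-const 1#) (Null⇒⟶0 (Null-*-Bounded (^-Null q<1) T-bounded)))

        g-difference : ∀ n m → g n (suc m) + - 1# * g (suc n) (suc m)
          ≈ q ^ n * t * x * g n m + - (q ^ n * t * y) * g (suc n) m
        g-difference n m = begin
          c₊ * q ^ (n ℕ.* suc m) + - 1# * (c₊ * q ^ (suc m ℕ.+ n ℕ.* suc m))
            ≈⟨ +-congˡ (*-congˡ (*-congˡ (^-homo-* q (suc m) (n ℕ.* suc m)))) ⟩
          c₊ * q ^ (n ℕ.* suc m) + - 1# * (c₊ * (q * q ^ m * q ^ (n ℕ.* suc m)))
            ≈⟨ eq₁ c₊ (q ^ (n ℕ.* suc m)) (q * q ^ m) ⟩
          c₊ * (1# - q * q ^ m) * q ^ (n ℕ.* suc m)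
            ≈⟨ *-cong (*-congʳ (coefficient-suc m)) (q^[n*suc-m] n m) ⟩
          t * (x - q ^ m * y) * factor m * c₀ * (1# - q * q ^ m) * (q ^ n * q ^ (n ℕ.* m))
            ≈⟨ eq₂ t (x - q ^ m * y) (factor m) c₀ (1# - q * q ^ m) (q ^ n) (q ^ (n ℕ.* m)) ⟩
          factor m * (1# - q * q ^ m) * (q ^ n * t * (x - q ^ m * y) * (c₀ * q ^ (n ℕ.* m)))
            ≈⟨ *-congʳ (factor-inverse m) ⟩
          1# * (q ^ n * t * (x - q ^ m * y) * (c₀ * q ^ (n ℕ.* m)))
            ≈⟨ eq₃ (q ^ n) t x y (q ^ m) c₀ (q ^ (n ℕ.* m)) ⟩
          q ^ n * t * x * g n m + - (q ^ n * t * y) * (c₀ * (q ^ m * q ^ (n ℕ.* m)))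
            ≈⟨ +-congˡ (*-congˡ (*-congˡ (^-homo-* q m (n ℕ.* m)))) ⟨
          q ^ n * t * x * g n m + - (q ^ n * t * y) * g (suc n) m ∎
          where
          c₀ = coefficient m
          c₊ = coefficient (suc m)

          eq₁ : ∀ c p r → c * p + - 1# * (c * (r * p)) ≈ c * (1# - r) * p
          eq₁ = solve 3 (λ c p r →
            c :* p :+ :- con 1ℤ :* (c :* (r :* p)) := c :* (con 1ℤ :- r) :* p) refl

          eq₂ : ∀ t v f c w p r → t * v * f * c * w * (p * r) ≈ f * w * (p * t * v * (c * r))
          eq₂ = solve 7 (λ t v f c w p r →
            t :* v :* f :* c :* w :* (p :* r) := f :* w :* (p :* t :* v :* (c :* r))) refl

          eq₃ : ∀ p t x y m c r → 1# * (p * t * (x - m * y) * (c * r))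
                ≈ p * t * x * (c * r) + - (p * t * y) * (c * (m * r))
          eq₃ = solve 7 (λ p t x y m c r → con 1ℤ :* (p :* t :* (x :- m :* y) :* (c :* r))
            := p :* t :* x :* (c :* r) :+ (:- (p :* t :* y)) :* (c :* (m :* r))) refl

        F-step : ∀ n → (1# - x * t * q ^ n) * F n ≈ (1# - y * t * q ^ n) * F (suc n)
        F-step n = begin
          (1# - x * t * q ^ n) * F n
            ≈⟨ eq₁ (F n) (F (suc n)) (g n 0) (q ^ n) x t ⟩
          ((F n - g n 0) + - 1# * (F (suc n) - g (suc n) 0) + F (suc n)) - q ^ n * t * x * F n
            ≈⟨ +-congʳ (+-congʳ (⟶-unique
                 (sumsTo-+ {g n ∘ suc} {λ m → - 1# * g (suc n) (suc m)} (sumsTo-suc {g n} (g-sums n))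
                   (sumsTo-*ˡ (- 1#) {g (suc n) ∘ suc} (sumsTo-suc {g (suc n)} (g-sums (suc n)))))
                 (sumsTo-cong (λ m → sym (g-difference n m))
                   (sumsTo-+ {λ m → q ^ n * t * x * g n m} {λ m → - (q ^ n * t * y) * g (suc n) m}
                     (sumsTo-*ˡ (q ^ n * t * x) {g n} (g-sums n))
                     (sumsTo-*ˡ (- (q ^ n * t * y)) {g (suc n)} (g-sums (suc n))))))) ⟩
          (q ^ n * t * x * F n + - (q ^ n * t * y) * F (suc n) + F (suc n)) - q ^ n * t * x * F n
            ≈⟨ eq₂ (F n) (F (suc n)) (q ^ n) x y t ⟩
          (1# - y * t * q ^ n) * F (suc n) ∎
          where
          eq₁ : ∀ a b g p x t → (1# - x * t * p) * a
            ≈ ((a - g) + - 1# * (b - g) + b) - p * t * x * a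
          eq₁ = solve 6 (λ a b g p x t → (con 1ℤ :- x :* t :* p) :* a
            := ((a :- g) :+ (:- con 1ℤ) :* (b :- g) :+ b) :- p :* t :* x :* a) refl

          eq₂ : ∀ a b p x y t → (p * t * x * a + - (p * t * y) * b + b) - p * t * x * a
            ≈ (1# - y * t * p) * b
          eq₂ = solve 6 (λ a b p x y t →
            (p :* t :* x :* a :+ (:- (p :* t :* y)) :* b :+ b) :- p :* t :* x :* a
            := (con 1ℤ :- y :* t :* p) :* b) refl

        F-iterate : ∀ n → pochhammer (x * t) q n * F 0 ≈ pochhammer (y * t) q n * F n
        F-iterate zero    = refl
        F-iterate (suc n) = begin
          pochhammer (x * t) q (suc n) * F 0
            ≈⟨ *-congʳ (pochhammer-suc (x * t) q n) ⟩
          pochhammer (x * t) q n * (1# - x * t * q ^ n) * F 0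
            ≈⟨ eq₁ _ (1# - x * t * q ^ n) (F 0) ⟩
          (1# - x * t * q ^ n) * (pochhammer (x * t) q n * F 0)
            ≈⟨ *-congˡ (F-iterate n) ⟩
          (1# - x * t * q ^ n) * (pochhammer (y * t) q n * F n)
            ≈⟨ eq₂ (1# - x * t * q ^ n) _ (F n) ⟩
          pochhammer (y * t) q n * ((1# - x * t * q ^ n) * F n)
            ≈⟨ *-congˡ (F-step n) ⟩
          pochhammer (y * t) q n * ((1# - y * t * q ^ n) * F (suc n))
            ≈⟨ *-assoc _ _ _ ⟨
          pochhammer (y * t) q n * (1# - y * t * q ^ n) * F (suc n)
            ≈⟨ *-congʳ (pochhammer-suc (y * t) q n) ⟨
          pochhammer (y * t) q (suc n) * F (suc n) ∎
          where
          eq₁ : ∀ d v f → d * v * f ≈ v * (d * f)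
          eq₁ = solve 3 (λ d v f → d :* v :* f := v :* (d :* f)) refl

          eq₂ : ∀ v d f → v * (d * f) ≈ d * (v * f)
          eq₂ = solve 3 (λ v d f → v :* (d :* f) := d :* (v :* f)) refl

      opaque
        q-binomial : ∃[ S ] coefficient sumsTo S ×
          (∀ {P D} → pochhammer (y * t) q ⟶ P → pochhammer (x * t) q ⟶ D → D * S ≈ P)
        q-binomial = F 0 , sumsTo-cong (λ m → *-identityʳ (coefficient m)) (g-sums 0)
          , λ {P} {D} yt→P xt→D → trans
              (⟶-unique (⟶-* xt→D (⟶-const (F 0)))
                (⟶-cong (λ n → sym (F-iterate n)) (⟶-* yt→P F⟶1)))
              (*-identityʳ P)

module QCoefficients {c ℓ₁ ℓ₂} {R : CompleteOrderedField c ℓ₁ ℓ₂} {k ℓ} (V : ValuedField R k ℓ) where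
  open ValuedField V hiding (zero)
  open Limits V
  open ℝ using (0<1)
  open FiniteSums commutativeRing
  open IntegerMultiples commutativeRing
  open Series V
  open QPochhammer V
  open SemiringSum semiring using (sum-cong-≋; *-distribˡ-sum)
  open SemiringExp semiring using (^-homo-*)
  open CommutativeSemiringExp commutativeSemiring using (^-distrib-*)
  open SetoidReasoning setoid

  module Coefficients
    {q : Carrier} (q<1 : ∣ q ∣< ℝ.1#)
    (q^ : Carrier → Carrier)
    (q^-cong : ∀ {α β} → α ≈ β → q^ α ≈ q^ β)
    (q^-+ : ∀ α β → q^ (α + β) ≈ q^ α * q^ β)
    (q^-· : ∀ n → q^ (n · 1#) ≈ q ^ n)
    (ι : ℤ → Carrier) (ι≡fromℤ : ∀ m → ι m ≡ fromℤ m)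
    (1/[q⨾q] 1/[-q⨾q] 1/[q²⨾q²] : ℕ → Carrier)
    (1/[q⨾q]-inverse : ∀ n → pochhammer q q n * 1/[q⨾q] n ≈ 1#)
    (1/[-q⨾q]-inverse : ∀ n → pochhammer (- q) q n * 1/[-q⨾q] n ≈ 1#)
    (1/[q²⨾q²]-inverse : ∀ n → pochhammer (q * q) (q * q) n * 1/[q²⨾q²] n ≈ 1#)
    where

    ι-+ : ∀ m n → ι (m ℤ.+ n) ≈ ι m + ι n
    ι-+ m n = trans (reflexive (ι≡fromℤ (m ℤ.+ n))) (trans (fromℤ-+ m n)
      (sym (+-cong (reflexive (ι≡fromℤ m)) (reflexive (ι≡fromℤ n)))))

    ι-sub : ∀ m n → ι (m ℤ.- n) ≈ ι m - ι n
    ι-sub m n = trans (reflexive (ι≡fromℤ (m ℤ.- n))) (trans (fromℤ-sub m n)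
      (sym (+-cong (reflexive (ι≡fromℤ m)) (-‿cong (reflexive (ι≡fromℤ n))))))

    ι-* : ∀ m n → ι (m ℤ.* n) ≈ ι m * ι n
    ι-* m n = trans (reflexive (ι≡fromℤ (m ℤ.* n))) (trans (fromℤ-* m n)
      (sym (*-cong (reflexive (ι≡fromℤ m)) (reflexive (ι≡fromℤ n)))))

    ι-0 : ι (+ 0) ≈ 0#
    ι-0 = reflexive (ι≡fromℤ (+ 0))

    ι-1 : ι (+ 1) ≈ 1#
    ι-1 = trans (reflexive (ι≡fromℤ (+ 1))) fromℤ-1

    ι-suc : ∀ n → ι (+ suc n) ≈ 1# + ι (+ n)
    ι-suc n = trans (ι-+ (+ 1) (+ n)) (+-congʳ ι-1)

    binom₂ : ℕ → ℤ
    binom₂ n = + (n C 2)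

    ι-binom₂ : ∀ n → ι (binom₂ (suc n)) ≈ ι (+ n) + ι (binom₂ n)
    ι-binom₂ n = trans (reflexive (≡.cong (λ m → ι (+ m)) (≡.sym eq))) (ι-+ (+ n) (binom₂ n))
      where
      eq : n ℕ.+ (n C 2) ≡ suc n C 2
      eq = ≡.trans (≡.cong (ℕ._+ (n C 2)) (≡.sym (nC1≡n n))) (nCk+nC[k+1]≡[n+1]C[k+1] n 1)

    q^-ι : ∀ n → q^ (ι (+ n)) ≈ q ^ n
    q^-ι n = trans (q^-cong (reflexive (ι≡fromℤ (+ n)))) (q^-· n)

    q^-0 : ∀ {β} → β ≈ 0# → q^ β ≈ 1#
    q^-0 β≈0 = trans (q^-cong β≈0) (q^-· 0)

    q^-^ : ∀ β n → q^ β ^ n ≈ q^ (β * ι (+ n))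
    q^-^ β zero    = sym (q^-0 (trans (*-congˡ ι-0) (zeroʳ β)))
    q^-^ β (suc n) = begin
      q^ β * q^ β ^ n             ≈⟨ *-congˡ (q^-^ β n) ⟩
      q^ β * q^ (β * ι (+ n))     ≈⟨ q^-+ _ _ ⟨
      q^ (β + β * ι (+ n))        ≈⟨ q^-cong (trans (eq β _) (*-congˡ (sym (ι-suc n)))) ⟩
      q^ (β * ι (+ suc n))        ∎
      where
      eq : ∀ β n → β + β * n ≈ β * (1# + n)
      eq = solve 2 (λ β n → β :+ β :* n := β :* (con 1ℤ :+ n)) refl

    inverse-unique : ∀ {u v w} → u * v ≈ 1# → u * w ≈ 1# → v ≈ w
    inverse-unique {u} {v} {w} uv≈1 uw≈1 = begin
      v              ≈⟨ *-identityʳ v ⟨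
      v * 1#         ≈⟨ *-congˡ uw≈1 ⟨
      v * (u * w)    ≈⟨ eq u v w ⟩
      w * (u * v)    ≈⟨ *-congˡ uv≈1 ⟩
      w * 1#         ≈⟨ *-identityʳ w ⟩
      w              ∎
      where
      eq : ∀ u v w → v * (u * w) ≈ w * (u * v)
      eq = solve 3 (λ u v w → v :* (u :* w) := w :* (u :* v)) refl

    [q²⨾q²]≈[q⨾q][-q⨾q] : ∀ n →
      pochhammer (q * q) (q * q) n ≈ pochhammer q q n * pochhammer (- q) q n
    [q²⨾q²]≈[q⨾q][-q⨾q] zero    = sym (*-identityˡ 1#)
    [q²⨾q²]≈[q⨾q][-q⨾q] (suc n) = begin
      pochhammer (q * q) (q * q) (suc n)
        ≈⟨ pochhammer-suc (q * q) (q * q) n ⟩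
      pochhammer (q * q) (q * q) n * (1# - q * q * (q * q) ^ n)
        ≈⟨ *-cong ([q²⨾q²]≈[q⨾q][-q⨾q] n) (+-congˡ (-‿cong (*-congˡ (^-distrib-* q q n)))) ⟩
      pochhammer q q n * pochhammer (- q) q n * (1# - q * q * (q ^ n * q ^ n))
        ≈⟨ eq _ _ q (q ^ n) ⟩
      (pochhammer q q n * (1# - q * q ^ n)) * (pochhammer (- q) q n * (1# - - q * q ^ n))
        ≈⟨ *-cong (pochhammer-suc q q n) (pochhammer-suc (- q) q n) ⟨
      pochhammer q q (suc n) * pochhammer (- q) q (suc n) ∎
      where
      eq : ∀ u v q p → u * v * (1# - q * q * (p * p)) ≈ (u * (1# - q * p)) * (v * (1# - - q * p))
      eq = solve 4 (λ u v q p → u :* v :* (con 1ℤ :- q :* q :* (p :* p))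
        := (u :* (con 1ℤ :- q :* p)) :* (v :* (con 1ℤ :- (:- q) :* p))) refl

    1/[q⨾q]*1/[-q⨾q] : ∀ n → 1/[q⨾q] n * 1/[-q⨾q] n ≈ 1/[q²⨾q²] n
    1/[q⨾q]*1/[-q⨾q] n = inverse-unique (begin
      pochhammer (q * q) (q * q) n * (1/[q⨾q] n * 1/[-q⨾q] n)
        ≈⟨ *-congʳ ([q²⨾q²]≈[q⨾q][-q⨾q] n) ⟩
      pochhammer q q n * pochhammer (- q) q n * (1/[q⨾q] n * 1/[-q⨾q] n)
        ≈⟨ eq _ _ _ _ ⟩
      (pochhammer q q n * 1/[q⨾q] n) * (pochhammer (- q) q n * 1/[-q⨾q] n)
        ≈⟨ *-cong (1/[q⨾q]-inverse n) (1/[-q⨾q]-inverse n) ⟩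
      1# * 1#
        ≈⟨ *-identityˡ 1# ⟩
      1# ∎) (1/[q²⨾q²]-inverse n)
      where
      eq : ∀ u v w z → u * v * (w * z) ≈ (u * w) * (v * z)
      eq = solve 4 (λ u v w z → u :* v :* (w :* z) := (u :* w) :* (v :* z)) refl

    -- (q;q)ₙ / (q;q)ₙ₋ᵢ, in the form in which it occurs in [n, i].
    falling : ℕ → ℕ → Carrier
    falling n i = pochhammer (q^ (- ι (+ n))) q i * (- 1#) ^ i
                    * q^ (ι (+ n) * ι (+ i) - ι (binom₂ i))

    falling-[q⨾q] : ∀ i m {n} → n ≡ i ℕ.+ m → falling n i * pochhammer q q m ≈ pochhammer q q n
    falling-[q⨾q] zero    m {n} ≡.refl = begin
      1# * 1# * q^ (ι (+ n) * ι (+ 0) - ι (+ 0)) * pochhammer q q n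
        ≈⟨ *-congʳ (*-congˡ (q^-0 (trans (+-cong (*-congˡ ι-0) (-‿cong ι-0)) (eq₁ _)))) ⟩
      1# * 1# * 1# * pochhammer q q n
        ≈⟨ eq₂ _ ⟩
      pochhammer q q n ∎
      where
      eq₁ : ∀ n → n * 0# - 0# ≈ 0#
      eq₁ = solve 1 (λ n → n :* con 0ℤ :- con 0ℤ := con 0ℤ) refl

      eq₂ : ∀ n → 1# * 1# * 1# * n ≈ n
      eq₂ = solve 1 (λ n → con 1ℤ :* con 1ℤ :* con 1ℤ :* n := n) refl
    falling-[q⨾q] (suc i) m {n} n≡1+i+m = begin
      pochhammer Q q (suc i) * (- 1# * (- 1#) ^ i) * q^ (ι (+ n) * ι (+ suc i) - ι (binom₂ (suc i)))
        * pochhammer q q m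
        ≈⟨ *-congʳ (*-cong (*-congʳ (pochhammer-suc Q q i)) q^-step) ⟩
      pochhammer Q q i * (1# - Q * q ^ i) * (- 1# * (- 1#) ^ i) * (E * q ^ suc m) * pochhammer q q m
        ≈⟨ eq₁ (pochhammer Q q i) Q (q ^ i) ((- 1#) ^ i) E (q ^ suc m) (pochhammer q q m) ⟩
      falling n i * (pochhammer q q m * (Q * (q ^ i * q ^ suc m) - q ^ suc m))
        ≈⟨ *-congˡ (*-congˡ (+-congʳ Q*q^n≈1)) ⟩
      falling n i * (pochhammer q q m * (1# - q ^ suc m))
        ≈⟨ *-congˡ (pochhammer-suc q q m) ⟨
      falling n i * pochhammer q q (suc m)
        ≈⟨ falling-[q⨾q] i (suc m) n≡i+1+m ⟩
      pochhammer q q n ∎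
      where
      Q = q^ (- ι (+ n))
      E = q^ (ι (+ n) * ι (+ i) - ι (binom₂ i))

      n≡i+1+m : n ≡ i ℕ.+ suc m
      n≡i+1+m = ≡.trans n≡1+i+m (≡.sym (ℕ.+-suc i m))

      eq₁ : ∀ u Q p s E r v → u * (1# - Q * p) * (- 1# * s) * (E * r) * v
            ≈ u * s * E * (v * (Q * (p * r) - r))
      eq₁ = solve 7 (λ u Q p s E r v → u :* (con 1ℤ :- Q :* p) :* ((:- con 1ℤ) :* s) :* (E :* r) :* v
        := u :* s :* E :* (v :* (Q :* (p :* r) :- r))) refl

      Q*q^n≈1 : Q * (q ^ i * q ^ suc m) ≈ 1#
      Q*q^n≈1 = begin
        Q * (q ^ i * q ^ suc m)        ≈⟨ *-congˡ (^-homo-* q i (suc m)) ⟨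
        Q * q ^ (i ℕ.+ suc m)          ≡⟨ ≡.cong (λ j → Q * q ^ j) n≡i+1+m ⟨
        Q * q ^ n                      ≈⟨ *-congˡ (q^-ι n) ⟨
        Q * q^ (ι (+ n))               ≈⟨ q^-+ _ _ ⟨
        q^ (- ι (+ n) + ι (+ n))       ≈⟨ q^-0 (-‿inverseˡ _) ⟩
        1#                             ∎

      eq₂ : ∀ n i b → n * (1# + i) - (i + b) ≈ (n * i - b) + (n - i)
      eq₂ = solve 3 (λ n i b → n :* (con 1ℤ :+ i) :- (i :+ b) := (n :* i :- b) :+ (n :- i)) refl

      eq₃ : ∀ x y → (x + y) - x ≈ y
      eq₃ = solve 2 (λ x y → (x :+ y) :- x := y) refl

      q^-step : q^ (ι (+ n) * ι (+ suc i) - ι (binom₂ (suc i))) ≈ E * q ^ suc m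
      q^-step = begin
        q^ (ι (+ n) * ι (+ suc i) - ι (binom₂ (suc i)))
          ≈⟨ q^-cong (+-cong (*-congˡ (ι-suc i)) (-‿cong (ι-binom₂ i))) ⟩
        q^ (ι (+ n) * (1# + ι (+ i)) - (ι (+ i) + ι (binom₂ i)))
          ≈⟨ q^-cong (eq₂ _ _ _) ⟩
        q^ ((ι (+ n) * ι (+ i) - ι (binom₂ i)) + (ι (+ n) - ι (+ i)))
          ≈⟨ q^-+ _ _ ⟩
        E * q^ (ι (+ n) - ι (+ i))
          ≈⟨ *-congˡ (q^-cong (begin
               ι (+ n) - ι (+ i)                    ≡⟨ ≡.cong (λ j → ι (+ j) - ι (+ i)) n≡i+1+m ⟩
               ι (+ (i ℕ.+ suc m)) - ι (+ i)        ≈⟨ +-congʳ (ι-+ (+ i) (+ suc m)) ⟩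
               (ι (+ i) + ι (+ suc m)) - ι (+ i)    ≈⟨ eq₃ _ _ ⟩
               ι (+ suc m)                          ∎)) ⟩
        E * q^ (ι (+ suc m))
          ≈⟨ *-congˡ (q^-ι (suc m)) ⟩
        E * q ^ suc m ∎

    falling/[q⨾q] : ∀ {i n} → i ℕ.≤ n → falling n i * 1/[q⨾q] n ≈ 1/[q⨾q] (n ∸ i)
    falling/[q⨾q] {i} {n} i≤n = inverse-unique (begin
      pochhammer q q m * (falling n i * 1/[q⨾q] n)    ≈⟨ eq _ _ _ ⟩
      falling n i * pochhammer q q m * 1/[q⨾q] n
        ≈⟨ *-congʳ (falling-[q⨾q] i m (≡.sym (ℕ.m+[n∸m]≡n i≤n))) ⟩
      pochhammer q q n * 1/[q⨾q] n                    ≈⟨ 1/[q⨾q]-inverse n ⟩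
      1#                                              ∎) (1/[q⨾q]-inverse m)
      where
      m = n ∸ i

      eq : ∀ u v w → u * (v * w) ≈ v * u * w
      eq = solve 3 (λ u v w → u :* (v :* w) := v :* u :* w) refl

    cauchy : ℕ → Carrier → Carrier → Carrier
    cauchy n x y = product {n} λ i → x - q ^ toℕ i * y

    cauchy-suc : ∀ n x y → cauchy (suc n) x y ≈ cauchy n x y * (x - q ^ n * y)
    cauchy-suc n x y = Π-snoc n λ i → x - q ^ i * y

    -- Reversing the order of the last i factors of pₙ(x,y) turns them into
    -- the factors of p_i(y, x q¹⁻ⁿ).
    cauchy-reverse : ∀ x y i m {n} → n ≡ i ℕ.+ m →
      cauchy i y (x * q^ (ι (1ℤ ℤ.- + n))) * (q^ (ι (binom₂ i)) * cauchy m x y)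
      ≈ cauchy n x y * (- 1#) ^ i * q^ (ι (+ i ℤ.* (+ i ℤ.- + n)))
    cauchy-reverse x y zero    m {n} ≡.refl = begin
      1# * (q^ (ι (+ 0)) * cauchy n x y)             ≈⟨ *-congˡ (*-congʳ (q^-0 ι-0)) ⟩
      1# * (1# * cauchy n x y)                       ≈⟨ eq _ ⟩
      cauchy n x y * 1# * 1#                         ≈⟨ *-congˡ (q^-0 (trans
                                                          (ι-* (+ 0) (+ 0 ℤ.- + n))
                                                          (trans (*-congʳ ι-0) (zeroˡ _)))) ⟨
      cauchy n x y * 1# * q^ (ι (+ 0 ℤ.* (+ 0 ℤ.- + n))) ∎
      where
      eq : ∀ u → 1# * (1# * u) ≈ u * 1# * 1#
      eq = solve 1 (λ u → con 1ℤ :* (con 1ℤ :* u) := u :* con 1ℤ :* con 1ℤ) refl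
    cauchy-reverse x y (suc i) m {n} n≡1+i+m = begin
      cauchy (suc i) y X * (q^ (ι (binom₂ (suc i))) * cauchy m x y)
        ≈⟨ *-cong (cauchy-suc i y X) (*-congʳ (trans (q^-cong (ι-binom₂ i)) (q^-+ _ _))) ⟩
      cauchy i y X * (y - q ^ i * X) * (q^ (ι (+ i)) * B * cauchy m x y)
        ≈⟨ *-congʳ (*-congˡ (+-cong y≈ (-‿cong q^i*X≈))) ⟩
      cauchy i y X * (W * q ^ m * y - W * x) * (q^ (ι (+ i)) * B * cauchy m x y)
        ≈⟨ eq₁ (cauchy i y X) W (q ^ m) x y (q^ (ι (+ i))) B (cauchy m x y) ⟩
      cauchy i y X * (B * (cauchy m x y * (x - q ^ m * y))) * (- 1# * (W * q^ (ι (+ i))))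
        ≈⟨ *-congʳ (*-congˡ (*-congˡ (cauchy-suc m x y))) ⟨
      cauchy i y X * (B * cauchy (suc m) x y) * (- 1# * (W * q^ (ι (+ i))))
        ≈⟨ *-congʳ (cauchy-reverse x y i (suc m) (≡.trans n≡1+i+m (≡.sym (ℕ.+-suc i m)))) ⟩
      cauchy n x y * (- 1#) ^ i * q^ (ι (+ i ℤ.* (+ i ℤ.- + n))) * (- 1# * (W * q^ (ι (+ i))))
        ≈⟨ eq₂ (cauchy n x y) ((- 1#) ^ i) _ W (q^ (ι (+ i))) ⟩
      cauchy n x y * (- 1# * (- 1#) ^ i) * (q^ (ι (+ i ℤ.* (+ i ℤ.- + n))) * (W * q^ (ι (+ i))))
        ≈⟨ *-congˡ q^-step ⟩
      cauchy n x y * (- 1#) ^ suc i * q^ (ι (+ suc i ℤ.* (+ suc i ℤ.- + n))) ∎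
      where
      X = x * q^ (ι (1ℤ ℤ.- + n))
      B = q^ (ι (binom₂ i))
      W = q^ (- ι (+ m))

      ι-n : ι (+ n) ≈ (1# + ι (+ i)) + ι (+ m)
      ι-n = trans (reflexive (≡.cong (λ j → ι (+ j)) n≡1+i+m))
        (trans (ι-+ (+ suc i) (+ m)) (+-congʳ (ι-suc i)))

      y≈ : y ≈ W * q ^ m * y
      y≈ = sym (trans (*-congʳ (begin
        W * q ^ m                  ≈⟨ *-congˡ (q^-ι m) ⟨
        W * q^ (ι (+ m))           ≈⟨ q^-+ _ _ ⟨
        q^ (- ι (+ m) + ι (+ m))   ≈⟨ q^-0 (-‿inverseˡ _) ⟩
        1#                         ∎)) (*-identityˡ y))

      eq₃ : ∀ i m → i + (1# - ((1# + i) + m)) ≈ - m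
      eq₃ = solve 2 (λ i m → i :+ (con 1ℤ :- ((con 1ℤ :+ i) :+ m)) := :- m) refl

      eq₄ : ∀ u x v → u * (x * v) ≈ u * v * x
      eq₄ = solve 3 (λ u x v → u :* (x :* v) := u :* v :* x) refl

      q^i*X≈ : q ^ i * X ≈ W * x
      q^i*X≈ = begin
        q ^ i * (x * q^ (ι (1ℤ ℤ.- + n)))
          ≈⟨ eq₄ _ _ _ ⟩
        q ^ i * q^ (ι (1ℤ ℤ.- + n)) * x
          ≈⟨ *-congʳ (*-congʳ (q^-ι i)) ⟨
        q^ (ι (+ i)) * q^ (ι (1ℤ ℤ.- + n)) * x
          ≈⟨ *-congʳ (q^-+ _ _) ⟨
        q^ (ι (+ i) + ι (1ℤ ℤ.- + n)) * x
          ≈⟨ *-congʳ (q^-cong (trans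
               (+-congˡ (trans (ι-sub 1ℤ (+ n)) (+-cong ι-1 (-‿cong ι-n)))) (eq₃ _ _))) ⟩
        W * x ∎

      eq₁ : ∀ u W p x y e B v → u * (W * p * y - W * x) * (e * B * v)
            ≈ u * (B * (v * (x - p * y))) * (- 1# * (W * e))
      eq₁ = solve 8 (λ u W p x y e B v → u :* (W :* p :* y :- W :* x) :* (e :* B :* v)
            := u :* (B :* (v :* (x :- p :* y))) :* ((:- con 1ℤ) :* (W :* e))) refl

      eq₂ : ∀ u s e W p → u * s * e * (- 1# * (W * p)) ≈ u * (- 1# * s) * (e * (W * p))
      eq₂ = solve 5 (λ u s e W p → u :* s :* e :* ((:- con 1ℤ) :* (W :* p))
            := u :* ((:- con 1ℤ) :* s) :* (e :* (W :* p))) refl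

      ι-product : ∀ j → ι (+ j ℤ.* (+ j ℤ.- + n)) ≈ ι (+ j) * (ι (+ j) - ι (+ n))
      ι-product j = trans (ι-* (+ j) (+ j ℤ.- + n)) (*-congˡ (ι-sub (+ j) (+ n)))

      eq₅ : ∀ i m → i * (i - ((1# + i) + m)) + (- m + i)
            ≈ (1# + i) * ((1# + i) - ((1# + i) + m))
      eq₅ = solve 2 (λ i m → i :* (i :- ((con 1ℤ :+ i) :+ m)) :+ (:- m :+ i)
        := (con 1ℤ :+ i) :* ((con 1ℤ :+ i) :- ((con 1ℤ :+ i) :+ m))) refl

      q^-step : q^ (ι (+ i ℤ.* (+ i ℤ.- + n))) * (W * q^ (ι (+ i)))
                ≈ q^ (ι (+ suc i ℤ.* (+ suc i ℤ.- + n)))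
      q^-step = begin
        q^ (ι (+ i ℤ.* (+ i ℤ.- + n))) * (W * q^ (ι (+ i)))
          ≈⟨ *-congˡ (q^-+ _ _) ⟨
        q^ (ι (+ i ℤ.* (+ i ℤ.- + n))) * q^ (- ι (+ m) + ι (+ i))
          ≈⟨ q^-+ _ _ ⟨
        q^ (ι (+ i ℤ.* (+ i ℤ.- + n)) + (- ι (+ m) + ι (+ i)))
          ≈⟨ q^-cong (+-congʳ (trans (ι-product i) (*-congˡ (+-congˡ (-‿cong ι-n))))) ⟩
        q^ (ι (+ i) * (ι (+ i) - ((1# + ι (+ i)) + ι (+ m))) + (- ι (+ m) + ι (+ i)))
          ≈⟨ q^-cong (eq₅ _ _) ⟩
        q^ ((1# + ι (+ i)) * ((1# + ι (+ i)) - ((1# + ι (+ i)) + ι (+ m))))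
          ≈⟨ q^-cong (trans (ι-product (suc i))
               (*-cong (ι-suc i) (+-cong (ι-suc i) (-‿cong ι-n)))) ⟨
        q^ (ι (+ suc i ℤ.* (+ suc i ℤ.- + n))) ∎

    cauchy-quotient : ∀ x y {i n w} → i ℕ.≤ n → cauchy i y (x * q^ (ι (1ℤ ℤ.- + n))) * w ≈ 1# →
      cauchy n x y * (- 1#) ^ i * q^ (ι (+ i ℤ.* (+ i ℤ.- + n))) * w
      ≈ q^ (ι (binom₂ i)) * cauchy (n ∸ i) x y
    cauchy-quotient x y {i} {n} {w} i≤n inv = begin
      cauchy n x y * (- 1#) ^ i * q^ (ι (+ i ℤ.* (+ i ℤ.- + n))) * w
        ≈⟨ *-congʳ (cauchy-reverse x y i (n ∸ i) (≡.sym (ℕ.m+[n∸m]≡n i≤n))) ⟨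
      cauchy i y (x * q^ (ι (1ℤ ℤ.- + n))) * (q^ (ι (binom₂ i)) * cauchy (n ∸ i) x y) * w
        ≈⟨ eq _ _ w ⟩
      cauchy i y (x * q^ (ι (1ℤ ℤ.- + n))) * w * (q^ (ι (binom₂ i)) * cauchy (n ∸ i) x y)
        ≈⟨ *-congʳ inv ⟩
      1# * (q^ (ι (binom₂ i)) * cauchy (n ∸ i) x y)
        ≈⟨ *-identityˡ _ ⟩
      q^ (ι (binom₂ i)) * cauchy (n ∸ i) x y ∎
      where
      eq : ∀ u v w → u * v * w ≈ u * w * v
      eq = solve 3 (λ u v w → u :* v :* w := u :* w :* v) refl

    z^i*t^n : ∀ z t {i n} → i ℕ.≤ n → z ^ i * t ^ n ≈ (z * t) ^ i * t ^ (n ∸ i)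
    z^i*t^n z t {i} {n} i≤n = begin
      z ^ i * t ^ n                    ≡⟨ ≡.cong (λ m → z ^ i * t ^ m) (ℕ.m+[n∸m]≡n i≤n) ⟨
      z ^ i * t ^ (i ℕ.+ (n ∸ i))      ≈⟨ *-congˡ (^-homo-* t i (n ∸ i)) ⟩
      z ^ i * (t ^ i * t ^ (n ∸ i))    ≈⟨ *-assoc _ _ _ ⟨
      z ^ i * t ^ i * t ^ (n ∸ i)      ≈⟨ *-congʳ (^-distrib-* z t i) ⟨
      (z * t) ^ i * t ^ (n ∸ i)        ∎

    0<⇒+suc : ∀ {m} → 0ℤ ℤ.< m → ∃[ d ] m ≡ + suc d
    0<⇒+suc {+ suc d} _ = d , ≡.refl
    0<⇒+suc {+ zero} (ℤ.+<+ ())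

    ∣q^∣<1 : ∀ {m} → 0ℤ ℤ.< m → ∣ q^ (ι m) ∣< ℝ.1#
    ∣q^∣<1 0<m with 0<⇒+suc 0<m
    ... | d , ≡.refl = ∣∣-congˡ (sym (q^-ι (suc d))) (∣*^∣ 0<1 q<1 q<1 d)

    q²<1 : ∣ q * q ∣< ℝ.1#
    q²<1 = ∣∣-congʳ (ℝ.*-identityˡ ℝ.1#) (∣*∣ 0<1 0<1 q<1 q<1)

    -- The two expansions of the theorem: L r s is the family L̃ of part (i), and
    -- inner is the inner sum of part (ii).
    module Expansions (α x y z a t : Carrier) where
      open QBinomial q<1 1/[q⨾q] 1/[q⨾q]-inverse x y t
        using (coefficient; coefficient-geometric; q-binomial)

      gauss : ℕ → ℕ → Carrier
      gauss n i = pochhammer (q^ (- ι (+ n))) q i * 1/[q⨾q] i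
        * (- 1#) ^ i * q^ (ι (+ n) * ι (+ i) - ι (binom₂ i))

      gauss- : ℕ → Carrier
      gauss- i = pochhammer (- q^ (- α)) q i * 1/[-q⨾q] i
        * q^ (α * ι (+ i) - ι (binom₂ i))

      exponent : ℤ → ℤ → ℕ → ℤ
      exponent r s i = r ℤ.* binom₂ i ℤ.- s ℤ.* binom₂ (suc i)

      L-term : ℤ → ℤ → ℕ → ℕ → Carrier
      L-term r s n i = gauss n i * gauss- i
        * q^ (ι (exponent r s i ℤ.+ binom₂ i)) * pochhammer a q i * cauchy (n ∸ i) x y * z ^ i

      L : ℤ → ℤ → ℕ → Carrier
      L r s n = Σ< (suc n) (L-term r s n)

      rhs : ℤ → ℤ → ℕ → Carrier
      rhs r s i = (pochhammer (- q^ (- α)) q i * pochhammer a q i) * 1/[q²⨾q²] i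
        * q^ (ι (+ i) * α + ι (exponent r s i)) * (z * t) ^ i

      Φ : ℕ → Carrier
      Φ i = (pochhammer (- q^ (- α)) q i * pochhammer a q i) * 1/[-q⨾q] i
        * ((z * t * q^ α) ^ i * 1/[q⨾q] i)

      L-convolve : ∀ r s n → L r s n * (t ^ n * 1/[q⨾q] n) ≈ convolve (rhs r s) coefficient n
      L-convolve r s n = begin
        L r s n * (t ^ n * 1/[q⨾q] n)
          ≈⟨ *-comm _ _ ⟩
        (t ^ n * 1/[q⨾q] n) * L r s n
          ≈⟨ Σ-*ˡ (suc n) (t ^ n * 1/[q⨾q] n) (L-term r s n) ⟨
        Σ< (suc n) (λ i → (t ^ n * 1/[q⨾q] n) * L-term r s n i)
          ≈⟨ Σ-cong< (suc n) (λ i i≤n → summand i (ℕ.s≤s⁻¹ i≤n)) ⟩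
        convolve (rhs r s) coefficient n ∎
        where
        eq₁ : ∀ β b e → (β - b) + (e + b) ≈ β + e
        eq₁ = solve 3 (λ β b e → (β :- b) :+ (e :+ b) := β :+ e) refl

        q-powers : ∀ i → q^ (α * ι (+ i) - ι (binom₂ i)) * q^ (ι (exponent r s i ℤ.+ binom₂ i))
                   ≈ q^ (ι (+ i) * α + ι (exponent r s i))
        q-powers i = trans (sym (q^-+ _ _)) (q^-cong (trans
          (+-congˡ (ι-+ (exponent r s i) (binom₂ i)))
          (trans (eq₁ _ _ _) (+-congʳ (*-comm α _)))))

        eq₂ : ∀ N u m e A w E F B p z T v →
          (T * v) * ((N * u * m * e) * (A * w * E) * F * B * p * z)
          ≈ (N * m * e * v) * ((u * w) * ((E * F) * ((z * T) * (A * B * p))))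
        eq₂ = solve 13 (λ N u m e A w E F B p z T v →
          (T :* v) :* ((N :* u :* m :* e) :* (A :* w :* E) :* F :* B :* p :* z)
          := (N :* m :* e :* v) :* ((u :* w) :* ((E :* F) :* ((z :* T) :* (A :* B :* p))))) refl

        eq₃ : ∀ v w E zt T A B p →
          v * (w * (E * ((zt * T) * (A * B * p)))) ≈ (A * B) * w * E * zt * (p * (T * v))
        eq₃ = solve 8 (λ v w E zt T A B p →
          v :* (w :* (E :* ((zt :* T) :* (A :* B :* p))))
          := (A :* B) :* w :* E :* zt :* (p :* (T :* v))) refl

        summand : ∀ i → i ℕ.≤ n →
          (t ^ n * 1/[q⨾q] n) * L-term r s n i ≈ rhs r s i * coefficient (n ∸ i)
        summand i i≤n = trans (eq₂ _ _ _ _ _ _ _ _ _ _ _ _ _) (trans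
          (*-cong (falling/[q⨾q] i≤n) (*-cong (1/[q⨾q]*1/[-q⨾q] i)
            (*-cong (q-powers i) (*-congʳ (z^i*t^n z t i≤n)))))
          (eq₃ _ _ _ _ _ _ _ _))

      inner-term : ℕ → ℕ → Carrier → Carrier
      inner-term n i c = gauss n i * gauss- i
        * (((- 1#) ^ i * q^ (ι (+ i ℤ.* (+ i ℤ.- + n))) * pochhammer a q i) * c) * z ^ i

      module _ (1/cauchy : ∀ n → Fin (suc n) → Carrier)
        (1/cauchy-inverse : ∀ n i →
          cauchy (toℕ i) y (x * q^ (ι (1ℤ ℤ.- + n))) * 1/cauchy n i ≈ 1#) where

        inner : ℕ → Carrier
        inner n = sum {suc n} λ i → inner-term n (toℕ i) (1/cauchy n i)

        inner-convolve : ∀ n →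
          (cauchy n x y * t ^ n) * 1/[q⨾q] n * inner n ≈ convolve Φ coefficient n
        inner-convolve n = trans
          (*-distribˡ-sum {suc n} ((cauchy n x y * t ^ n) * 1/[q⨾q] n)
            (λ i → inner-term n (toℕ i) (1/cauchy n i)))
          (sum-cong-≋ {suc n} λ i → summand (toℕ i) (1/cauchy n i)
            (ℕ.s≤s⁻¹ (Fin.toℕ<n i)) (1/cauchy-inverse n i))
          where
          eq₁ : ∀ β b → (β - b) + b ≈ β
          eq₁ = solve 2 (λ β b → (β :- b) :+ b := β) refl

          q-powers : ∀ i → q^ (α * ι (+ i) - ι (binom₂ i)) * q^ (ι (binom₂ i)) ≈ q^ α ^ i
          q-powers i = trans (sym (q^-+ _ _)) (trans (q^-cong (eq₁ _ _)) (sym (q^-^ α i)))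

          eq₂ : ∀ N u m e A w E G B v z T c C →
            (C * T) * v * ((N * u * m * e) * (A * w * E) * ((m * G * B) * c) * z)
            ≈ (N * m * e * v) * ((C * m * G * c) * ((z * T) * (A * B * w * u * E)))
          eq₂ = solve 14 (λ N u m e A w E G B v z T c C →
            (C :* T) :* v :* ((N :* u :* m :* e) :* (A :* w :* E) :* ((m :* G :* B) :* c) :* z)
            := (N :* m :* e :* v) :* ((C :* m :* G :* c) :* ((z :* T) :* (A :* B :* w :* u :* E))))
            refl

          eq₃ : ∀ v b p zt T A B w u E →
            v * ((b * p) * ((zt * T) * (A * B * w * u * E)))
            ≈ (A * B) * w * ((zt * (E * b)) * u) * (p * (T * v))
          eq₃ = solve 10 (λ v b p zt T A B w u E →
            v :* ((b :* p) :* ((zt :* T) :* (A :* B :* w :* u :* E)))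
            := (A :* B) :* w :* ((zt :* (E :* b)) :* u) :* (p :* (T :* v))) refl

          summand : ∀ i c → i ℕ.≤ n → cauchy i y (x * q^ (ι (1ℤ ℤ.- + n))) * c ≈ 1# →
            (cauchy n x y * t ^ n) * 1/[q⨾q] n * inner-term n i c ≈ Φ i * coefficient (n ∸ i)
          summand i c i≤n inv = trans (eq₂ _ _ _ _ _ _ _ _ _ _ _ _ _ _) (trans
            (*-cong (falling/[q⨾q] i≤n) (*-cong (cauchy-quotient x y i≤n inv)
              (*-congʳ (z^i*t^n z t i≤n))))
            (trans (eq₃ _ _ _ _ _ _ _ _ _ _) (*-congʳ (*-congˡ (*-congʳ
              (trans (*-congˡ (q-powers i)) (sym (^-distrib-* (z * t) (q^ α) i))))))))

      private
        module [q²⨾q²] = Reciprocal (q * q) q²<1 1/[q²⨾q²] 1/[q²⨾q²]-inverse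
        module [-q⨾q] = Reciprocal (- q) q<1 1/[-q⨾q] 1/[-q⨾q]-inverse
        module [q⨾q] = Reciprocal q q<1 1/[q⨾q] 1/[q⨾q]-inverse

        A B : ℕ → Carrier
        A i = 1# - - q^ (- α) * q ^ i
        B i = 1# - a * q ^ i

      rhs-suc : ∀ r s i → rhs r s (suc i)
        ≈ A i * B i * [q²⨾q²].factor i * (q^ (α - ι s) * q^ (ι (r ℤ.- s)) ^ i * (z * t)) * rhs r s i
      rhs-suc r s i = trans
        (*-congʳ (*-cong (*-cong (*-cong (pochhammer-suc (- q^ (- α)) q i) (pochhammer-suc a q i))
          ([q²⨾q²].reciprocal-suc i)) q-step))
        (eq₁ _ (A i) _ (B i) ([q²⨾q²].factor i) _ _ (q^ (α - ι s)) (q^ (ι (r ℤ.- s)) ^ i) (z * t) _)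
        where
        eq₁ : ∀ A α B β f w E e Q zt p →
          ((A * α) * (B * β)) * (f * w) * (E * (e * Q)) * (zt * p)
          ≈ α * β * f * (e * Q * zt) * ((A * B) * w * E * p)
        eq₁ = solve 11 (λ A α B β f w E e Q zt p →
          ((A :* α) :* (B :* β)) :* (f :* w) :* (E :* (e :* Q)) :* (zt :* p)
          := α :* β :* f :* (e :* Q :* zt) :* ((A :* B) :* w :* E :* p)) refl

        ι-exponent : ∀ i → ι (exponent r s i) ≈ ι r * ι (binom₂ i) - ι s * ι (binom₂ (suc i))
        ι-exponent i = trans (ι-sub (r ℤ.* binom₂ i) (s ℤ.* binom₂ (suc i)))
          (+-cong (ι-* r (binom₂ i)) (-‿cong (ι-* s (binom₂ (suc i)))))

        eq₂ : ∀ i α r s b → (1# + i) * α + (r * (i + b) - s * ((1# + i) + (i + b)))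
              ≈ (i * α + (r * b - s * (i + b))) + ((α - s) + (r - s) * i)
        eq₂ = solve 5 (λ i α r s b →
          (con 1ℤ :+ i) :* α :+ (r :* (i :+ b) :- s :* ((con 1ℤ :+ i) :+ (i :+ b)))
          := (i :* α :+ (r :* b :- s :* (i :+ b))) :+ ((α :- s) :+ (r :- s) :* i)) refl

        q-step : q^ (ι (+ suc i) * α + ι (exponent r s (suc i)))
          ≈ q^ (ι (+ i) * α + ι (exponent r s i)) * (q^ (α - ι s) * q^ (ι (r ℤ.- s)) ^ i)
        q-step = begin
          q^ (ι (+ suc i) * α + ι (exponent r s (suc i)))
            ≈⟨ q^-cong (+-cong (*-congʳ (ι-suc i)) (trans (ι-exponent (suc i))
                 (+-cong (*-congˡ (ι-binom₂ i)) (-‿cong (*-congˡ (trans (ι-binom₂ (suc i))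
                   (+-cong (ι-suc i) (ι-binom₂ i)))))))) ⟩
          q^ ((1# + ι (+ i)) * α + (ι r * (ι (+ i) + ι (binom₂ i))
              - ι s * ((1# + ι (+ i)) + (ι (+ i) + ι (binom₂ i)))))
            ≈⟨ q^-cong (eq₂ (ι (+ i)) α (ι r) (ι s) (ι (binom₂ i))) ⟩
          q^ ((ι (+ i) * α + (ι r * ι (binom₂ i) - ι s * (ι (+ i) + ι (binom₂ i))))
              + ((α - ι s) + (ι r - ι s) * ι (+ i)))
            ≈⟨ q^-cong (+-cong (+-congˡ (trans (ι-exponent i)
                 (+-congˡ (-‿cong (*-congˡ (ι-binom₂ i)))))) (+-congˡ (*-congʳ (ι-sub r s)))) ⟨
          q^ ((ι (+ i) * α + ι (exponent r s i)) + ((α - ι s) + ι (r ℤ.- s) * ι (+ i)))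
            ≈⟨ trans (q^-+ _ _) (*-congˡ (q^-+ _ _)) ⟩
          q^ (ι (+ i) * α + ι (exponent r s i)) * (q^ (α - ι s) * q^ (ι (r ℤ.- s) * ι (+ i)))
            ≈⟨ *-congˡ (*-congˡ (q^-^ _ i)) ⟨
          q^ (ι (+ i) * α + ι (exponent r s i)) * (q^ (α - ι s) * q^ (ι (r ℤ.- s)) ^ i) ∎

      Φ-suc : ∀ i → Φ (suc i)
        ≈ A i * B i * ([-q⨾q].factor i * [q⨾q].factor i) * (z * t * q^ α) * Φ i
      Φ-suc i = trans
        (*-cong (*-cong (*-cong (pochhammer-suc (- q^ (- α)) q i) (pochhammer-suc a q i))
          ([-q⨾q].reciprocal-suc i)) (*-congˡ ([q⨾q].reciprocal-suc i)))
        (eq _ (A i) _ (B i) ([-q⨾q].factor i) _ ([q⨾q].factor i) _ (z * t * q^ α) _)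
        where
        eq : ∀ A α B β f w g u zt p →
          ((A * α) * (B * β)) * (f * w) * ((zt * p) * (g * u))
          ≈ α * β * (f * g) * zt * ((A * B) * w * (p * u))
        eq = solve 10 (λ A α B β f w g u zt p →
          ((A :* α) :* (B :* β)) :* (f :* w) :* ((zt :* p) :* (g :* u))
          := α :* β :* (f :* g) :* zt :* ((A :* B) :* w :* (p :* u))) refl

      private
        AB⟶1 : (λ i → A i * B i) ⟶ 1#
        AB⟶1 = ⟶-congʳ (*-identityˡ 1#) (⟶-* (1-*^⟶1 (- q^ (- α)) q<1) (1-*^⟶1 a q<1))

      rhs-ratio⟶ : ∀ r s {l} → (λ i → q^ (ι (r ℤ.- s)) ^ i) ⟶ l →
        (λ i → A i * B i * [q²⨾q²].factor i * (q^ (α - ι s) * q^ (ι (r ℤ.- s)) ^ i * (z * t)))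
          ⟶ z * t * q^ (α - ι s) * l
      rhs-ratio⟶ r s {l} Q⟶l = ⟶-congʳ (eq (q^ (α - ι s)) l (z * t))
        (⟶-* (⟶-* AB⟶1 [q²⨾q²].factor⟶1) (⟶-* (⟶-*ˡ (q^ (α - ι s)) Q⟶l) (⟶-const (z * t))))
        where
        eq : ∀ e l zt → 1# * 1# * (e * l * zt) ≈ zt * e * l
        eq = solve 3 (λ e l zt → con 1ℤ :* con 1ℤ :* (e :* l :* zt) := zt :* e :* l) refl

      rhs-converges : ∀ r s → s ℤ.< r ⊎ (s ≡ r × ∣ z * t * q^ (α - ι s) ∣< ℝ.1#) →
                      ∃[ S ] rhs r s sumsTo S
      rhs-converges r s (inj₁ s<r) = summable (ratio⇒geometric (rhs-suc r s)
        (rhs-ratio⟶ r s (Null⇒⟶0 (^-Null (∣q^∣<1 0<r-s))))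
        (∣∣-congˡ (sym (zeroʳ _)) (∣0∣ 0<1)))
        where
        0<r-s : 0ℤ ℤ.< r ℤ.- s
        0<r-s = ≡.subst (ℤ._< r ℤ.- s) (ℤ.+-inverseʳ s) (ℤ.+-monoˡ-< (ℤ.- s) s<r)
      rhs-converges r .r (inj₂ (≡.refl , w<1)) = summable (ratio⇒geometric (rhs-suc r r)
        (rhs-ratio⟶ r r (⟶-cong (λ i → sym (Q^i≈1 i)) (⟶-const 1#)))
        (∣∣-congˡ (sym (*-identityʳ _)) w<1))
        where
        Q≈1 : q^ (ι (r ℤ.- r)) ≈ 1#
        Q≈1 = q^-0 (trans (ι-sub r r) (-‿inverseʳ _))

        Q^i≈1 : ∀ i → q^ (ι (r ℤ.- r)) ^ i ≈ 1#
        Q^i≈1 zero    = refl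
        Q^i≈1 (suc i) = trans (*-cong Q≈1 (Q^i≈1 i)) (*-identityˡ 1#)

      Φ-converges : ∣ z * t * q^ α ∣< ℝ.1# → ∃[ S ] Φ sumsTo S
      Φ-converges w<1 = summable (ratio⇒geometric Φ-suc
        (⟶-congʳ (eq (z * t * q^ α)) (⟶-* (⟶-* AB⟶1 (⟶-* [-q⨾q].factor⟶1 [q⨾q].factor⟶1))
          (⟶-const (z * t * q^ α)))) w<1)
        where
        eq : ∀ w → 1# * (1# * 1#) * w ≈ w
        eq = solve 1 (λ w → con 1ℤ :* (con 1ℤ :* con 1ℤ) :* w := w) refl

      convolve-sums : ∣ x * t ∣< ℝ.1# → ∀ {P D D⁻¹} →
        pochhammer (y * t) q ⟶ P → pochhammer (x * t) q ⟶ D → D * D⁻¹ ≈ 1# →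
        ∀ {b S} → b sumsTo S → convolve b coefficient sumsTo (P * D⁻¹ * S)
      convolve-sums xt<1 {P} {D} {D⁻¹} yt→P xt→D DD⁻¹≈1 {b} {S} b→S =
        let F , c→F , DF≈ = q-binomial xt<1 in
        ⟶-congʳ (*-congʳ (F≈P/D (DF≈ yt→P xt→D))) (mertens {b} b→S (coefficient-geometric xt<1) c→F)
        where
        eq : ∀ D F D⁻¹ → D * D⁻¹ * F ≈ D * F * D⁻¹
        eq = solve 3 (λ D F D⁻¹ → D :* D⁻¹ :* F := D :* F :* D⁻¹) refl

        F≈P/D : ∀ {F} → D * F ≈ P → F ≈ P * D⁻¹
        F≈P/D {F} DF≈P = begin
          F               ≈⟨ *-identityˡ F ⟨
          1# * F          ≈⟨ *-congʳ DD⁻¹≈1 ⟨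
          D * D⁻¹ * F     ≈⟨ eq D F D⁻¹ ⟩
          D * F * D⁻¹     ≈⟨ *-congʳ DF≈P ⟩
          P * D⁻¹         ∎

    -- Euler's case y = 0 of the q-binomial theorem.
    pochhammer-limit-invertible : ∀ x t → ∣ x * t ∣< ℝ.1# → ∀ {D} →
      pochhammer (x * t) q ⟶ D → ∃[ D⁻¹ ] D * D⁻¹ ≈ 1#
    pochhammer-limit-invertible x t xt<1 xt→D =
      let F , _ , DF≈ = QBinomial.q-binomial q<1 1/[q⨾q] 1/[q⨾q]-inverse x 0# t xt<1
      in F , DF≈ (⟶-cong (λ n → sym (pochhammer-0 (zeroˡ t) n)) (⟶-const 1#)) xt→D

module ComplexQSeries {c ℓ₁ ℓ₂} (ℝ : CompleteOrderedField c ℓ₁ ℓ₂) where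
  open Complex ℝ
  open ComplexField ℝ using (valuedField; *-inverse; inverse⇒NonZero)

  private
    module K = ValuedField valuedField

  open Exponential valuedField
  open FiniteSums K.commutativeRing
  open IntegerMultiples K.commutativeRing using () renaming (fromℤ to fromℤ′)
  open Limits valuedField using (sumsTo-cong)
  open QCoefficients valuedField
  open QPochhammer valuedField
  open SemiringSum K.semiring using (sum-cong-≋)

  private
    n!≢0 : ∀ n → NonZero ((n !) ×ℂ 1ℂ)
    n!≢0 n = NonZero-ℕ (n !) {{n !≢0}}

    1/! : ℕ → ℂ
    1/! n = ((n !) ×ℂ 1ℂ) ⁻¹[ n!≢0 n ]

    1/!-inverse : ∀ n → 1/! n K.* ((n !) K.· K.1#) K.≈ K.1#
    1/!-inverse n = K.trans (K.*-comm (1/! n) ((n !) ×ℂ 1ℂ)) (*-inverse ((n !) ×ℂ 1ℂ) (n!≢0 n))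

    fromℤ≡fromℤ′ : ∀ m → fromℤ m ≡ fromℤ′ m
    fromℤ≡fromℤ′ (+ n)    = ≡.refl
    fromℤ≡fromℤ′ -[1+ n ] = ≡.refl

    -- The operations of K are definitionally those of Complex, but comparing
    -- two large expressions unfolds them into real and imaginary parts over and
    -- over again.  Hence the comparison proceeds factor by factor.
    product₃ : ∀ {u u′ v v′} i → u ≡ u′ → v ≡ v′ → u * i * v ≡ u′ K.* i K.* v′
    product₃ i ≡.refl ≡.refl = ≡.refl

    product₄ : ∀ {u u′ v v′ w w′} i → u ≡ u′ → v ≡ v′ → w ≡ w′ →
               u * i * v * w ≡ u′ K.* i K.* v′ K.* w′
    product₄ i ≡.refl ≡.refl ≡.refl = ≡.refl

    product₆ : ∀ {u u′ v v′ w w′ f f′ g g′ h h′} →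
      u ≡ u′ → v ≡ v′ → w ≡ w′ → f ≡ f′ → g ≡ g′ → h ≡ h′ →
      u * v * w * f * g * h ≡ u′ K.* v′ K.* w′ K.* f′ K.* g′ K.* h′
    product₆ ≡.refl ≡.refl ≡.refl ≡.refl ≡.refl ≡.refl = ≡.refl

    product₇ : ∀ {u u′ v v′ w w′ f f′ g g′ h h′} i →
      u ≡ u′ → v ≡ v′ → w ≡ w′ → f ≡ f′ → g ≡ g′ → h ≡ h′ →
      u * v * (w * f * g * i) * h ≡ u′ K.* v′ K.* (w′ K.* f′ K.* g′ K.* i) K.* h′
    product₇ i ≡.refl ≡.refl ≡.refl ≡.refl ≡.refl ≡.refl = ≡.refl

    ^≡ : ∀ z n → z ^ n ≡ z K.^ n
    ^≡ z n = ≡.refl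

    ⟨⨾⟩≡pochhammer : ∀ a b n → ⟨ a ⨾ b ⟩ n ≡ pochhammer a b n
    ⟨⨾⟩≡pochhammer a b n = ≡.refl

  module WithParameters {q} (q≢0 : NonZero q) (q<1 : ∣ q ∣< 1ℝ) {q^ : ℂ → ℂ} (isPower : IsPower q q^)
    (α x y z a t : ℂ) where

    open IsPower isPower
    open QSeries q q<1 q^
    open Terms 1/! 1/!-inverse
    open Powers {q} {q ⁻¹[ q≢0 ]} {log} (*-inverse q q≢0) exp-log q^ power

    1/[q⨾q] 1/[-q⨾q] 1/[q²⨾q²] : ℕ → ℂ
    1/[q⨾q] n = (⟨ q ⨾ q ⟩ n) ⁻¹[ [q⨾q]≢0 n ]
    1/[-q⨾q] n = (⟨ - q ⨾ q ⟩ n) ⁻¹[ [-q⨾q]≢0 n ]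
    1/[q²⨾q²] n = (⟨ q * q ⨾ q * q ⟩ n) ⁻¹[ [q²⨾q²]≢0 n ]

    1/[q⨾q]-inverse : ∀ n → pochhammer q q n K.* 1/[q⨾q] n K.≈ K.1#
    1/[q⨾q]-inverse n = *-inverse (⟨ q ⨾ q ⟩ n) ([q⨾q]≢0 n)

    module C = Coefficients {q} q<1 q^ q^-cong q^-+ q^-· fromℤ fromℤ≡fromℤ′
      1/[q⨾q] 1/[-q⨾q] 1/[q²⨾q²] 1/[q⨾q]-inverse
      (λ n → *-inverse (⟨ - q ⨾ q ⟩ n) ([-q⨾q]≢0 n))
      (λ n → *-inverse (⟨ q * q ⨾ q * q ⟩ n) ([q²⨾q²]≢0 n))
    module E = C.Expansions α x y z a t

    coefficient : ℕ → ℂ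
    coefficient = QBinomial.coefficient {q} q<1 1/[q⨾q] 1/[q⨾q]-inverse x y t

    cauchy≡ : ∀ n x y → cauchy n x y ≡ C.cauchy n x y
    cauchy≡ n x y = ≡.refl

    gauss≡ : ∀ n i → [ fromℤ (+ n) , i ]q ≡ E.gauss n i
    gauss≡ n i = product₄ (1/[q⨾q] i) (⟨⨾⟩≡pochhammer (q^ (- fromℤ (+ n))) q i) (^≡ (- 1ℂ) i)
      (q^≡ (fromℤ (+ n)) (fromℤ (+ i)) (fromℤ (binom₂ i)))
      where
      q^≡ : ∀ u v w → q^ (u * v - w) ≡ q^ (u K.* v K.- w)
      q^≡ u v w = ≡.refl

    gauss-≡ : ∀ i → [ α , i ]-q ≡ E.gauss- i
    gauss-≡ i = product₃ (1/[-q⨾q] i) (⟨⨾⟩≡pochhammer (- q^ (- α)) q i)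
      (q^≡ (fromℤ (+ i)) (fromℤ (binom₂ i)))
      where
      q^≡ : ∀ v w → q^ (α * v - w) ≡ q^ (α K.* v K.- w)
      q^≡ v w = ≡.refl

    L̃-term : ℤ → ℤ → ℕ → ℕ → ℂ
    L̃-term r s n i = [ fromℤ (+ n) , i ]q * [ α , i ]-q
      * q^ℤ (exponent r s i ℤ.+ binom₂ i) * ⟨ a ⨾ q ⟩ i * cauchy (n ∸ i) x y * z ^ i

    L̃-term≡ : ∀ r s n i → L̃-term r s n i ≡ E.L-term r s n i
    L̃-term≡ r s n i = product₆ (gauss≡ n i) (gauss-≡ i)
      (≡.refl {x = q^ℤ (exponent r s i ℤ.+ binom₂ i)})
      (⟨⨾⟩≡pochhammer a q i) (cauchy≡ (n ∸ i) x y) (^≡ z i)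

    L̃≈L : ∀ r s n → L̃ r s n α x y z a ≈ E.L r s n
    L̃≈L r s n = Σ-cong (suc n) {L̃-term r s n} {E.L-term r s n}
      λ i → K.reflexive (L̃-term≡ r s n i)

    term-i : ℤ → ℤ → ℕ → ℂ
    term-i r s n = L̃ r s n α x y z a * (t ^ n / ⟨ q ⨾ q ⟩ n [ [q⨾q]≢0 n ])

    term-i≈ : ∀ r s n → term-i r s n ≈ convolve (E.rhs r s) coefficient n
    term-i≈ r s n = K.trans {term-i r s n} {E.L r s n * w} {convolve (E.rhs r s) coefficient n}
      (K.*-congʳ {w} {L̃ r s n α x y z a} {E.L r s n} (L̃≈L r s n)) (E.L-convolve r s n)
      where w = t ^ n / ⟨ q ⨾ q ⟩ n [ [q⨾q]≢0 n ]

    module _ (p≢0 : ∀ n (i : Fin (suc n)) →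
                    NonZero (cauchy (toℕ i) y (x * q^ℤ (1ℤ ℤ.- + n)))) where
      1/cauchy : ∀ n → Fin (suc n) → ℂ
      1/cauchy n i = cauchy (toℕ i) y (x * q^ℤ (1ℤ ℤ.- + n)) ⁻¹[ p≢0 n i ]

      1/cauchy-inverse : ∀ n i →
        C.cauchy (toℕ i) y (x K.* q^ (fromℤ (1ℤ ℤ.- + n))) K.* 1/cauchy n i K.≈ K.1#
      1/cauchy-inverse n i = *-inverse (cauchy (toℕ i) y (x * q^ℤ (1ℤ ℤ.- + n))) (p≢0 n i)

      inner-term : ∀ n → Fin (suc n) → ℂ
      inner-term n i = let k = toℕ i in
        [ fromℤ (+ n) , k ]q * [ α , k ]-q
          * (((- 1ℂ) ^ k * q^ℤ (+ k ℤ.* (+ k ℤ.- + n)) * ⟨ a ⨾ q ⟩ k)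
              / cauchy k y (x * q^ℤ (1ℤ ℤ.- + n)) [ p≢0 n i ])
          * z ^ k

      inner : ℕ → ℂ
      inner n = sum {suc n} (inner-term n)

      inner-term≡ : ∀ n i → inner-term n i ≡ E.inner-term n (toℕ i) (1/cauchy n i)
      inner-term≡ n i = product₇ (1/cauchy n i) (gauss≡ n (toℕ i)) (gauss-≡ (toℕ i))
        (^≡ (- 1ℂ) (toℕ i)) (≡.refl {x = q^ℤ (+ toℕ i ℤ.* (+ toℕ i ℤ.- + n))})
        (⟨⨾⟩≡pochhammer a q (toℕ i)) (^≡ z (toℕ i))

      inner≈ : ∀ n → inner n ≈ E.inner 1/cauchy 1/cauchy-inverse n
      inner≈ n = sum-cong-≋ {suc n} {inner-term n}
        {λ i → E.inner-term n (toℕ i) (1/cauchy n i)} λ i → K.reflexive (inner-term≡ n i)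

      term-ii : ℕ → ℂ
      term-ii n = (cauchy n x y * t ^ n) / ⟨ q ⨾ q ⟩ n [ [q⨾q]≢0 n ] * inner n

      term-ii≈ : ∀ n → term-ii n ≈ convolve E.Φ coefficient n
      term-ii≈ n = K.trans {term-ii n} {w * E.inner 1/cauchy 1/cauchy-inverse n}
        {convolve E.Φ coefficient n}
        (K.*-congˡ {w} {inner n} {E.inner 1/cauchy 1/cauchy-inverse n} (inner≈ n))
        (E.inner-convolve 1/cauchy 1/cauchy-inverse n)
        where w = (cauchy n x y * t ^ n) / ⟨ q ⨾ q ⟩ n [ [q⨾q]≢0 n ]

    module _ (xt<1 : ∣ x * t ∣< 1ℝ) where
      private
        yt-limit = pochhammer-converges (y * t) {q} q<1
        xt-limit = pochhammer-converges (x * t) {q} q<1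

      P D : ℂ
      P = proj₁ yt-limit
      D = proj₁ xt-limit

      yt→P : ⟨ y * t ⨾ q ⟩∞≡ P
      yt→P = proj₂ yt-limit

      xt→D : ⟨ x * t ⨾ q ⟩∞≡ D
      xt→D = proj₂ xt-limit

      D≢0 : NonZero D
      D≢0 = inverse⇒NonZero {D} {proj₁ D⁻¹} (proj₂ D⁻¹)
        where D⁻¹ = C.pochhammer-limit-invertible x t xt<1 {D} xt→D

      convolve-sums : ∀ {u b S} → (∀ n → u n ≈ convolve b coefficient n) → b sumsTo S →
                      u sumsTo (P / D [ D≢0 ] * S)
      convolve-sums {u} {b} {S} u≈ b→S =
        sumsTo-cong {convolve b coefficient} {u} {P / D [ D≢0 ] * S}
          (λ n → K.sym {u n} {convolve b coefficient n} (u≈ n))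
          (E.convolve-sums xt<1 {P} {D} {D ⁻¹[ D≢0 ]} yt→P xt→D (*-inverse D D≢0) {b} {S} b→S)

theorem6 :
  ∀ {c ℓ₁ ℓ₂} (ℝ : CompleteOrderedField c ℓ₁ ℓ₂) → let open Complex ℝ in
  (q : ℂ) → NonZero q → (∣q∣<1 : ∣ q ∣< 1ℝ) →
  (q^ : ℂ → ℂ) → IsPower q q^ → let open QSeries q ∣q∣<1 q^ in
  (α x y z a t : ℂ) →
  ( (r s : ℤ) → r ≢ 0ℤ → s ≢ 0ℤ → ∣ x * t ∣< 1ℝ →
    let rhs : ℕ → ℂ
        rhs k = (⟨ - q^ (- α) ⨾ q ⟩ k * ⟨ a ⨾ q ⟩ k)
                  / ⟨ q * q ⨾ q * q ⟩ k [ [q²⨾q²]≢0 k ]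
                  * q^ (fromℤ (+ k) * α + fromℤ (exponent r s k)) * (z * t) ^ k
    in
    ∃[ P ] ∃[ D ] Σ[ D≢0 ∈ NonZero D ]
      ( ⟨ y * t ⨾ q ⟩∞≡ P
      × ⟨ x * t ⨾ q ⟩∞≡ D
      × (s ℤ.< r ⊎ (s ≡ r × ∣ z * t * q^ (α - fromℤ s) ∣< 1ℝ) → ∃[ S ] rhs sumsTo S)
      × (∀ S → rhs sumsTo S →
          (λ n → L̃ r s n α x y z a * (t ^ n / ⟨ q ⨾ q ⟩ n [ [q⨾q]≢0 n ]))
            sumsTo (P / D [ D≢0 ] * S)) ) )
  ×
  ( ∣ z * t ∣< 1ℝ → ∣ x * t ∣< 1ℝ →
    (p≢0 : ∀ n (k : Fin (suc n)) →
      NonZero (cauchy (toℕ k) y (x * q^ℤ (1ℤ ℤ.- + n)))) →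
    let rhs : ℕ → ℂ
        rhs = ₂Φ₁-term (- q^ (- α)) a (- q) [-q⨾q]≢0 (z * t * q^ α)
        inner : ℕ → ℂ
        inner n = sum {suc n} λ i → let k = toℕ i in
          [ fromℤ (+ n) , k ]q * [ α , k ]-q
            * (((- 1ℂ) ^ k * q^ℤ (+ k ℤ.* (+ k ℤ.- + n)) * ⟨ a ⨾ q ⟩ k)
                / cauchy k y (x * q^ℤ (1ℤ ℤ.- + n)) [ p≢0 n i ])
            * z ^ k
    in
    ∃[ P ] ∃[ D ] Σ[ D≢0 ∈ NonZero D ]
      ( ⟨ y * t ⨾ q ⟩∞≡ P
      × ⟨ x * t ⨾ q ⟩∞≡ D
      × (∣ z * t * q^ α ∣< 1ℝ → ∃[ S ] rhs sumsTo S)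
      × (∀ S → rhs sumsTo S →
          (λ n → (cauchy n x y * t ^ n) / ⟨ q ⨾ q ⟩ n [ [q⨾q]≢0 n ] * inner n)
            sumsTo (P / D [ D≢0 ] * S)) ) )
theorem6 ℝ q q≢0 q<1 q^ isPower α x y z a t =
  (λ r s _ _ xt<1 →
      P xt<1 , D xt<1 , D≢0 xt<1 , yt→P xt<1 , xt→D xt<1
    , E.rhs-converges r s
    , λ S rhs→S → convolve-sums xt<1 {term-i r s} {E.rhs r s} {S} (term-i≈ r s) rhs→S)
  , λ _ xt<1 p≢0 →
      P xt<1 , D xt<1 , D≢0 xt<1 , yt→P xt<1 , xt→D xt<1
    , E.Φ-converges
    , λ S Φ→S → convolve-sums xt<1 {term-ii p≢0} {E.Φ} {S} (term-ii≈ p≢0) Φ→S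
  where
  open ComplexQSeries ℝ
  open WithParameters {q} q≢0 q<1 {q^} isPower α x y z a t
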